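{- Let $\widetilde T=-E+H+X-SXS+Y-U^2YU+Z-U^2ZU\in\widehat{\mathcal R}$ (with $E,H,X,Y,Z$ as in the context), and write $\widetilde T=\sum_{n\ge1}\widetilde T_n$ with $\widetilde T_n\in\mathbb Q[\mathcal M_n]$. Then (a) $\widetilde T\pi_S\in\pi_U\widehat{\mathcal R}$ and $\widetilde T\pi_U\in\pi_S\widehat{\mathcal R}$; equivalently, for each $n$, $\widetilde T_n(1+S)\in(1+U+U^2)\mathbb Q[\mathcal M_n]$ and $\widetilde T_n(1+U+U^2)\in(1+S)\mathbb Q[\mathcal M_n]$; (b) $\langle\widetilde T,K\rangle=-1$ for every right coset $K=M\Gamma$, $M\in\mathcal M$.
   Context: Let $\Gamma=\mathrm{PSL}_2(\mathbb Z)$, $S=\pm\begin{pmatrix}0&-1\\1&0\end{pmatrix}$, $U=\pm\begin{pmatrix}1&-1\\1&0\end{pmatrix}$, $\pi_S=(1+S)/2$, $\pi_U=(1+U+U^2)/3$ ($1$ = identity). Let $\mathcal M_n$ be the set of integer $2\times2$ matrices of determinant $n$ modulo $\pm1$, $\mathcal M=\bigcup_n\mathcal M_n$, and $\widehat{\mathcal R}=\prod_{n\ge1}\mathbb Q[\mathcal M_n]$, formal $\mathbb Q$-linear combinations of elements of $\mathcal M$ with finitely many terms of each determinant; $\mathbb Q[\Gamma]$ acts on both sides by matrix multiplication. For $\xi=\sum c_MM$ and $\mathcal S\subset\mathcal M$, $\langle\xi,\mathcal S\rangle=\sum_{M\in\mathcal S}c_M$. Elements of $\mathcal M$ are represented by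 $M=\begin{pmatrix}a&b\\c&d\end{pmatrix}$ with $c\ge0$. Notation $\left\langle{L_1\atop L_2}\right\rangle$, for two lines of inequalities in $a,b,c,d$: the formal sum $\sum c(M)M$ over such $M$ satisfying all inequalities, with $c(M)=1$ if no inequality of the first line $L_1$ is an equality, $1/2$ if exactly one is, and if exactly two are, $1/4$, $1/3$, $1/6$ according as they are independent ($A\le B$, $C\le D$), overlapping ($A\le B$, $A\le C$) or nested ($A\le B\le C$). Let $\mathcal F=\{z\in\mathbb H:0\le\operatorname{Re}z\le1/2,\ |z-1|\ge1\}$, $\chi(z)=1/(2\pi)$ times the angle subtended by $\mathcal F$ at $z$; for elliptic $M$ ($\operatorname{tr}(M)^2<4\det M$) let $z_M\in\mathbb H$ be its fixed point. Define $E=\sum_{M\text{ elliptic}}\chi(z_M)M$, $H=\left\langle{a-d\le-b\le c\atop c=0<a}\right\rangle$, $X=\left\langle{0\le a-d;\ -b\le c\atop b<0<d}\right\rangle$, $Y=\left\langle{a-d\le-b\le c\atop 0<c<a}\right\rangle$, $Z=\left\langle{a-d\le c\le-b\atop 0<a;\ 0<c}\right\rangle$. (The element $\widetilde T$ indeed lies in $\widehat{\mathcal R}$.) -}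

module Defs where

open import Data.Bool using (Bool; true; false; _∧_; not; if_then_else_)
open import Data.Nat as ℕ using (ℕ)
open import Data.Integer as ℤ using (ℤ; +_; -[1+_])
import Data.Integer.Properties as ℤP
open import Data.Rational as ℚ using (ℚ; 0ℚ; 1ℚ; ½)
import Data.Rational.Properties as ℚP
open import Data.List using (List; []; _∷_; map; foldr)
open import Data.List.Relation.Unary.All using (All)
open import Data.List.Relation.Unary.Any using (Any)
open import Data.List.Relation.Unary.AllPairs using (AllPairs)
open import Data.Product using (_×_; _,_; ∃; proj₁; proj₂)
open import Data.Sum using (_⊎_)
open import Relation.Nullary using (¬_; does)
open import Relation.Binary.PropositionalEquality using (_≡_)

record Mat : Set where
  constructor mat
  field
    a b c d : ℤ
open Mat public

det : Mat → ℤ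
det (mat a b c d) = a ℤ.* d ℤ.- b ℤ.* c

tr : Mat → ℤ
tr (mat a b c d) = a ℤ.+ d

_·_ : Mat → Mat → Mat
mat a b c d · mat a' b' c' d' =
  mat (a ℤ.* a' ℤ.+ b ℤ.* c') (a ℤ.* b' ℤ.+ b ℤ.* d')
      (c ℤ.* a' ℤ.+ d ℤ.* c') (c ℤ.* b' ℤ.+ d ℤ.* d')
infixl 7 _·_

neg : Mat → Mat
neg (mat a b c d) = mat (ℤ.- a) (ℤ.- b) (ℤ.- c) (ℤ.- d)

adj : Mat → Mat
adj (mat a b c d) = mat d (ℤ.- b) (ℤ.- c) a

-- equality in M = matrices modulo ±1
_~_ : Mat → Mat → Set
M ~ N = M ≡ N ⊎ M ≡ neg N

_==_ : ℤ → ℤ → Bool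
x == y = does (x ℤ.≟ y)

_≤ᵇ_ : ℤ → ℤ → Bool
x ≤ᵇ y = does (x ℤP.≤? y)

_<ᵇ_ : ℤ → ℤ → Bool
x <ᵇ y = does (x ℤP.<? y)

infix 4 _==_ _≤ᵇ_ _<ᵇ_

matEq : Mat → Mat → Bool
matEq (mat a b c d) (mat a' b' c' d') = (a == a') ∧ (b == b') ∧ (c == c') ∧ (d == d')

simᵇ : Mat → Mat → Bool
simᵇ M N = matEq M N Data.Bool.∨ matEq M (neg N)
  where import Data.Bool

-- Formal Q-linear combinations of elements of M, given by their
-- coefficient function (a function on matrices, invariant under ±).

Coef : Set
Coef = Mat → ℚ

_⊕_ : Coef → Coef → Coef
(f ⊕ g) N = f N ℚ.+ g N
infixl 6 _⊕_

⊖_ : Coef → Coef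
(⊖ f) N = ℚ.- f N

-- left multiplication by γ ∈ Γ:  γ (Σ c_M M) = Σ c_M (γM),
-- so the coefficient at N is c at γ⁻¹ N.
_▹_ : Mat → Coef → Coef
(γ ▹ f) N = f (adj γ · N)
infixr 8 _▹_

-- right multiplication by γ ∈ Γ: coefficient at N is c at N γ⁻¹.
_◃_ : Coef → Mat → Coef
(f ◃ γ) N = f (N · adj γ)
infixl 8 _◃_

-- A finite formal sum Σ qᵢ Mᵢ (an element of Q[M]) and its coefficients:
-- the coefficient at the class of N is the sum of qᵢ over Mᵢ ~ N.
FinSum : Set
FinSum = List (ℚ × Mat)

coeff : FinSum → Coef
coeff [] N = 0ℚ
coeff ((q , M) ∷ xs) N = (if simᵇ M N then q else 0ℚ) ℚ.+ coeff xs N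

restrict : ℕ → Coef → Coef
restrict n f N = if det N == + n then f N else 0ℚ

S U : Mat
S = mat (+ 0) (ℤ.- + 1) (+ 1) (+ 0)
U = mat (+ 1) (ℤ.- + 1) (+ 1) (+ 0)

-- The bracket notation  < L₁ / L₂ >.  The coefficient of a class is the
-- sum over its representatives R ∈ {M, -M} with c ≥ 0 that satisfy all
-- inequalities, of the weight c(R) determined by the equalities among
-- the inequalities of the first line.

-- weight for two nested inequalities A ≤ B ≤ C (e₁ : A = B, e₂ : B = C)
wNested : Bool → Bool → ℚ
wNested true  true  = + 1 ℚ./ 6
wNested true  false = ½
wNested false true  = ½
wNested false false = 1ℚ

wIndep : Bool → Bool → ℚ
wIndep true  true  = + 1 ℚ./ 4
wIndep true  false = ½
wIndep false true  = ½
wIndep false false = 1ℚ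

overReps : (Mat → ℚ) → Coef
overReps f M = f M ℚ.+ f (neg M)

when : Bool → ℚ → ℚ
when b q = if b then q else 0ℚ

-- H = < a-d ≤ -b ≤ c / c = 0 < a >
Hrep : Mat → ℚ
Hrep (mat a b c d) =
  when ((+ 0 ≤ᵇ c) ∧ (c == + 0) ∧ (+ 0 <ᵇ a)
        ∧ (a ℤ.- d ≤ᵇ ℤ.- b) ∧ (ℤ.- b ≤ᵇ c))
       (wNested (a ℤ.- d == ℤ.- b) (ℤ.- b == c))

-- X = < 0 ≤ a-d ; -b ≤ c / b < 0 < d >
Xrep : Mat → ℚ
Xrep (mat a b c d) =
  when ((+ 0 ≤ᵇ c) ∧ (b <ᵇ + 0) ∧ (+ 0 <ᵇ d)
        ∧ (+ 0 ≤ᵇ a ℤ.- d) ∧ (ℤ.- b ≤ᵇ c))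
       (wIndep (+ 0 == a ℤ.- d) (ℤ.- b == c))

-- Y = < a-d ≤ -b ≤ c / 0 < c < a >
Yrep : Mat → ℚ
Yrep (mat a b c d) =
  when ((+ 0 ≤ᵇ c) ∧ (+ 0 <ᵇ c) ∧ (c <ᵇ a)
        ∧ (a ℤ.- d ≤ᵇ ℤ.- b) ∧ (ℤ.- b ≤ᵇ c))
       (wNested (a ℤ.- d == ℤ.- b) (ℤ.- b == c))

-- Z = < a-d ≤ c ≤ -b / 0 < a ; 0 < c >
Zrep : Mat → ℚ
Zrep (mat a b c d) =
  when ((+ 0 ≤ᵇ c) ∧ (+ 0 <ᵇ a) ∧ (+ 0 <ᵇ c)
        ∧ (a ℤ.- d ≤ᵇ c) ∧ (c ≤ᵇ ℤ.- b))
       (wNested (a ℤ.- d == c) (c == ℤ.- b))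

H X Y Z : Coef
H = overReps Hrep
X = overReps Xrep
Y = overReps Yrep
Z = overReps Zrep

-- E = Σ_{M elliptic} χ(z_M) M

elliptic : Mat → Bool
elliptic M = tr M ℤ.* tr M <ᵇ + 4 ℤ.* det M

_≤ℚ_ _≡ℚ_ : ℚ → ℚ → Bool
p ≤ℚ q = does (p ℚP.≤? q)
p ≡ℚ q = does (p ℚP.≟ q)

-- χ(z)/(angle / 2π) for z = x + i·√y2 (y2 > 0), for the region
-- F = {0 ≤ Re z ≤ 1/2, |z-1| ≥ 1}.  F is bounded (inside ℍ) by the three
-- curves Re z = 0, Re z = 1/2, |z-1| = 1; the only point of ℍ lying on
-- two of them is the corner ρ = 1/2 + i√3/2, where the interior angle
-- of F is 2π/3.  Hence χ = 1 on the interior, 1/2 on the open edges,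
-- 1/3 at ρ, and 0 outside F.
χ : ℚ → ℚ → ℚ
χ x y2 = if inF then value else 0ℚ
  where
    circ : ℚ
    circ = (x ℚ.- 1ℚ) ℚ.* (x ℚ.- 1ℚ) ℚ.+ y2
    inF : Bool
    inF = (0ℚ ≤ℚ x) ∧ (x ≤ℚ ½) ∧ (1ℚ ≤ℚ circ)
    e₁ e₂ e₃ : Bool
    e₁ = x ≡ℚ 0ℚ
    e₂ = x ≡ℚ ½
    e₃ = circ ≡ℚ 1ℚ
    value : ℚ
    value = if e₂ ∧ e₃ then + 1 ℚ./ 3
            else if e₁ Data.Bool.∨ e₂ Data.Bool.∨ e₃ then ½ else 1ℚ
      where import Data.Bool

-- For a representative with c > 0 the fixed point in ℍ of z ↦ (az+b)/(cz+d)
-- is z_M = x + i y with x = (a-d)/(2c), y² = (4 det M - (a+d)²)/(4c²).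
-- Elliptic matrices have c ≠ 0, so exactly one of ±M has c > 0.
Erep : Mat → ℚ
Erep M@(mat a b (+ ℕ.suc k) d) =
  when (elliptic M)
       (χ ((a ℤ.- d) ℚ./ (2 ℕ.* ℕ.suc k))
          ((+ 4 ℤ.* det M ℤ.- tr M ℤ.* tr M) ℚ./ (4 ℕ.* ℕ.suc k ℕ.* ℕ.suc k)))
Erep _ = 0ℚ

E : Coef
E = overReps Erep

T̃ : Coef
T̃ = ⊖ E ⊕ H ⊕ X ⊕ ⊖ (S ▹ (X ◃ S)) ⊕ Y ⊕ ⊖ ((U · U) ▹ (Y ◃ U))
      ⊕ Z ⊕ ⊖ ((U · U) ▹ (Z ◃ U))

InCoset : Mat → Mat → Set
InCoset M N = ∃ λ γ → det γ ≡ + 1 × N ~ (M · γ)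

sumℚ : List ℚ → ℚ
sumℚ = foldr ℚ._+_ 0ℚ

{-# OPTIONS --safe #-}
module Submission where

open import Defs
open import Data.Nat using (ℕ; _≤_)
open import Data.Integer using (+_; -[1+_])
open import Data.Rational using (ℚ)
open import Data.Product using (_×_; _,_; ∃)
open import Data.List using (List; map)
open import Data.List.Relation.Unary.All using (All)
open import Data.List.Relation.Unary.Any using (Any)
open import Data.List.Relation.Unary.AllPairs using (AllPairs)
open import Relation.Nullary using (¬_)
open import Relation.Binary.PropositionalEquality using (_≡_)

open import Algebra.Bundles using (CommutativeMonoid)
open import Data.Bool using (Bool; true; false; _∧_; _∨_; if_then_else_)
open import Data.Bool.Properties using (∧-zeroʳ)
open import Data.Nat as ℕ using (zero; suc; s≤s; z≤n)
import Data.Nat.Properties as ℕP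
import Data.Nat.Tactic.RingSolver as ℕSolver
open import Data.Nat.Induction using (<-wellFounded)
open import Induction.WellFounded using (Acc; acc)
open import Data.Integer as ℤ using (ℤ; _+_; _*_; -_; _-_; _<_; +<+; +≤+; ∣_∣)
import Data.Integer.Properties as ℤP
import Data.Integer.DivMod as DivMod
open import Data.Integer.Tactic.RingSolver using (solve-∀)
open import Data.Rational as ℚ using (0ℚ; 1ℚ; ½; toℚᵘ)
import Data.Rational.Properties as ℚP
open import Data.Rational.Unnormalised as ℚᵘ using (ℚᵘ; mkℚᵘ; *≡*; *≤*; _≃_)
import Data.Rational.Unnormalised.Properties as ℚᵘP
open import Data.Product using (proj₁; proj₂)
open import Data.Sum using (_⊎_; inj₁; inj₂)
open import Data.Vec using (Vec; []; _∷_; zipWith)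
open import Data.Vec.Properties using (≡-dec)
open import Data.List
  using ([]; _∷_; _++_; upTo; applyUpTo; filter; deduplicate; cartesianProductWith)
open import Data.List.Properties using (∷-injective; map-∘; map-++; map-applyUpTo)
open import Data.List.Membership.Propositional using (_∈_)
import Data.List.Membership.Propositional.Properties as ∈P
open import Data.List.Relation.Unary.Any as Any using (here; there)
import Data.List.Relation.Unary.Any.Properties as AnyP
open import Data.List.Relation.Unary.All as All using ([]; _∷_)
import Data.List.Relation.Unary.All.Properties as AllP
open import Data.List.Relation.Unary.AllPairs as AllPairs using ([]; _∷_)
import Data.List.Relation.Unary.AllPairs.Properties as AllPairsP
open import Data.List.Relation.Unary.Unique.DecSetoid.Properties using (deduplicate-!)
open import Function using (_∘_)
open import Function.Bundles using (mk⇔)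
open import Relation.Nullary using (Dec; does; yes; no; contradiction)
open import Relation.Nullary.Decidable
  using (map′; _×-dec_; _⊎-dec_; toWitness; does-⇔; dec-true; dec-false; decidable-stable)
open import Relation.Binary.Bundles using (DecSetoid)
open import Relation.Binary.PropositionalEquality
  using (refl; sym; trans; cong; cong₂; subst; subst₂; module ≡-Reasoning)

-- With m = −b and p = a − d, the coefficients of T̃ depend only on the signs of integral linear
-- forms in the entries, and on matrices of positive determinant the E, H, X, Y, Z terms telescope
-- to four cones, with the weights of the bracket notation:
--   T̃ = Σ± [0 ≤ c < a] ⟨p ≤ m ≤ c⟩ − [c > 0 ≥ a] ⟨0 ≤ p⟩⟨p ≤ c ≤ m⟩
--         − [m > 0 ≥ d] ⟨0 ≤ p⟩⟨p ≤ m ≤ c⟩ − [−m < d ≤ 0] ⟨m ≤ p ≤ c⟩.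
-- Part (a) says that T̃(1 + S) is invariant under left multiplication by U, and T̃(1 + U + U²)
-- under S.  Each is an identity between functions of the signs of 12, respectively 18, linear
-- forms, and it holds on every sign vector allowed by the three-term relations l + m + n = 0 and
-- the relations k l + m n = det > 0 among these forms.
-- For (b), let t(M) be the sum of T̃ over MΓ.  Summing (a) gives 2 t(UM) = 2 t(M) and
-- 3 t(SM) = 3 t(M), so t is constant on double cosets ΓMΓ, and by Smith normal form and
-- homogeneity M may be taken to be diag(1, k).  There T̃ is supported on the matrices (1, y; 0, k)
-- and (x, −1; k, 0), up to one more matrix for k = 1, whose coefficients add up to −1.

-- Signs of linear forms

-- Membership becomes invariance by averaging: since U³ and S² are ±1, a left U-invariant h equals
-- (1 + U + U²)(h/3), and a left S-invariant h equals (1 + S)(h/2). This also supplies the finite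
-- sums asked for in (a). The identities between brackets have many boundary cases with fractional
-- weights; signs that include zero treat open cones and their walls alike. To compare coefficients
-- at N with those at γ N δ, the listed forms contain, up to sign, every form that arises by
-- substitution, so both sides become functions of one sign vector. Forms are added one at a time
-- and a branch is cut as soon as a relation fails, instead of running through all 3¹⁸ vectors.
-- Infinite sums over a coset are given by finite lists that contain the support; such lists exist
-- because matrices of determinant n in the cones have entries at most n in absolute value. The
-- telescoping uses det > 0, so the function of signs replaces `T̃` only there.

data Sgn : Set where
  ⁻ ⁰ ⁺ : Sgn

sgn : ℤ → Sgn
sgn (+ 0) = ⁰
sgn (+ suc _) = ⁺
sgn -[1+ _ ] = ⁻

flip : Sgn → Sgn
flip ⁻ = ⁺
flip ⁰ = ⁰
flip ⁺ = ⁻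

sgn-neg : ∀ x → sgn (- x) ≡ flip (sgn x)
sgn-neg (+ 0) = refl
sgn-neg (+ suc _) = refl
sgn-neg -[1+ _ ] = refl

isPos isNeg isZero isNN : Sgn → Bool
isPos ⁺ = true
isPos _ = false
isNeg ⁻ = true
isNeg _ = false
isZero ⁰ = true
isZero _ = false
isNN ⁻ = false
isNN _ = true

-- A matrix F also stands for the linear form N ↦ tr(Fᵗ N).
⟪_,_⟫ : Mat → Mat → ℤ
⟪ mat x y z w , mat a b c d ⟫ = x * a + y * b + z * c + w * d

transpose : Mat → Mat
transpose (mat a b c d) = mat a c b d

infixl 6 _⊞_
_⊞_ : Mat → Mat → Mat
mat a b c d ⊞ mat a' b' c' d' = mat (a + a') (b + b') (c + c') (d + d')

0ₘ : Mat
0ₘ = mat (+ 0) (+ 0) (+ 0) (+ 0)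

mat≡ : ∀ {a b c d a' b' c' d'} → a ≡ a' → b ≡ b' → c ≡ c' → d ≡ d' →
       mat a b c d ≡ mat a' b' c' d'
mat≡ refl refl refl refl = refl

infix 4 _≟ₘ_
_≟ₘ_ : (M N : Mat) → Dec (M ≡ N)
mat a b c d ≟ₘ mat a' b' c' d' =
  map′ (λ { (p , q , r , s) → mat≡ p q r s }) (λ { refl → refl , refl , refl , refl })
       (a ℤ.≟ a' ×-dec b ℤ.≟ b' ×-dec c ℤ.≟ c' ×-dec d ℤ.≟ d')

⟪⟫-neg : ∀ F N → ⟪ neg F , N ⟫ ≡ - ⟪ F , N ⟫
⟪⟫-neg (mat x y z w) (mat a b c d) = lem x y z w a b c d
  where
  lem : ∀ x y z w a b c d → - x * a + - y * b + - z * c + - w * d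
        ≡ - (x * a + y * b + z * c + w * d)
  lem = solve-∀

⟪⟫-negʳ : ∀ F N → ⟪ F , neg N ⟫ ≡ - ⟪ F , N ⟫
⟪⟫-negʳ (mat x y z w) (mat a b c d) = lem x y z w a b c d
  where
  lem : ∀ x y z w a b c d → x * - a + y * - b + z * - c + w * - d
        ≡ - (x * a + y * b + z * c + w * d)
  lem = solve-∀

⟪⟫-⊞ : ∀ F G N → ⟪ F ⊞ G , N ⟫ ≡ ⟪ F , N ⟫ + ⟪ G , N ⟫
⟪⟫-⊞ (mat x y z w) (mat x' y' z' w') (mat a b c d) = lem x y z w x' y' z' w' a b c d
  where
  lem : ∀ x y z w x' y' z' w' a b c d →
        (x + x') * a + (y + y') * b + (z + z') * c + (w + w') * d
        ≡ x * a + y * b + z * c + w * d + (x' * a + y' * b + z' * c + w' * d)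
  lem = solve-∀

-- tr(Fᵗ N γ) = tr((F γᵗ)ᵗ N): a factor on the matrix moves to the form as its transpose. With the
-- left version, a form evaluated at γ N δ is another form evaluated at N.
⟪⟫-·ʳ : ∀ F N γ → ⟪ F , N · γ ⟫ ≡ ⟪ F · transpose γ , N ⟫
⟪⟫-·ʳ (mat x y z w) (mat a b c d) (mat e f g h) = lem x y z w a b c d e f g h
  where
  lem : ∀ x y z w a b c d e f g h →
        x * (a * e + b * g) + y * (a * f + b * h) + z * (c * e + d * g) + w * (c * f + d * h)
        ≡ (x * e + y * f) * a + (x * g + y * h) * b + (z * e + w * f) * c + (z * g + w * h) * d
  lem = solve-∀

⟪⟫-·ˡ : ∀ F γ N → ⟪ F , γ · N ⟫ ≡ ⟪ transpose γ · F , N ⟫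
⟪⟫-·ˡ (mat x y z w) (mat e f g h) (mat a b c d) = lem x y z w a b c d e f g h
  where
  lem : ∀ x y z w a b c d e f g h →
        x * (e * a + f * c) + y * (e * b + f * d) + z * (g * a + h * c) + w * (g * b + h * d)
        ≡ (e * x + g * z) * a + (e * y + g * w) * b + (f * x + h * z) * c + (f * y + h * w) * d
  lem = solve-∀

⟪0⟫ : ∀ N → ⟪ 0ₘ , N ⟫ ≡ + 0
⟪0⟫ (mat a b c d) = refl

σ : Mat → Mat → Sgn
σ N F = sgn ⟪ F , N ⟫

-- A literal is a position in a list of forms, taken with a sign.
data Literal : Set where
  plus minus : ℕ → Literal

nth : ∀ {A : Set} → A → List A → ℕ → A
nth d [] _ = d
nth d (x ∷ xs) zero = x
nth d (x ∷ xs) (suc n) = nth d xs n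

formAt : List Mat → Literal → Mat
formAt A (plus i) = nth 0ₘ A i
formAt A (minus i) = neg (nth 0ₘ A i)

sgnAt : List Sgn → Literal → Sgn
sgnAt s (plus i) = nth ⁰ s i
sgnAt s (minus i) = flip (nth ⁰ s i)

nth-σ : ∀ N A i → nth ⁰ (map (σ N) A) i ≡ σ N (nth 0ₘ A i)
-- The two defaults match: past the end the form is `0ₘ`, whose sign is `⁰` on every matrix.
nth-σ N [] i = sym (cong sgn (⟪0⟫ N))
nth-σ N (F ∷ A) zero = refl
nth-σ N (F ∷ A) (suc i) = nth-σ N A i

σ-neg : ∀ N F → σ N (neg F) ≡ flip (σ N F)
σ-neg N F = trans (cong sgn (⟪⟫-neg F N)) (sgn-neg ⟪ F , N ⟫)

sgnAt-σ : ∀ N A l → sgnAt (map (σ N) A) l ≡ σ N (formAt A l)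
sgnAt-σ N A (plus i) = nth-σ N A i
sgnAt-σ N A (minus i) = trans (cong flip (nth-σ N A i)) (sym (σ-neg N (nth 0ₘ A i)))

-- A form absent up to sign gets the position past the end, which denotes `0ₘ`. The search carries
-- no proof; `Located` checks its answers afterwards.
locate : List Mat → Mat → Literal
locate A F = go 0 A
  where
  go : ℕ → List Mat → Literal
  go i [] = plus i
  go i (G ∷ A) = if does (F ≟ₘ G) then plus i
                 else if does (F ≟ₘ neg G) then minus i else go (suc i) A

-- A relation among the forms at the given literals:
-- l + m + n = 0, respectively k l + m n = det.
data SignRule : Set where
  lin : (l m n : Literal) → SignRule
  quad : (k l m n : Literal) → SignRule

dot : ∀ {n} → Vec ℤ n → Vec ℤ n → ℤ
dot [] [] = + 0
dot (e ∷ es) (x ∷ xs) = e * x + dot es xs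

dot-+ : ∀ {n} (es fs xs : Vec ℤ n) → dot (zipWith _+_ es fs) xs ≡ dot es xs + dot fs xs
dot-+ [] [] [] = refl
dot-+ (e ∷ es) (f ∷ fs) (x ∷ xs) = trans (cong (λ t → (e + f) * x + t) (dot-+ es fs xs))
                                          (lem e f x (dot es xs) (dot fs xs))
  where
  lem : ∀ e f x p q → (e + f) * x + (p + q) ≡ (e * x + p) + (f * x + q)
  lem = solve-∀

monomials : Mat → Vec ℤ 10
monomials (mat a b c d) = a * a ∷ b * b ∷ c * c ∷ d * d ∷ a * b ∷ a * c ∷ a * d ∷
                          b * c ∷ b * d ∷ c * d ∷ []

-- Coefficients of the product of two linear forms, in the order of `monomials`. A relation k l + m
-- n = det thereby becomes an equality of integer vectors, which `valid?` decides.
_⊗_ : Mat → Mat → Vec ℤ 10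
mat x y z w ⊗ mat x' y' z' w' =
  x * x' ∷ y * y' ∷ z * z' ∷ w * w' ∷ x * y' + y * x' ∷ x * z' + z * x' ∷
  x * w' + w * x' ∷ y * z' + z * y' ∷ y * w' + w * y' ∷ z * w' + w * z' ∷ []

dot-⊗ : ∀ F G N → dot (F ⊗ G) (monomials N) ≡ ⟪ F , N ⟫ * ⟪ G , N ⟫
dot-⊗ (mat x y z w) (mat x' y' z' w') (mat a b c d) = lem x y z w x' y' z' w' a b c d
  where
  lem : ∀ x y z w x' y' z' w' a b c d →
        (x * x') * (a * a) + ((y * y') * (b * b) + ((z * z') * (c * c) + ((w * w') * (d * d)
        + ((x * y' + y * x') * (a * b) + ((x * z' + z * x') * (a * c)
        + ((x * w' + w * x') * (a * d) + ((y * z' + z * y') * (b * c)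
        + ((y * w' + w * y') * (b * d) + ((z * w' + w * z') * (c * d) + + 0)))))))))
        ≡ (x * a + y * b + z * c + w * d) * (x' * a + y' * b + z' * c + w' * d)
  lem = solve-∀

detForm : Vec ℤ 10
detForm = + 0 ∷ + 0 ∷ + 0 ∷ + 0 ∷ + 0 ∷ + 0 ∷ + 1 ∷ -[1+ 0 ] ∷ + 0 ∷ + 0 ∷ []

dot-det : ∀ N → dot detForm (monomials N) ≡ det N
dot-det (mat a b c d) =
  lem (a * a) (b * b) (c * c) (d * d) (a * b) (a * c) (a * d) (b * c) (b * d) (c * d)
  where
  lem : ∀ aa bb cc dd ab ac ad bc bd cd →
        + 0 * aa + (+ 0 * bb + (+ 0 * cc + (+ 0 * dd + (+ 0 * ab + (+ 0 * ac
        + (+ 1 * ad + (-[1+ 0 ] * bc + (+ 0 * bd + (+ 0 * cd + + 0))))))))) ≡ ad - bc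
  lem = solve-∀

Valid : List Mat → SignRule → Set
Valid A (lin l m n) = formAt A l ⊞ formAt A m ⊞ formAt A n ≡ 0ₘ
Valid A (quad k l m n) =
  zipWith _+_ (formAt A k ⊗ formAt A l) (formAt A m ⊗ formAt A n) ≡ detForm

valid? : ∀ A r → Dec (Valid A r)
valid? A (lin l m n) = formAt A l ⊞ formAt A m ⊞ formAt A n ≟ₘ 0ₘ
valid? A (quad k l m n) =
  ≡-dec ℤ._≟_ (zipWith _+_ (formAt A k ⊗ formAt A l) (formAt A m ⊗ formAt A n)) detForm

-- Three integers of sum zero are all zero or include both a positive and a negative one.
cancels : Sgn → Sgn → Sgn → Bool
cancels ⁰ ⁰ ⁰ = true
cancels ⁰ ⁰ _ = false
cancels ⁰ ⁺ t = isNeg t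
cancels ⁰ ⁻ t = isPos t
cancels ⁺ ⁻ _ = true
cancels ⁺ _ t = isNeg t
cancels ⁻ ⁺ _ = true
cancels ⁻ _ t = isPos t

_⊠_ : Sgn → Sgn → Sgn
⁰ ⊠ _ = ⁰
⁺ ⊠ t = t
⁻ ⊠ t = flip t

-- Of a quadratic relation only det > 0 is kept: two products with positive sum cannot both be
-- nonpositive.
holds : List Sgn → SignRule → Bool
holds s (lin l m n) = cancels (sgnAt s l) (sgnAt s m) (sgnAt s n)
holds s (quad k l m n) =
  isPos (sgnAt s k ⊠ sgnAt s l) ∨ isPos (sgnAt s m ⊠ sgnAt s n)

cancels-sgn : ∀ x y z → x + y + z ≡ + 0 → cancels (sgn x) (sgn y) (sgn z) ≡ true
cancels-sgn (+ 0) (+ 0) (+ 0) _ = refl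
cancels-sgn (+ 0) (+ suc _) -[1+ _ ] _ = refl
cancels-sgn (+ 0) -[1+ _ ] (+ suc _) _ = refl
cancels-sgn (+ suc _) -[1+ _ ] _ _ = refl
cancels-sgn (+ suc _) (+ 0) -[1+ _ ] _ = refl
cancels-sgn (+ suc _) (+ suc _) -[1+ _ ] _ = refl
cancels-sgn -[1+ _ ] (+ suc _) _ _ = refl
cancels-sgn -[1+ _ ] (+ 0) (+ suc _) _ = refl
cancels-sgn -[1+ _ ] -[1+ _ ] (+ suc _) _ = refl

sgn-* : ∀ x y → sgn (x * y) ≡ sgn x ⊠ sgn y
sgn-* (+ 0) y = refl
sgn-* (+ suc m) (+ 0) = cong sgn (ℤP.*-zeroʳ (+ suc m))
sgn-* (+ suc _) (+ suc _) = refl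
sgn-* (+ suc _) -[1+ _ ] = refl
sgn-* -[1+ m ] (+ 0) = cong sgn (ℤP.*-zeroʳ -[1+ m ])
sgn-* -[1+ _ ] (+ suc _) = refl
sgn-* -[1+ _ ] -[1+ _ ] = refl

positive-summand : ∀ x y → + 0 < x + y → isPos (sgn x) ∨ isPos (sgn y) ≡ true
positive-summand (+ suc _) _ _ = refl
positive-summand (+ 0) (+ suc _) _ = refl
positive-summand -[1+ _ ] (+ suc _) _ = refl
positive-summand (+ 0) (+ 0) (+<+ ())
positive-summand (+ 0) -[1+ _ ] ()
positive-summand -[1+ _ ] (+ 0) ()
positive-summand -[1+ _ ] -[1+ _ ] ()

holds-σ : ∀ A N → + 0 < det N → ∀ r → Valid A r → holds (map (σ N) A) r ≡ true
holds-σ A N det>0 (lin l m n) v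
  rewrite sgnAt-σ N A l | sgnAt-σ N A m | sgnAt-σ N A n =
  cancels-sgn ⟪ F , N ⟫ ⟪ G , N ⟫ ⟪ K , N ⟫ (begin
    ⟪ F , N ⟫ + ⟪ G , N ⟫ + ⟪ K , N ⟫  ≡⟨ cong (_+ ⟪ K , N ⟫) (⟪⟫-⊞ F G N) ⟨
    ⟪ F ⊞ G , N ⟫ + ⟪ K , N ⟫          ≡⟨ ⟪⟫-⊞ (F ⊞ G) K N ⟨
    ⟪ F ⊞ G ⊞ K , N ⟫                  ≡⟨ cong ⟪_, N ⟫ v ⟩
    ⟪ 0ₘ , N ⟫                         ≡⟨ ⟪0⟫ N ⟩
    + 0                                ∎)
  where
  open ≡-Reasoning
  F = formAt A l
  G = formAt A m
  K = formAt A n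
holds-σ A N det>0 (quad k l m n) v
  rewrite sgnAt-σ N A k | sgnAt-σ N A l | sgnAt-σ N A m | sgnAt-σ N A n
        | sym (sgn-* ⟪ formAt A k , N ⟫ ⟪ formAt A l , N ⟫)
        | sym (sgn-* ⟪ formAt A m , N ⟫ ⟪ formAt A n , N ⟫) =
  positive-summand (⟪ F , N ⟫ * ⟪ G , N ⟫) (⟪ K , N ⟫ * ⟪ L , N ⟫) (subst (+ 0 <_) (begin
    det N                                                       ≡⟨ dot-det N ⟨
    dot detForm V                                               ≡⟨ cong (λ q → dot q V) v ⟨
    dot (zipWith _+_ (F ⊗ G) (K ⊗ L)) V                         ≡⟨ dot-+ (F ⊗ G) (K ⊗ L) V ⟩
    dot (F ⊗ G) V + dot (K ⊗ L) V                               ≡⟨ cong₂ _+_ (dot-⊗ F G N) (dot-⊗ K L N) ⟩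
    ⟪ F , N ⟫ * ⟪ G , N ⟫ + ⟪ K , N ⟫ * ⟪ L , N ⟫               ∎) det>0)
  where
  open ≡-Reasoning
  F = formAt A k
  G = formAt A l
  K = formAt A m
  L = formAt A n
  V = monomials N

-- An arrangement lists forms latest first, each with the relations between it
-- and the forms after it.
Arrangement : Set
Arrangement = List (Mat × List SignRule)

forms : Arrangement → List Mat
forms = map proj₁

-- Positions in the rules of `F` are counted in `F ∷ forms A`: 0 is `F` itself, larger numbers are
-- the forms introduced before it.
data ValidArr : Arrangement → Set where
  [] : ValidArr []
  _∷_ : ∀ {F rs A} → All (Valid (F ∷ forms A)) rs → ValidArr A → ValidArr ((F , rs) ∷ A)

validArr? : ∀ A → Dec (ValidArr A)
validArr? [] = yes []
validArr? ((F , rs) ∷ A) =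
  map′ (λ { (v , w) → v ∷ w }) (λ { (v ∷ w) → v , w })
       (All.all? (valid? (F ∷ forms A)) rs ×-dec validArr? A)

allHold : List Sgn → List SignRule → Bool
allHold s [] = true
allHold s (r ∷ rs) = if holds s r then allHold s rs else false

allHold-σ : ∀ A N → + 0 < det N → ∀ {rs} → All (Valid A) rs → allHold (map (σ N) A) rs ≡ true
allHold-σ A N det>0 [] = refl
allHold-σ A N det>0 {r ∷ rs} (v ∷ vs) rewrite holds-σ A N det>0 r v = allHold-σ A N det>0 vs

-- Tests k on every sign vector that obeys all relations.
everyCell : Arrangement → (List Sgn → Bool) → Bool
everyCell [] k = k []
everyCell ((F , rs) ∷ A) k = everyCell A λ s → try (⁻ ∷ s) (try (⁰ ∷ s) (try (⁺ ∷ s) true))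
  where
  try : List Sgn → Bool → Bool
  try s b = if allHold s rs then (if k s then b else false) else b

-- Induction on the forms: the recursive call tests a sign vector of the older forms by testing its
-- three extensions. The extension by the true sign `σ N F` obeys its rules by `allHold-σ`, hence
-- was tested; failure there or in an earlier branch would make the whole test `false`.
everyCell-sound : ∀ A → ValidArr A → ∀ k → everyCell A k ≡ true →
                  ∀ N → + 0 < det N → k (map (σ N) (forms A)) ≡ true
everyCell-sound [] _ k h N _ = h
everyCell-sound ((F , rs) ∷ A) (v ∷ w) k h N det>0 =
  finish (σ N F) (everyCell-sound A w _ h N det>0) (allHold-σ (F ∷ forms A) N det>0 v)
  where
  s = map (σ N) (forms A)
  finish : ∀ t → (let try = λ s b → if allHold s rs then (if k s then b else false) else b in
             try (⁻ ∷ s) (try (⁰ ∷ s) (try (⁺ ∷ s) true)) ≡ true) →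
           allHold (t ∷ s) rs ≡ true → k (t ∷ s) ≡ true
  finish ⁻ e q with allHold (⁻ ∷ s) rs | k (⁻ ∷ s)
  finish ⁻ e refl | true | true = refl
  finish ⁰ e q with allHold (⁻ ∷ s) rs | k (⁻ ∷ s) | allHold (⁰ ∷ s) rs | k (⁰ ∷ s)
  finish ⁰ e refl | true | true | true | true = refl
  finish ⁰ e refl | false | _ | true | true = refl
  finish ⁺ e q with allHold (⁻ ∷ s) rs | k (⁻ ∷ s) | allHold (⁰ ∷ s) rs | k (⁰ ∷ s)
                  | allHold (⁺ ∷ s) rs | k (⁺ ∷ s)
  finish ⁺ e refl | true | true | true | true | true | true = refl
  finish ⁺ e refl | false | _ | true | true | true | true = refl
  finish ⁺ e refl | true | true | false | _ | true | true = refl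
  finish ⁺ e refl | false | _ | false | _ | true | true = refl

-- T̃ as a function of signs

whenℤ : Bool → ℤ → ℤ
whenℤ b z = if b then z else + 0

-- Weights are measured in units of 1/24.
nested₂₄ indep₂₄ : Bool → Bool → ℤ
nested₂₄ true  true  = + 4
nested₂₄ true  false = + 12
nested₂₄ false true  = + 12
nested₂₄ false false = + 24
indep₂₄ true  true  = + 6
indep₂₄ true  false = + 12
indep₂₄ false true  = + 12
indep₂₄ false false = + 24

nestedW : Sgn → Sgn → ℤ
nestedW x y = nested₂₄ (isZero x) (isZero y)

-- The weight of ⟨ 0 ≤ p ⟩ times a nested weight, hence half of the latter when p = 0.
halfNested : Sgn → Sgn → Sgn → ℤ
halfNested ⁰ ⁰ ⁰ = + 2
halfNested ⁰ ⁰ _ = + 6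
halfNested ⁰ _ ⁰ = + 6
halfNested ⁰ _ _ = + 12
halfNested _ x y = nestedW x y

aᶠ mᶠ cᶠ dᶠ pᶠ c-pᶠ m-pᶠ c-mᶠ m-cᶠ d+mᶠ a-cᶠ : Mat
-- With m = −b and p = a − d, as linear forms on matrices.
aᶠ = mat (+ 1) (+ 0) (+ 0) (+ 0)
mᶠ = mat (+ 0) -[1+ 0 ] (+ 0) (+ 0)
cᶠ = mat (+ 0) (+ 0) (+ 1) (+ 0)
dᶠ = mat (+ 0) (+ 0) (+ 0) (+ 1)
pᶠ = mat (+ 1) (+ 0) (+ 0) -[1+ 0 ]
c-pᶠ = mat -[1+ 0 ] (+ 0) (+ 1) (+ 1)
m-pᶠ = mat -[1+ 0 ] -[1+ 0 ] (+ 0) (+ 1)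
c-mᶠ = mat (+ 0) (+ 1) (+ 1) (+ 0)
m-cᶠ = mat (+ 0) -[1+ 0 ] -[1+ 0 ] (+ 0)
d+mᶠ = mat (+ 0) -[1+ 0 ] (+ 0) (+ 1)
a-cᶠ = mat (+ 1) (+ 0) -[1+ 0 ] (+ 0)

-- The quadratic rule at `dᶠ` is det = a d + m c. The two at `a-cᶠ` compute det from the row (a - c,
-- b - d) and either row of the matrix: a(d + m) - m(a - c) and c(d + m) + d(a - c).
baseArrangement : Arrangement
baseArrangement =
  (a-cᶠ ,
     lin (minus 0) (plus 9) (minus 7) ∷ lin (minus 0) (plus 6) (minus 4) ∷
     quad (plus 9) (plus 1) (minus 8) (plus 0) ∷ quad (plus 7) (plus 1) (plus 6) (plus 0) ∷ []) ∷
  (d+mᶠ ,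
     lin (minus 0) (plus 8) (plus 2) ∷ lin (minus 0) (plus 7) (plus 5) ∷ []) ∷
  (c-mᶠ ,
     lin (plus 0) (plus 6) (minus 5) ∷ lin (minus 0) (plus 2) (minus 1) ∷ []) ∷
  (m-pᶠ ,
     lin (minus 0) (plus 5) (minus 2) ∷ []) ∷
  (c-pᶠ ,
     lin (minus 0) (plus 3) (minus 1) ∷ []) ∷
  (pᶠ ,
     lin (minus 0) (plus 4) (minus 1) ∷ []) ∷
  (dᶠ ,
     quad (plus 3) (plus 0) (plus 2) (plus 1) ∷ []) ∷
  (cᶠ , []) ∷
  (mᶠ , []) ∷
  (aᶠ , []) ∷
  []

data Cell : Set where
  cell : (a m c d p c-p m-p c-m d+m a-c : Sgn) → Cell

toCell : List Sgn → Cell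
toCell (ac ∷ dm ∷ cm ∷ mp ∷ cp ∷ p ∷ d ∷ c ∷ m ∷ a ∷ _) = cell a m c d p cp mp cm dm ac
toCell _ = cell ⁰ ⁰ ⁰ ⁰ ⁰ ⁰ ⁰ ⁰ ⁰ ⁰

-- c > 0 ≥ a, 0 ≤ p ≤ c ≤ m
inCone₁ : Cell → Bool
inCone₁ (cell a m c d p cp mp cm dm ac) =
  isPos c ∧ isNN (flip a) ∧ isNN p ∧ isNN cp ∧ isNN (flip cm)
-- m > 0 ≥ d, 0 ≤ p ≤ m ≤ c
inCone₂ : Cell → Bool
inCone₂ (cell a m c d p cp mp cm dm ac) =
  isPos m ∧ isNN (flip d) ∧ isNN p ∧ isNN mp ∧ isNN cm
-- −m < d ≤ 0, m ≤ p ≤ c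
inCone₃ : Cell → Bool
inCone₃ (cell a m c d p cp mp cm dm ac) =
  isPos m ∧ isNN (flip d) ∧ isPos dm ∧ isNN (flip mp) ∧ isNN cp
-- 0 ≤ c < a, p ≤ m ≤ c
inCone₄ : Cell → Bool
inCone₄ (cell a m c d p cp mp cm dm ac) =
  isNN c ∧ isPos ac ∧ isNN mp ∧ isNN cm

weight₁ weight₂ weight₃ weight₄ : Cell → ℤ
weight₁ (cell a m c d p cp mp cm dm ac) = halfNested p cp cm
weight₂ (cell a m c d p cp mp cm dm ac) = halfNested p mp cm
weight₃ (cell a m c d p cp mp cm dm ac) = nestedW mp cp
weight₄ (cell a m c d p cp mp cm dm ac) = nestedW mp cm

τ : Cell → ℤ
τ s = whenℤ (inCone₄ s) (weight₄ s)
      - (whenℤ (inCone₁ s) (weight₁ s) + whenℤ (inCone₂ s) (weight₂ s) + whenℤ (inCone₃ s) (weight₃ s))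

-- With two more forms the list contains, up to sign, every pullback of a base form under N ↦ N S⁻¹,
-- U N and U N S⁻¹.
S-arrangement : Arrangement
S-arrangement =
  (mat (+ 1) -[1+ 0 ] -[1+ 0 ] (+ 0) ,
     lin (minus 0) (plus 11) (minus 4) ∷ lin (minus 0) (plus 10) (plus 2) ∷
     lin (minus 0) (plus 7) (plus 1) ∷ lin (plus 0) (plus 6) (minus 3) ∷ []) ∷
  (mat (+ 0) -[1+ 0 ] -[1+ 0 ] (+ 1) ,
     lin (plus 0) (plus 8) (minus 2) ∷ lin (minus 0) (plus 7) (minus 3) ∷
     lin (minus 0) (plus 4) (plus 1) ∷ []) ∷
  baseArrangement

-- Eight more forms make room for the pullbacks under N ↦ N U⁻¹, N U⁻² and S N, S N U⁻¹, S N U⁻².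
-- Each quadratic rule is the determinant after some additions or subtractions of rows and columns.
U-arrangement : Arrangement
U-arrangement =
  (mat (+ 1) (+ 1) (+ 1) (+ 1) ,
     lin (minus 0) (plus 17) (minus 5) ∷ lin (minus 0) (plus 14) (plus 3) ∷
     lin (minus 0) (plus 7) (plus 6) ∷ lin (plus 0) (plus 2) (minus 1) ∷
     quad (plus 17) (plus 0) (minus 7) (plus 1) ∷ quad (plus 16) (plus 0) (minus 7) (plus 2) ∷
     quad (minus 15) (plus 0) (plus 6) (plus 1) ∷ quad (plus 14) (plus 0) (plus 6) (plus 2) ∷ []) ∷
  (mat (+ 1) (+ 0) (+ 1) (+ 0) ,
     lin (minus 0) (plus 16) (plus 14) ∷ lin (minus 0) (plus 15) (plus 2) ∷
     lin (minus 0) (plus 12) (plus 5) ∷ quad (minus 16) (plus 1) (plus 15) (plus 0) ∷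
     quad (plus 14) (plus 1) (plus 13) (plus 0) ∷ []) ∷
  (mat (+ 0) -[1+ 0 ] (+ 0) -[1+ 0 ] ,
     lin (minus 0) (plus 14) (minus 12) ∷ lin (minus 0) (plus 13) (plus 3) ∷
     lin (minus 0) (plus 11) (minus 5) ∷ []) ∷
  (mat (+ 1) (+ 1) (+ 1) (+ 0) ,
     lin (minus 0) (plus 14) (plus 7) ∷ lin (minus 0) (plus 12) (plus 4) ∷
     lin (minus 0) (plus 10) (minus 2) ∷ lin (plus 0) (plus 8) (minus 3) ∷ []) ∷
  (mat (+ 1) (+ 1) -[1+ 0 ] -[1+ 0 ] ,
     lin (plus 0) (plus 12) (plus 8) ∷ lin (plus 0) (plus 11) (plus 7) ∷
     lin (plus 0) (plus 5) (minus 4) ∷ lin (minus 0) (plus 3) (minus 2) ∷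
     quad (minus 13) (plus 0) (plus 4) (plus 3) ∷ quad (minus 12) (plus 0) (plus 5) (plus 3) ∷
     quad (minus 11) (plus 0) (plus 4) (plus 2) ∷ quad (plus 10) (plus 0) (plus 5) (plus 2) ∷ []) ∷
  (mat (+ 0) -[1+ 0 ] -[1+ 0 ] -[1+ 0 ] ,
     lin (minus 0) (plus 11) (minus 1) ∷ lin (plus 0) (plus 9) (plus 5) ∷
     lin (plus 0) (plus 7) (plus 2) ∷ []) ∷
  (mat (+ 0) (+ 0) (+ 1) (+ 1) ,
     lin (minus 0) (plus 11) (plus 6) ∷ lin (minus 0) (plus 9) (plus 8) ∷
     lin (minus 0) (plus 4) (plus 3) ∷ quad (plus 11) (plus 0) (minus 9) (plus 1) ∷
     quad (plus 10) (plus 0) (plus 8) (plus 1) ∷ []) ∷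
  (mat (+ 1) (+ 1) (+ 0) (+ 0) ,
     lin (minus 0) (plus 10) (minus 9) ∷ lin (minus 0) (plus 7) (minus 4) ∷
     lin (minus 0) (plus 3) (plus 1) ∷ []) ∷
  baseArrangement

-- Functions of finitely many signs and their translates under N ↦ γ N δ

record Piece : Set where
  constructor piece
  field
    support : List Mat
    value : List Sgn → ℤ
open Piece public

⟦_⟧ : Piece → Mat → ℤ
⟦ p ⟧ N = value p (map (σ N) (support p))

-- Replacing N by -N flips every sign, so the sum over both representatives is again a function on
-- the same forms.
±_ −_ : Piece → Piece
± piece A f = piece A λ s → f s + f (map flip s)
− piece A f = piece A λ s → - f s

σ-negʳ : ∀ N F → σ (neg N) F ≡ flip (σ N F)
σ-negʳ N F = trans (cong sgn (⟪⟫-negʳ F N)) (sgn-neg ⟪ F , N ⟫)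

map-σ-neg : ∀ N A → map (σ (neg N)) A ≡ map flip (map (σ N) A)
map-σ-neg N [] = refl
map-σ-neg N (F ∷ A) = cong₂ _∷_ (σ-negʳ N F) (map-σ-neg N A)

±-overReps : ∀ p N → ⟦ ± p ⟧ N ≡ ⟦ p ⟧ N + ⟦ p ⟧ (neg N)
±-overReps p N = cong (λ s → ⟦ p ⟧ N + value p s) (sym (map-σ-neg N (support p)))

tPiece : Piece
tPiece = piece (forms baseArrangement) λ s → τ (toCell s)

Tℤ : Mat → ℤ
Tℤ = ⟦ ± tPiece ⟧

pullback : Mat → Mat → List Mat → List Mat
pullback γ δ = map λ F → transpose γ · F · transpose δ

1ₘ : Mat
1ₘ = mat (+ 1) (+ 0) (+ 0) (+ 1)

·-assoc : ∀ A B C → A · B · C ≡ A · (B · C)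
·-assoc (mat a b c d) (mat e f g h) (mat i j k l) =
  mat≡ (lem a b e f g h i k) (lem a b e f g h j l) (lem c d e f g h i k) (lem c d e f g h j l)
  where
  lem : ∀ a b e f g h i k → (a * e + b * g) * i + (a * f + b * h) * k
        ≡ a * (e * i + f * k) + b * (g * i + h * k)
  lem = solve-∀

·-identityˡ : ∀ N → 1ₘ · N ≡ N
·-identityˡ (mat a b c d) = mat≡ (lem a c) (lem b d) (lem′ a c) (lem′ b d)
  where
  lem : ∀ a c → + 1 * a + + 0 * c ≡ a
  lem = solve-∀
  lem′ : ∀ a c → + 0 * a + + 1 * c ≡ c
  lem′ = solve-∀

·-identityʳ : ∀ N → N · 1ₘ ≡ N
·-identityʳ (mat a b c d) = mat≡ (lem a b) (lem′ a b) (lem c d) (lem′ c d)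
  where
  lem : ∀ a b → a * + 1 + b * + 0 ≡ a
  lem = solve-∀
  lem′ : ∀ a b → a * + 0 + b * + 1 ≡ b
  lem′ = solve-∀

σ-pullback : ∀ γ N δ A → map (σ (γ · N · δ)) A ≡ map (σ N) (pullback γ δ A)
σ-pullback γ N δ [] = refl
σ-pullback γ N δ (F ∷ A) = cong₂ _∷_ (cong sgn (begin
    ⟪ F , γ · N · δ ⟫                         ≡⟨ ⟪⟫-·ʳ F (γ · N) δ ⟩
    ⟪ F · transpose δ , γ · N ⟫               ≡⟨ ⟪⟫-·ˡ (F · transpose δ) γ N ⟩
    ⟪ transpose γ · (F · transpose δ) , N ⟫   ≡⟨ cong ⟪_, N ⟫ (·-assoc (transpose γ) F (transpose δ)) ⟨
    ⟪ transpose γ · F · transpose δ , N ⟫     ∎)) (σ-pullback γ N δ A)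
  where open ≡-Reasoning

-- p , γ , δ stands for N ↦ ⟦ p ⟧ (γ N δ).
Translate : Set
Translate = Piece × Mat × Mat

translatesSum : List Translate → Mat → ℤ
translatesSum [] N = + 0
translatesSum ((p , γ , δ) ∷ ts) N = ⟦ p ⟧ (γ · N · δ) + translatesSum ts N

pulledForms : Translate → List Mat
pulledForms (p , γ , δ) = pullback γ δ (support p)

-- A sum of translates read on one common list of forms: each value function comes with the literals
-- that supply its arguments.
Compiled : Set
Compiled = List ((List Sgn → ℤ) × List Literal)

compile : List Mat → List Translate → Compiled
compile A = map λ t → value (proj₁ t) , map (locate A) (pulledForms t)

sumAt : Compiled → List Sgn → ℤ
sumAt [] s = + 0
sumAt ((f , ls) ∷ c) s = f (map (sgnAt s) ls) + sumAt c s

agree : Compiled → Compiled → List Sgn → Bool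
agree c e s = does (sumAt c s ℤ.≟ sumAt e s)

Located : List Mat → List Translate → Set
Located A ts = map (λ c → map (formAt A) (proj₂ c)) (compile A ts) ≡ map pulledForms ts

map-sgnAt-σ : ∀ N A ls → map (sgnAt (map (σ N) A)) ls ≡ map (σ N) (map (formAt A) ls)
map-sgnAt-σ N A [] = refl
map-sgnAt-σ N A (l ∷ ls) = cong₂ _∷_ (sgnAt-σ N A l) (map-sgnAt-σ N A ls)

sumAt-compile : ∀ A ts N → Located A ts →
                sumAt (compile A ts) (map (σ N) A) ≡ translatesSum ts N
sumAt-compile A [] N _ = refl
sumAt-compile A (t@(p , γ , δ) ∷ ts) N eq =
  cong₂ _+_ (cong (value p) (begin
    map (sgnAt (map (σ N) A)) ls       ≡⟨ map-sgnAt-σ N A ls ⟩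
    map (σ N) (map (formAt A) ls)      ≡⟨ cong (map (σ N)) (proj₁ (∷-injective eq)) ⟩
    map (σ N) (pulledForms t)          ≡⟨ σ-pullback γ N δ (support p) ⟨
    map (σ (γ · N · δ)) (support p)    ∎))
  (sumAt-compile A ts N (proj₂ (∷-injective eq)))
  where
  open ≡-Reasoning
  ls = map (locate A) (pulledForms t)

does⇒ : ∀ {P : Set} (d : Dec P) → does d ≡ true → P
does⇒ (yes p) _ = p

-- Once all pulled back forms are located in `A`, both sums are functions of the sign vector of `A`,
-- and their equality for all N is a finite computation. For concrete data the hypotheses on
-- `ValidArr`, `Located` and `everyCell` are closed and are settled by evaluation.
translates-agree :
  ∀ A → ValidArr A → ∀ ps qs → Located (forms A) ps → Located (forms A) qs →
  everyCell A (agree (compile (forms A) ps) (compile (forms A) qs)) ≡ true →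
  ∀ N → + 0 < det N → translatesSum ps N ≡ translatesSum qs N
translates-agree A v ps qs locp locq ok N det>0 = begin
  translatesSum ps N                            ≡⟨ sumAt-compile (forms A) ps N locp ⟨
  sumAt (compile (forms A) ps) (map (σ N) (forms A))
    ≡⟨ does⇒ (_ ℤ.≟ _) (everyCell-sound A v (agree (compile (forms A) ps)
        (compile (forms A) qs)) ok N det>0) ⟩
  sumAt (compile (forms A) qs) (map (σ N) (forms A))
    ≡⟨ sumAt-compile (forms A) qs N locq ⟩
  translatesSum qs N                            ∎
  where open ≡-Reasoning

-- Finite verification of the invariance and telescoping identities

S-left S-right U-left U-right : List Translate
S-left = (± tPiece , 1ₘ , 1ₘ) ∷ (± tPiece , 1ₘ , adj S) ∷ []
S-right = (± tPiece , U , 1ₘ) ∷ (± tPiece , U , adj S) ∷ []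
U-left = (± tPiece , 1ₘ , 1ₘ) ∷ (± tPiece , 1ₘ , adj U) ∷ (± tPiece , 1ₘ , adj (U · U)) ∷ []
U-right = (± tPiece , S , 1ₘ) ∷ (± tPiece , S , adj U) ∷ (± tPiece , S , adj (U · U)) ∷ []

-- The coefficient of T̃ S at N is that of T̃ at N S⁻¹, whence `adj S`. The two lists give the
-- coefficients of T̃(1 + S) at N and at U N; the last `refl` runs the enumeration.
Tℤ-S-translates : ∀ N → + 0 < det N → translatesSum S-left N ≡ translatesSum S-right N
Tℤ-S-translates = translates-agree S-arrangement (toWitness {a? = validArr? S-arrangement} _)
                    S-left S-right refl refl refl

Tℤ-U-translates : ∀ N → + 0 < det N → translatesSum U-left N ≡ translatesSum U-right N
Tℤ-U-translates = translates-agree U-arrangement (toWitness {a? = validArr? U-arrangement} _)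
                    U-left U-right refl refl refl

-- In ePiece the condition m > 0 replaces ellipticity, see discriminant-sgn.
hPiece xPiece yPiece zPiece ePiece : Piece
hPiece = piece (cᶠ ∷ aᶠ ∷ m-pᶠ ∷ c-mᶠ ∷ []) λ where
  (c ∷ a ∷ mp ∷ cm ∷ _) →
    whenℤ (isNN c ∧ isZero c ∧ isPos a ∧ isNN mp ∧ isNN cm) (nestedW mp cm)
  _ → + 0
xPiece = piece (cᶠ ∷ mᶠ ∷ dᶠ ∷ pᶠ ∷ c-mᶠ ∷ []) λ where
  (c ∷ m ∷ d ∷ p ∷ cm ∷ _) →
    whenℤ (isNN c ∧ isPos m ∧ isPos d ∧ isNN p ∧ isNN cm) (indep₂₄ (isZero p) (isZero cm))
  _ → + 0
yPiece = piece (cᶠ ∷ a-cᶠ ∷ m-pᶠ ∷ c-mᶠ ∷ []) λ where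
  (c ∷ ac ∷ mp ∷ cm ∷ _) →
    whenℤ (isNN c ∧ isPos c ∧ isPos ac ∧ isNN mp ∧ isNN cm) (nestedW mp cm)
  _ → + 0
zPiece = piece (cᶠ ∷ aᶠ ∷ c-pᶠ ∷ m-cᶠ ∷ []) λ where
  (c ∷ a ∷ cp ∷ mc ∷ _) →
    whenℤ (isNN c ∧ isPos a ∧ isPos c ∧ isNN cp ∧ isNN mc) (nestedW cp mc)
  _ → + 0
ePiece = piece (cᶠ ∷ mᶠ ∷ pᶠ ∷ c-pᶠ ∷ m-pᶠ ∷ []) λ where
  (c ∷ m ∷ p ∷ cp ∷ mp ∷ _) →
    whenℤ (isPos c ∧ isPos m ∧ isNN p ∧ isNN cp ∧ isNN mp)
          (if isZero cp ∧ isZero mp then + 8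
           else if isZero p ∨ isZero cp ∨ isZero mp then + 12 else + 24)
  _ → + 0

-- The coefficient of U² Y U at N is that of Y at U⁻² N U⁻¹, and similarly for S X S. Up to sign,
-- all forms that arise are among the ten of `baseArrangement`.
definition : List Translate
definition = (− (± ePiece) , 1ₘ , 1ₘ) ∷ (± hPiece , 1ₘ , 1ₘ)
  ∷ (± xPiece , 1ₘ , 1ₘ) ∷ (− (± xPiece) , adj S , adj S)
  ∷ (± yPiece , 1ₘ , 1ₘ) ∷ (− (± yPiece) , adj (U · U) , adj U)
  ∷ (± zPiece , 1ₘ , 1ₘ) ∷ (− (± zPiece) , adj (U · U) , adj U) ∷ []

definition-Tℤ : ∀ N → + 0 < det N →
                translatesSum definition N ≡ translatesSum ((± tPiece , 1ₘ , 1ₘ) ∷ []) N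
definition-Tℤ = translates-agree baseArrangement (toWitness {a? = validArr? baseArrangement} _)
                  definition ((± tPiece , 1ₘ , 1ₘ) ∷ []) refl refl refl

Tℤ-S : ∀ N → + 0 < det N → Tℤ N + Tℤ (N · adj S) ≡ Tℤ (U · N) + Tℤ (U · N · adj S)
Tℤ-S N det>0 = begin
  Tℤ N + Tℤ (N · adj S)
    ≡⟨ cong₂ (λ P Q → Tℤ P + Q) (sym (trans (·-identityʳ (1ₘ · N)) (·-identityˡ N)))
         (trans (cong (λ P → Tℤ (P · adj S)) (sym (·-identityˡ N)))
             (sym (ℤP.+-identityʳ (Tℤ (1ₘ · N · adj S))))) ⟩
  translatesSum S-left N
    ≡⟨ Tℤ-S-translates N det>0 ⟩
  translatesSum S-right N
    ≡⟨ cong₂ (λ P Q → Tℤ P + Q) (·-identityʳ (U · N)) (ℤP.+-identityʳ (Tℤ (U · N · adj S))) ⟩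
  Tℤ (U · N) + Tℤ (U · N · adj S) ∎
  where open ≡-Reasoning

Tℤ-U : ∀ N → + 0 < det N →
       Tℤ N + Tℤ (N · adj U) + Tℤ (N · adj (U · U))
       ≡ Tℤ (S · N) + Tℤ (S · N · adj U) + Tℤ (S · N · adj (U · U))
Tℤ-U N det>0 = begin
  Tℤ N + Tℤ (N · adj U) + Tℤ (N · adj (U · U))
    ≡⟨ cong₂ _+_ (cong₂ (λ P Q → Tℤ P + Tℤ Q) (sym (trans (·-identityʳ (1ₘ · N)) (·-identityˡ N)))
                    (cong (_· adj U) (sym (·-identityˡ N))))
         (cong (λ P → Tℤ (P · adj (U · U))) (sym (·-identityˡ N))) ⟩
  Tℤ (1ₘ · N · 1ₘ) + Tℤ (1ₘ · N · adj U) + Tℤ (1ₘ · N · adj (U · U))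
    ≡⟨ reassoc (Tℤ (1ₘ · N · 1ₘ)) (Tℤ (1ₘ · N · adj U)) (Tℤ (1ₘ · N · adj (U · U))) ⟨
  translatesSum U-left N
    ≡⟨ Tℤ-U-translates N det>0 ⟩
  translatesSum U-right N
    ≡⟨ reassoc (Tℤ (S · N · 1ₘ)) (Tℤ (S · N · adj U)) (Tℤ (S · N · adj (U · U))) ⟩
  Tℤ (S · N · 1ₘ) + Tℤ (S · N · adj U) + Tℤ (S · N · adj (U · U))
    ≡⟨ cong (λ P → Tℤ P + Tℤ (S · N · adj U) + Tℤ (S · N · adj (U · U))) (·-identityʳ (S · N)) ⟩
  Tℤ (S · N) + Tℤ (S · N · adj U) + Tℤ (S · N · adj (U · U)) ∎
  where
  open ≡-Reasoning
  reassoc : ∀ x y z → x + (y + (z + + 0)) ≡ x + y + z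
  reassoc x y z = trans (cong (λ t → x + (y + t)) (ℤP.+-identityʳ z)) (sym (ℤP.+-assoc x y z))

-- Comparison with the rational coefficients in the definition of T̃

ι : ℤ → ℚ
ι z = z ℚ./ 24

ι-+ : ∀ x y → ι (x + y) ≡ ι x ℚ.+ ι y
ι-+ x y = ℚP.toℚᵘ-injective (begin
  toℚᵘ (ι (x + y))                ≈⟨ ℚP.toℚᵘ-fromℚᵘ (mkℚᵘ (x + y) 23) ⟩
  mkℚᵘ (x + y) 23                 ≈⟨ *≡* (lem x y) ⟩
  mkℚᵘ x 23 ℚᵘ.+ mkℚᵘ y 23        ≈⟨ ℚᵘP.+-cong (ℚP.toℚᵘ-fromℚᵘ (mkℚᵘ x 23)) (ℚP.toℚᵘ-fromℚᵘ (mkℚᵘ y 23)) ⟨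
  toℚᵘ (ι x) ℚᵘ.+ toℚᵘ (ι y)      ≈⟨ ℚP.toℚᵘ-homo-+ (ι x) (ι y) ⟨
  toℚᵘ (ι x ℚ.+ ι y)              ∎)
  where
  open ℚᵘP.≃-Reasoning
  -- 576 = 24 · 24 is the denominator of the unnormalised sum.
  lem : ∀ x y → (x + y) * + 576 ≡ (x * + 24 + y * + 24) * + 24
  lem = solve-∀

ι-neg : ∀ x → ι (- x) ≡ ℚ.- ι x
ι-neg x = ℚP.toℚᵘ-injective (begin
  toℚᵘ (ι (- x))      ≈⟨ ℚP.toℚᵘ-fromℚᵘ (mkℚᵘ (- x) 23) ⟩
  ℚᵘ.- mkℚᵘ x 23      ≈⟨ ℚᵘP.-‿cong (ℚP.toℚᵘ-fromℚᵘ (mkℚᵘ x 23)) ⟨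
  ℚᵘ.- toℚᵘ (ι x)     ≈⟨ ℚP.toℚᵘ-homo‿- (ι x) ⟨
  toℚᵘ (ℚ.- ι x)      ∎)
  where open ℚᵘP.≃-Reasoning

isNN-sgn : ∀ z → does (+ 0 ℤP.≤? z) ≡ isNN (sgn z)
isNN-sgn (+ 0) = refl
isNN-sgn (+ suc _) = refl
isNN-sgn -[1+ _ ] = refl

isPos-sgn : ∀ z → does (+ 0 ℤP.<? z) ≡ isPos (sgn z)
isPos-sgn (+ 0) = refl
isPos-sgn (+ suc _) = refl
isPos-sgn -[1+ _ ] = refl

isZero-sgn : ∀ z → does (z ℤ.≟ + 0) ≡ isZero (sgn z)
isZero-sgn (+ 0) = refl
isZero-sgn (+ suc _) = refl
isZero-sgn -[1+ _ ] = refl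

-- The difference enters as any `z` equal to it, so that `z` can be a pairing `⟪ F , N ⟫`, as found
-- under the sign in `σ`.
≤ᵇ-sgn : ∀ x y {z} → z ≡ y - x → (x Defs.≤ᵇ y) ≡ isNN (sgn z)
≤ᵇ-sgn x y refl = trans (does-⇔ (mk⇔ ℤP.i≤j⇒0≤j-i ℤP.0≤i-j⇒j≤i)
                        (x ℤP.≤? y) (+ 0 ℤP.≤? (y - x))) (isNN-sgn (y - x))

<ᵇ-sgn : ∀ x y {z} → z ≡ y - x → (x Defs.<ᵇ y) ≡ isPos (sgn z)
<ᵇ-sgn x y refl = trans (does-⇔ (mk⇔ to from)
                        (x ℤP.<? y) (+ 0 ℤP.<? (y - x))) (isPos-sgn (y - x))
  where
  to : x < y → + 0 < y - x
  to x<y = subst (_< y - x) (ℤP.+-inverseʳ x) (ℤP.+-monoˡ-< (- x) x<y)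
  from : + 0 < y - x → x < y
  from 0<y-x = subst₂ _<_ (ℤP.+-identityˡ x) (lem y x) (ℤP.+-monoˡ-< x 0<y-x)
    where
    lem : ∀ y x → y - x + x ≡ y
    lem = solve-∀

==-sgn : ∀ x y {z} → z ≡ x - y → (x Defs.== y) ≡ isZero (sgn z)
==-sgn x y refl =
  trans (does-⇔ (mk⇔ ℤP.i≡j⇒i-j≡0 (ℤP.i-j≡0⇒i≡j x y)) (x ℤ.≟ y) (x - y ℤ.≟ + 0))
        (isZero-sgn (x - y))

isZero-flip : ∀ s → isZero (flip s) ≡ isZero s
isZero-flip ⁻ = refl
isZero-flip ⁰ = refl
isZero-flip ⁺ = refl

==-sgn˘ : ∀ x y {z} → z ≡ y - x → (x Defs.== y) ≡ isZero (sgn z)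
==-sgn˘ x y {z} eq = begin
  (x Defs.== y)          ≡⟨ ==-sgn x y (trans (cong -_ eq) (lem y x)) ⟩
  isZero (sgn (- z))     ≡⟨ cong isZero (sgn-neg z) ⟩
  isZero (flip (sgn z))  ≡⟨ isZero-flip (sgn z) ⟩
  isZero (sgn z)         ∎
  where
  open ≡-Reasoning
  lem : ∀ y x → - (y - x) ≡ x - y
  lem = solve-∀

module _ (a b c d : ℤ) where
  private N = mat a b c d

  -- Right sides such as `a - + 0` are left unsimplified: they are literally the differences that
  -- the comparison lemmas above expect.
  ⟪a⟫ : ⟪ aᶠ , N ⟫ ≡ a - + 0
  ⟪a⟫ = lem a b c d
    where
    lem : ∀ a b c d → + 1 * a + + 0 * b + + 0 * c + + 0 * d ≡ a - + 0
    lem = solve-∀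
  ⟪m⟫ : ⟪ mᶠ , N ⟫ ≡ + 0 - b
  ⟪m⟫ = lem a b c d
    where
    lem : ∀ a b c d → + 0 * a + -[1+ 0 ] * b + + 0 * c + + 0 * d ≡ + 0 - b
    lem = solve-∀
  ⟪c⟫ : ⟪ cᶠ , N ⟫ ≡ c - + 0
  ⟪c⟫ = lem a b c d
    where
    lem : ∀ a b c d → + 0 * a + + 0 * b + + 1 * c + + 0 * d ≡ c - + 0
    lem = solve-∀
  ⟪d⟫ : ⟪ dᶠ , N ⟫ ≡ d - + 0
  ⟪d⟫ = lem a b c d
    where
    lem : ∀ a b c d → + 0 * a + + 0 * b + + 0 * c + + 1 * d ≡ d - + 0
    lem = solve-∀
  ⟪p⟫ : ⟪ pᶠ , N ⟫ ≡ (a - d) - + 0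
  ⟪p⟫ = lem a b c d
    where
    lem : ∀ a b c d → + 1 * a + + 0 * b + + 0 * c + -[1+ 0 ] * d ≡ (a - d) - + 0
    lem = solve-∀
  ⟪c-p⟫ : ⟪ c-pᶠ , N ⟫ ≡ c - (a - d)
  ⟪c-p⟫ = lem a b c d
    where
    lem : ∀ a b c d → -[1+ 0 ] * a + + 0 * b + + 1 * c + + 1 * d ≡ c - (a - d)
    lem = solve-∀
  ⟪m-p⟫ : ⟪ m-pᶠ , N ⟫ ≡ - b - (a - d)
  ⟪m-p⟫ = lem a b c d
    where
    lem : ∀ a b c d → -[1+ 0 ] * a + -[1+ 0 ] * b + + 0 * c + + 1 * d ≡ - b - (a - d)
    lem = solve-∀
  ⟪c-m⟫ : ⟪ c-mᶠ , N ⟫ ≡ c - - b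
  ⟪c-m⟫ = lem a b c d
    where
    lem : ∀ a b c d → + 0 * a + + 1 * b + + 1 * c + + 0 * d ≡ c - - b
    lem = solve-∀
  ⟪m-c⟫ : ⟪ m-cᶠ , N ⟫ ≡ - b - c
  ⟪m-c⟫ = lem a b c d
    where
    lem : ∀ a b c d → + 0 * a + -[1+ 0 ] * b + -[1+ 0 ] * c + + 0 * d ≡ - b - c
    lem = solve-∀
  ⟪a-c⟫ : ⟪ a-cᶠ , N ⟫ ≡ a - c
  ⟪a-c⟫ = lem a b c d
    where
    lem : ∀ a b c d → + 1 * a + + 0 * b + -[1+ 0 ] * c + + 0 * d ≡ a - c
    lem = solve-∀
  ⟪d+m⟫ : ⟪ d+mᶠ , N ⟫ ≡ d - b
  ⟪d+m⟫ = lem a b c d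
    where
    lem : ∀ a b c d → + 0 * a + -[1+ 0 ] * b + + 0 * c + + 1 * d ≡ d - b
    lem = solve-∀

ι-when : ∀ b z {q} → q ≡ ι z → when b q ≡ ι (whenℤ b z)
ι-when true _ eq = eq
ι-when false _ _ = refl

ι-nested : ∀ x y → wNested x y ≡ ι (nested₂₄ x y)
ι-nested true true = refl
ι-nested true false = refl
ι-nested false true = refl
ι-nested false false = refl

ι-indep : ∀ x y → wIndep x y ≡ ι (indep₂₄ x y)
ι-indep true true = refl
ι-indep true false = refl
ι-indep false true = refl
ι-indep false false = refl

when-cong : ∀ {b b′ q q′} z → b ≡ b′ → q ≡ q′ → q′ ≡ ι z → when b q ≡ ι (whenℤ b′ z)
when-cong {b} z refl refl eq = ι-when b z eq

Hrep-piece : ∀ N → Hrep N ≡ ι (⟦ hPiece ⟧ N)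
Hrep-piece N@(mat a b c d) = when-cong (nested₂₄ (isZero (σ N m-pᶠ)) (isZero (σ N c-mᶠ)))
  (cong₂ _∧_ (≤ᵇ-sgn (+ 0) c (⟪c⟫ a b c d)) (cong₂ _∧_ (==-sgn c (+ 0) (⟪c⟫ a b c d))
      (cong₂ _∧_ (<ᵇ-sgn (+ 0) a (⟪a⟫ a b c d))
    (cong₂ _∧_ (≤ᵇ-sgn (a - d) (- b) (⟪m-p⟫ a b c d)) (≤ᵇ-sgn (- b) c (⟪c-m⟫ a b c d))))))
  (cong₂ wNested (==-sgn˘ (a - d) (- b) (⟪m-p⟫ a b c d)) (==-sgn˘ (- b) c (⟪c-m⟫ a b c d)))
      (ι-nested (isZero (σ N m-pᶠ)) (isZero (σ N c-mᶠ)))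

Xrep-piece : ∀ N → Xrep N ≡ ι (⟦ xPiece ⟧ N)
Xrep-piece N@(mat a b c d) = when-cong (indep₂₄ (isZero (σ N pᶠ)) (isZero (σ N c-mᶠ)))
  (cong₂ _∧_ (≤ᵇ-sgn (+ 0) c (⟪c⟫ a b c d)) (cong₂ _∧_ (<ᵇ-sgn b (+ 0) (⟪m⟫ a b c d))
      (cong₂ _∧_ (<ᵇ-sgn (+ 0) d (⟪d⟫ a b c d))
    (cong₂ _∧_ (≤ᵇ-sgn (+ 0) (a - d) (⟪p⟫ a b c d)) (≤ᵇ-sgn (- b) c (⟪c-m⟫ a b c d))))))
  (cong₂ wIndep (==-sgn˘ (+ 0) (a - d) (⟪p⟫ a b c d)) (==-sgn˘ (- b) c (⟪c-m⟫ a b c d)))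
      (ι-indep (isZero (σ N pᶠ)) (isZero (σ N c-mᶠ)))

Yrep-piece : ∀ N → Yrep N ≡ ι (⟦ yPiece ⟧ N)
Yrep-piece N@(mat a b c d) = when-cong (nested₂₄ (isZero (σ N m-pᶠ)) (isZero (σ N c-mᶠ)))
  (cong₂ _∧_ (≤ᵇ-sgn (+ 0) c (⟪c⟫ a b c d)) (cong₂ _∧_ (<ᵇ-sgn (+ 0) c (⟪c⟫ a b c d))
      (cong₂ _∧_ (<ᵇ-sgn c a (⟪a-c⟫ a b c d))
    (cong₂ _∧_ (≤ᵇ-sgn (a - d) (- b) (⟪m-p⟫ a b c d)) (≤ᵇ-sgn (- b) c (⟪c-m⟫ a b c d))))))
  (cong₂ wNested (==-sgn˘ (a - d) (- b) (⟪m-p⟫ a b c d)) (==-sgn˘ (- b) c (⟪c-m⟫ a b c d)))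
      (ι-nested (isZero (σ N m-pᶠ)) (isZero (σ N c-mᶠ)))

Zrep-piece : ∀ N → Zrep N ≡ ι (⟦ zPiece ⟧ N)
Zrep-piece N@(mat a b c d) = when-cong (nested₂₄ (isZero (σ N c-pᶠ)) (isZero (σ N m-cᶠ)))
  (cong₂ _∧_ (≤ᵇ-sgn (+ 0) c (⟪c⟫ a b c d)) (cong₂ _∧_ (<ᵇ-sgn (+ 0) a (⟪a⟫ a b c d))
      (cong₂ _∧_ (<ᵇ-sgn (+ 0) c (⟪c⟫ a b c d))
    (cong₂ _∧_ (≤ᵇ-sgn (a - d) c (⟪c-p⟫ a b c d)) (≤ᵇ-sgn c (- b) (⟪m-c⟫ a b c d))))))
  (cong₂ wNested (==-sgn˘ (a - d) c (⟪c-p⟫ a b c d)) (==-sgn˘ c (- b) (⟪m-c⟫ a b c d)))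
      (ι-nested (isZero (σ N c-pᶠ)) (isZero (σ N m-cᶠ)))

-- The numerator of v - u over the product of the denominators, so it has the sign of v - u.
crossDiff : ℚᵘ → ℚᵘ → ℤ
crossDiff u v = ℚᵘ.↥ v * ℚᵘ.↧ u - ℚᵘ.↥ u * ℚᵘ.↧ v

-- Cross-multiplication produces the integral form `z` only up to the factor `+ suc k` left by the
-- denominators; being positive, it does not change the sign.
≤ℚ-sgn : ∀ {p q u v} → toℚᵘ p ≃ u → toℚᵘ q ≃ v → ∀ k z → crossDiff u v ≡ + suc k * z →
         (p ≤ℚ q) ≡ isNN (sgn z)
≤ℚ-sgn {p} {q} {u} {v} p≃u q≃v k z eq =
  trans (does-⇔ (mk⇔ to from) (p ℚP.≤? q) (+ 0 ℤP.≤? z)) (isNN-sgn z)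
  where
  to : p ℚ.≤ q → + 0 ℤ.≤ z
  to p≤q with ℚᵘP.≤-respʳ-≃ q≃v (ℚᵘP.≤-respˡ-≃ p≃u (ℚP.toℚᵘ-mono-≤ p≤q))
  ... | *≤* h = ℤP.*-cancelˡ-≤-pos (+ 0) z (+ suc k)
                  (subst₂ ℤ._≤_ (sym (ℤP.*-zeroʳ (+ suc k))) eq (ℤP.i≤j⇒0≤j-i h))
  from : + 0 ℤ.≤ z → p ℚ.≤ q
  from 0≤z = ℚP.toℚᵘ-cancel-≤ (ℚᵘP.≤-respʳ-≃ (ℚᵘP.≃-sym q≃v) (ℚᵘP.≤-respˡ-≃ (ℚᵘP.≃-sym p≃u)
    (*≤* (ℤP.0≤i-j⇒j≤i (subst₂ ℤ._≤_ (ℤP.*-zeroʳ (+ suc k)) (sym eq)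
        (ℤP.*-monoˡ-≤-nonNeg (+ suc k) 0≤z))))))

≡ℚ-sgn : ∀ {p q u v} → toℚᵘ p ≃ u → toℚᵘ q ≃ v → ∀ k z → crossDiff u v ≡ + suc k * z →
         (p ≡ℚ q) ≡ isZero (sgn z)
≡ℚ-sgn {p} {q} {u} {v} p≃u q≃v k z eq =
  trans (does-⇔ (mk⇔ to from) (p ℚP.≟ q) (z ℤ.≟ + 0)) (isZero-sgn z)
  where
  to : p ≡ q → z ≡ + 0
  to refl with ℚᵘP.≃-trans (ℚᵘP.≃-sym p≃u) q≃v
  ... | *≡* h = ℤP.*-cancelˡ-≡ (+ suc k) z (+ 0)
                  (trans (sym eq) (trans (ℤP.i≡j⇒i-j≡0 (sym h)) (sym (ℤP.*-zeroʳ (+ suc k)))))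
  from : z ≡ + 0 → p ≡ q
  from refl = ℚP.toℚᵘ-injective (ℚᵘP.≃-trans p≃u (ℚᵘP.≃-trans
    (*≡* (sym (ℤP.i-j≡0⇒i≡j (ℚᵘ.↥ v * ℚᵘ.↧ u) (ℚᵘ.↥ u * ℚᵘ.↧ v) (trans eq (ℤP.*-zeroʳ (+ suc k))))))
        (ℚᵘP.≃-sym q≃v)))

isPos-true : ∀ {z} → + 0 < z → isPos (sgn z) ≡ true
isPos-true (+<+ (s≤s z≤n)) = refl

isPos-false : ∀ {z} → z ℤ.≤ + 0 → isPos (sgn z) ≡ false
isPos-false {+ 0} _ = refl
isPos-false { -[1+ _ ]} _ = refl
isPos-false {+ suc _} (+≤+ ())

0≤-sgn : ∀ {z} → isNN (sgn z) ≡ true → + 0 ℤ.≤ z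
0≤-sgn {+ _} _ = +≤+ z≤n

*-nonneg : ∀ {x y} → + 0 ℤ.≤ x → + 0 ℤ.≤ y → + 0 ℤ.≤ x * y
*-nonneg {+ 0} {y} _ _ = ℤP.≤-refl
*-nonneg {+ suc x} {+ 0} _ _ = ℤP.≤-reflexive (sym (ℤP.*-zeroʳ (+ suc x)))
*-nonneg {+ suc x} {+ suc y} _ _ = +≤+ z≤n

-- 4 m c − p² = 3 m c + c (m − p) + p (c − p)
discriminant-sgn : ∀ c m p → + 0 < c → + 0 ℤ.≤ p → + 0 ℤ.≤ c - p → + 0 ℤ.≤ m - p →
                   isPos (sgn (+ 4 * (m * c) - p * p)) ≡ isPos (sgn m)
discriminant-sgn c@(+ suc _) m@(+ suc _) p c>0 p≥0 c≥p m≥p =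
  isPos-true (subst (+ 0 <_) (sym (lem c m p))
    (ℤP.+-mono-<-≤ {+ 0} {+ 3 * (m * c)} {+ 0} (+<+ (s≤s z≤n))
      (ℤP.+-mono-≤ {+ 0} {c * (m - p)} {+ 0} (*-nonneg (ℤP.<⇒≤ c>0) m≥p) (*-nonneg p≥0 c≥p))))
  where
  lem : ∀ c m p → + 4 * (m * c) - p * p ≡ + 3 * (m * c) + (c * (m - p) + p * (c - p))
  lem = solve-∀
discriminant-sgn c@(+ suc _) m@(+ 0) p c>0 p≥0 c≥p m≥p =
  isPos-false (subst (ℤ._≤ + 0) (sym (lem c p)) (ℤP.neg-mono-≤ (*-nonneg p≥0 p≥0)))
  where
  lem : ∀ c p → + 4 * (+ 0 * c) - p * p ≡ - (p * p)
  lem = solve-∀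
discriminant-sgn c m@(-[1+ k ]) p c>0 p≥0 c≥p m≥p =
  contradiction (ℤP.≤-trans p≥0 (ℤP.0≤i-j⇒j≤i {m} {p} m≥p)) λ ()
discriminant-sgn (+ 0) _ _ (+<+ ())

ePiece-c≤0 : ∀ N → isPos (σ N cᶠ) ≡ false → ι (⟦ ePiece ⟧ N) ≡ 0ℚ
ePiece-c≤0 N eq rewrite eq = refl

-- For c > 0 the fixed point z = x + iy is a root of c z² - p z + m = 0, so 2x = p/c and |z|² = m/c.
-- Hence x ≥ 0, x ≤ 1/2 and |z - 1| ≥ 1 read p ≥ 0, c - p ≥ 0 and m - p ≥ 0, with equality in the
-- same places.
Erep-piece : ∀ N → Erep N ≡ ι (⟦ ePiece ⟧ N)
Erep-piece N@(mat a b c@(+ suc k) d) = begin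
  when (elliptic N) (if (0ℚ ≤ℚ x) ∧ (x ≤ℚ ½) ∧ (1ℚ ≤ℚ circ) then χvalue (x ≡ℚ 0ℚ) (x ≡ℚ ½)
      (circ ≡ℚ 1ℚ) else 0ℚ)
    ≡⟨ cong₂ when elliptic≡ (cong₂ (λ i v → if i then v else 0ℚ) inF≡ value≡) ⟩
  when (isPos (sgn (+ 4 * (⟪ mᶠ , N ⟫ * c) - ⟪ pᶠ , N ⟫ * ⟪ pᶠ , N ⟫)))
       (if isNN p′ ∧ isNN cp′ ∧ isNN mp′ then χvalue (isZero p′) (isZero cp′) (isZero mp′) else 0ℚ)
    ≡⟨ finish (isNN p′ ∧ isNN cp′ ∧ isNN mp′) refl ⟩
  ι (whenℤ (isPos (σ N mᶠ) ∧ isNN p′ ∧ isNN cp′ ∧ isNN mp′) v₂₄)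
    ≡⟨ cong (λ s → ι (whenℤ (s ∧ isPos (σ N mᶠ) ∧ isNN p′ ∧ isNN cp′ ∧ isNN mp′) v₂₄))
            (sym (cong (λ z → isPos (sgn z)) (⟪c⟫ a b c d))) ⟩
  ι (⟦ ePiece ⟧ N) ∎
  where
  open ≡-Reasoning
  χvalue : Bool → Bool → Bool → ℚ
  χvalue e₁ e₂ e₃ = if e₂ ∧ e₃ then + 1 ℚ./ 3 else if e₁ ∨ e₂ ∨ e₃ then ½ else 1ℚ
  D : ℤ
  D = + 4 * det N - tr N * tr N
  x = (a - d) ℚ./ (2 ℕ.* suc k)
  y2 = D ℚ./ (4 ℕ.* suc k ℕ.* suc k)
  circ = (x ℚ.- 1ℚ) ℚ.* (x ℚ.- 1ℚ) ℚ.+ y2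
  p′ = σ N pᶠ
  cp′ = σ N c-pᶠ
  mp′ = σ N m-pᶠ
  v₂₄ = if isZero cp′ ∧ isZero mp′ then + 8 else if isZero p′ ∨ isZero cp′ ∨ isZero mp′ then + 12 else + 24
  xᵘ = mkℚᵘ (a - d) (ℕ.pred (2 ℕ.* suc k))
  yᵘ = mkℚᵘ D (ℕ.pred (4 ℕ.* suc k ℕ.* suc k))
  x≃ : toℚᵘ x ≃ xᵘ
  x≃ = ℚP.toℚᵘ-fromℚᵘ xᵘ
  circᵘ = (xᵘ ℚᵘ.+ mkℚᵘ -[1+ 0 ] 0) ℚᵘ.* (xᵘ ℚᵘ.+ mkℚᵘ -[1+ 0 ] 0) ℚᵘ.+ yᵘ
  x-1≃ : toℚᵘ (x ℚ.- 1ℚ) ≃ xᵘ ℚᵘ.+ mkℚᵘ -[1+ 0 ] 0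
  x-1≃ = ℚᵘP.≃-trans (ℚP.toℚᵘ-homo-+ x (ℚ.- 1ℚ)) (ℚᵘP.+-congˡ (mkℚᵘ -[1+ 0 ] 0) x≃)
  circ≃ : toℚᵘ circ ≃ circᵘ
  circ≃ = ℚᵘP.≃-trans (ℚP.toℚᵘ-homo-+ ((x ℚ.- 1ℚ) ℚ.* (x ℚ.- 1ℚ)) y2)
            (ℚᵘP.+-cong (ℚᵘP.≃-trans (ℚP.toℚᵘ-homo-* (x ℚ.- 1ℚ) (x ℚ.- 1ℚ)) (ℚᵘP.*-cong x-1≃ x-1≃))
                        (ℚP.toℚᵘ-fromℚᵘ yᵘ))
  0≃ : toℚᵘ 0ℚ ≃ mkℚᵘ (+ 0) 0
  0≃ = ℚᵘP.≃-refl {mkℚᵘ (+ 0) 0}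
  ½≃ : toℚᵘ ½ ≃ mkℚᵘ (+ 1) 1
  ½≃ = ℚᵘP.≃-refl {mkℚᵘ (+ 1) 1}
  1≃ : toℚᵘ 1ℚ ≃ mkℚᵘ (+ 1) 0
  1≃ = ℚᵘP.≃-refl {mkℚᵘ (+ 1) 0}
  pcross : crossDiff (mkℚᵘ (+ 0) 0) xᵘ ≡ + 1 * ⟪ pᶠ , N ⟫
  pcross = trans (lem (a - d)) (cong (+ 1 *_) (sym (⟪p⟫ a b c d)))
    where
    lem : ∀ p → p * + 1 - + 0 ≡ + 1 * (p - + 0)
    lem = solve-∀
  pcross′ : crossDiff xᵘ (mkℚᵘ (+ 0) 0) ≡ + 1 * - ⟪ pᶠ , N ⟫
  pcross′ = trans (lem (a - d)) (cong (λ t → + 1 * - t) (sym (⟪p⟫ a b c d)))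
    where
    lem : ∀ p → + 0 - p * + 1 ≡ + 1 * - (p - + 0)
    lem = solve-∀
  cpcross : crossDiff xᵘ (mkℚᵘ (+ 1) 1) ≡ + 2 * ⟪ c-pᶠ , N ⟫
  cpcross = trans (lem (a - d) c) (cong (+ 2 *_) (sym (⟪c-p⟫ a b c d)))
    where
    lem : ∀ p c → + 1 * (+ 2 * c) - p * + 2 ≡ + 2 * (c - p)
    lem = solve-∀
  -- `circᵘ` has denominator (2c)² · 4c² = 16c⁴ and circ - 1 = (m - p)/c, which leaves the factor
  -- 16c³; `pred` is taken because `≤ℚ-sgn` adds the successor back.
  16c³ : ℕ
  16c³ = ℕ.pred (16 ℕ.* (suc k ℕ.* suc k ℕ.* suc k))
  mpcross : crossDiff (mkℚᵘ (+ 1) 0) circᵘ ≡ + suc 16c³ * ⟪ m-pᶠ , N ⟫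
  mpcross = trans (lem a b c d) (cong (+ suc 16c³ *_) (sym (⟪m-p⟫ a b c d)))
    where
    lem : ∀ a b c d →
          ((((a - d) * + 1 + -[1+ 0 ] * (+ 2 * c)) * ((a - d) * + 1 + -[1+ 0 ] * (+ 2 * c))) * (+ 4 * c * c)
           + (+ 4 * (a * d - b * c) - (a + d) * (a + d)) * (+ 2 * c * + 1 * (+ 2 * c * + 1))) * + 1
          - + 1 * (+ 2 * c * + 1 * (+ 2 * c * + 1) * (+ 4 * c * c))
          ≡ + 16 * (c * c * c) * (- b - (a - d))
    lem = solve-∀
  mpcross′ : crossDiff circᵘ (mkℚᵘ (+ 1) 0) ≡ + suc 16c³ * - ⟪ m-pᶠ , N ⟫
  mpcross′ = trans (lem (ℚᵘ.↥ circᵘ) (ℚᵘ.↧ circᵘ)) (trans (cong -_ mpcross)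
      (ℤP.neg-distribʳ-* (+ suc 16c³) ⟪ m-pᶠ , N ⟫))
    where
    lem : ∀ n d → + 1 * d - n * + 1 ≡ - (n * + 1 - + 1 * d)
    lem = solve-∀
  isZero-neg : ∀ z → isZero (sgn (- z)) ≡ isZero (sgn z)
  isZero-neg z = trans (cong isZero (sgn-neg z)) (isZero-flip (sgn z))
  inF≡ : (0ℚ ≤ℚ x) ∧ (x ≤ℚ ½) ∧ (1ℚ ≤ℚ circ) ≡ isNN p′ ∧ isNN cp′ ∧ isNN mp′
  inF≡ = cong₂ _∧_ (≤ℚ-sgn {0ℚ} {x} 0≃ x≃ 0 ⟪ pᶠ , N ⟫ pcross)
           (cong₂ _∧_ (≤ℚ-sgn {x} {½} x≃ ½≃ 1 ⟪ c-pᶠ , N ⟫ cpcross)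
               (≤ℚ-sgn {1ℚ} {circ} 1≃ circ≃ 16c³ ⟪ m-pᶠ , N ⟫ mpcross))
  value≡ : χvalue (x ≡ℚ 0ℚ) (x ≡ℚ ½) (circ ≡ℚ 1ℚ) ≡ χvalue (isZero p′) (isZero cp′) (isZero mp′)
  value≡ = begin
    χvalue (x ≡ℚ 0ℚ) (x ≡ℚ ½) (circ ≡ℚ 1ℚ)
      ≡⟨ cong₂ (λ e₂ e₃ → χvalue (x ≡ℚ 0ℚ) e₂ e₃) (≡ℚ-sgn x≃ ½≃ 1 ⟪ c-pᶠ , N ⟫ cpcross)
           (trans (≡ℚ-sgn {circ} {1ℚ} circ≃ 1≃ 16c³ (- ⟪ m-pᶠ , N ⟫) mpcross′) (isZero-neg ⟪ m-pᶠ , N ⟫)) ⟩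
    χvalue (x ≡ℚ 0ℚ) (isZero cp′) (isZero mp′)
      ≡⟨ cong (λ e₁ → χvalue e₁ (isZero cp′) (isZero mp′))
           (trans (≡ℚ-sgn x≃ 0≃ 0 (- ⟪ pᶠ , N ⟫) pcross′) (isZero-neg ⟪ pᶠ , N ⟫)) ⟩
    χvalue (isZero p′) (isZero cp′) (isZero mp′) ∎
  elliptic≡ : elliptic N ≡ isPos (sgn (+ 4 * (⟪ mᶠ , N ⟫ * c) - ⟪ pᶠ , N ⟫ * ⟪ pᶠ , N ⟫))
  elliptic≡ = <ᵇ-sgn (tr N * tr N) (+ 4 * det N)
    (trans (cong₂ (λ m p → + 4 * (m * c) - p * p) (⟪m⟫ a b c d) (⟪p⟫ a b c d)) (lem a b c d))
    where
    lem : ∀ a b c d → + 4 * ((+ 0 - b) * c) - ((a - d) - + 0) * ((a - d) - + 0)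
          ≡ + 4 * (a * d - b * c) - (a + d) * (a + d)
    lem = solve-∀
  ι-value : ∀ e₁ e₂ e₃ → χvalue e₁ e₂ e₃ ≡ ι (if e₂ ∧ e₃ then + 8 else if e₁ ∨ e₂ ∨ e₃ then + 12 else + 24)
  ι-value true true true = refl
  ι-value true true false = refl
  ι-value true false true = refl
  ι-value true false false = refl
  ι-value false true true = refl
  ι-value false true false = refl
  ι-value false false true = refl
  ι-value false false false = refl
  ∧-split : ∀ {x y} → x ∧ y ≡ true → x ≡ true × y ≡ true
  ∧-split {true} h = refl , h
  -- Ellipticity agrees with m > 0 once the three inequalities hold; where one of them fails, both
  -- sides vanish.
  finish : ∀ i → isNN p′ ∧ isNN cp′ ∧ isNN mp′ ≡ i →
    when (isPos (sgn (+ 4 * (⟪ mᶠ , N ⟫ * c) - ⟪ pᶠ , N ⟫ * ⟪ pᶠ , N ⟫)))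
         (if i then χvalue (isZero p′) (isZero cp′) (isZero mp′) else 0ℚ)
    ≡ ι (whenℤ (isPos (σ N mᶠ) ∧ i) v₂₄)
  finish false _ rewrite ∧-zeroʳ (isPos (σ N mᶠ)) with isPos
      (sgn (+ 4 * (⟪ mᶠ , N ⟫ * c) - ⟪ pᶠ , N ⟫ * ⟪ pᶠ , N ⟫))
  ... | true = refl
  ... | false = refl
  finish true h =
    trans (cong (λ e → when e (χvalue (isZero p′) (isZero cp′) (isZero mp′)))
            (discriminant-sgn c ⟪ mᶠ , N ⟫ ⟪ pᶠ , N ⟫ (+<+ (s≤s z≤n)) (0≤-sgn p≥0)
              (subst (+ 0 ℤ.≤_) c-p (0≤-sgn c≥p)) (subst (+ 0 ℤ.≤_) m-p (0≤-sgn m≥p))))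
      (ι-when-true (isPos (σ N mᶠ)) (ι-value (isZero p′) (isZero cp′) (isZero mp′)))
    where
    p≥0 = proj₁ (∧-split h)
    c≥p = proj₁ (∧-split (proj₂ (∧-split {isNN p′} h)))
    m≥p = proj₂ (∧-split {isNN cp′} (proj₂ (∧-split {isNN p′} h)))
    p≡ : ⟪ pᶠ , N ⟫ ≡ a - d
    p≡ = trans (⟪p⟫ a b c d) (ℤP.+-identityʳ (a - d))
    c-p : ⟪ c-pᶠ , N ⟫ ≡ c - ⟪ pᶠ , N ⟫
    c-p = trans (⟪c-p⟫ a b c d) (cong (λ p → c - p) (sym p≡))
    m-p : ⟪ m-pᶠ , N ⟫ ≡ ⟪ mᶠ , N ⟫ - ⟪ pᶠ , N ⟫
    m-p = trans (⟪m-p⟫ a b c d) (cong₂ _-_ (sym (trans (⟪m⟫ a b c d) (ℤP.+-identityˡ (- b)))) (sym p≡))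
    ι-when-true : ∀ e {q z} → q ≡ ι z → when e q ≡ ι (whenℤ (e ∧ true) z)
    ι-when-true true eq = eq
    ι-when-true false _ = refl
Erep-piece (mat a b (+ 0) d) =
  sym (ePiece-c≤0 (mat a b (+ 0) d) (cong isPos (cong sgn (⟪c⟫ a b (+ 0) d))))
Erep-piece (mat a b -[1+ k ] d) =
  sym (ePiece-c≤0 (mat a b -[1+ k ] d) (cong isPos (cong sgn (⟪c⟫ a b -[1+ k ] d))))

overReps-piece : ∀ {f} p → (∀ N → f N ≡ ι (⟦ p ⟧ N)) → ∀ N → overReps f N ≡ ι (⟦ ± p ⟧ N)
overReps-piece {f} p eq N = begin
  f N ℚ.+ f (neg N)                    ≡⟨ cong₂ ℚ._+_ (eq N) (eq (neg N)) ⟩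
  ι (⟦ p ⟧ N) ℚ.+ ι (⟦ p ⟧ (neg N))    ≡⟨ ι-+ (⟦ p ⟧ N) (⟦ p ⟧ (neg N)) ⟨
  ι (⟦ p ⟧ N + ⟦ p ⟧ (neg N))          ≡⟨ cong ι (±-overReps p N) ⟨
  ι (⟦ ± p ⟧ N)                        ∎
  where open ≡-Reasoning

E-piece : ∀ N → E N ≡ ι (⟦ ± ePiece ⟧ N)
E-piece = overReps-piece {Erep} ePiece Erep-piece

H-piece : ∀ N → H N ≡ ι (⟦ ± hPiece ⟧ N)
H-piece = overReps-piece {Hrep} hPiece Hrep-piece

X-piece : ∀ N → X N ≡ ι (⟦ ± xPiece ⟧ N)
X-piece = overReps-piece {Xrep} xPiece Xrep-piece

Y-piece : ∀ N → Y N ≡ ι (⟦ ± yPiece ⟧ N)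
Y-piece = overReps-piece {Yrep} yPiece Yrep-piece

Z-piece : ∀ N → Z N ≡ ι (⟦ ± zPiece ⟧ N)
Z-piece = overReps-piece {Zrep} zPiece Zrep-piece

-- The eight summands of T̃ are matched one by one with `definition`; the telescoping
-- `definition-Tℤ` is where det > 0 enters.
T̃-ι : ∀ N → + 0 < det N → T̃ N ≡ ι (Tℤ N)
T̃-ι N det>0 = begin
  T̃ N
    ≡⟨ cong₂ ℚ._+_ (cong₂ ℚ._+_ (cong₂ ℚ._+_ (cong₂ ℚ._+_ (cong₂ ℚ._+_ (cong₂ ℚ._+_ (cong₂ ℚ._+_
         (plain⁻ E ePiece E-piece) (plain H hPiece H-piece))
         (plain X xPiece X-piece)) (conj X xPiece X-piece (adj S) (adj S)))
         (plain Y yPiece Y-piece)) (conj Y yPiece Y-piece (adj (U · U)) (adj U)))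
         (plain Z zPiece Z-piece)) (conj Z zPiece Z-piece (adj (U · U)) (adj U)) ⟩
  ι e ℚ.+ ι h ℚ.+ ι x ℚ.+ ι x′ ℚ.+ ι y ℚ.+ ι y′ ℚ.+ ι z ℚ.+ ι z′
    ≡⟨ collect e h x x′ y y′ z z′ ⟩
  ι (e + h + x + x′ + y + y′ + z + z′)
    ≡⟨ cong ι (reassoc e h x x′ y y′ z z′) ⟩
  ι (translatesSum definition N)
    ≡⟨ cong ι (definition-Tℤ N det>0) ⟩
  ι (Tℤ (1ₘ · N · 1ₘ) + + 0)
    ≡⟨ cong ι (trans (ℤP.+-identityʳ (Tℤ (1ₘ · N · 1ₘ))) (cong Tℤ 1N1)) ⟩
  ι (Tℤ N) ∎
  where
  open ≡-Reasoning
  1N1 : 1ₘ · N · 1ₘ ≡ N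
  1N1 = trans (·-identityʳ (1ₘ · N)) (·-identityˡ N)
  e = ⟦ − (± ePiece) ⟧ (1ₘ · N · 1ₘ)
  h = ⟦ ± hPiece ⟧ (1ₘ · N · 1ₘ)
  x = ⟦ ± xPiece ⟧ (1ₘ · N · 1ₘ)
  x′ = ⟦ − (± xPiece) ⟧ (adj S · N · adj S)
  y = ⟦ ± yPiece ⟧ (1ₘ · N · 1ₘ)
  y′ = ⟦ − (± yPiece) ⟧ (adj (U · U) · N · adj U)
  z = ⟦ ± zPiece ⟧ (1ₘ · N · 1ₘ)
  z′ = ⟦ − (± zPiece) ⟧ (adj (U · U) · N · adj U)
  plain : ∀ f p → (∀ N → f N ≡ ι (⟦ ± p ⟧ N)) → f N ≡ ι (⟦ ± p ⟧ (1ₘ · N · 1ₘ))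
  plain f p eq = trans (eq N) (cong (λ M → ι (⟦ ± p ⟧ M)) (sym 1N1))
  plain⁻ : ∀ f p → (∀ N → f N ≡ ι (⟦ ± p ⟧ N)) → ℚ.- f N ≡ ι (⟦ − (± p) ⟧ (1ₘ · N · 1ₘ))
  plain⁻ f p eq = trans (cong ℚ.-_ (plain f p eq)) (sym (ι-neg (⟦ ± p ⟧ (1ₘ · N · 1ₘ))))
  conj : ∀ f p → (∀ N → f N ≡ ι (⟦ ± p ⟧ N)) → ∀ γ δ →
         ℚ.- f (γ · N · δ) ≡ ι (⟦ − (± p) ⟧ (γ · N · δ))
  conj f p eq γ δ = trans (cong ℚ.-_ (eq (γ · N · δ))) (sym (ι-neg (⟦ ± p ⟧ (γ · N · δ))))
  collect : ∀ e h x x′ y y′ z z′ →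
    ι e ℚ.+ ι h ℚ.+ ι x ℚ.+ ι x′ ℚ.+ ι y ℚ.+ ι y′ ℚ.+ ι z ℚ.+ ι z′ ≡ ι (e + h + x + x′ + y + y′ + z + z′)
  collect e h x x′ y y′ z z′ =
    snoc (e + h + x + x′ + y + y′ + z) z′ (snoc (e + h + x + x′ + y + y′) z
      (snoc (e + h + x + x′ + y) y′ (snoc (e + h + x + x′) y
        (snoc (e + h + x) x′ (snoc (e + h) x (sym (ι-+ e h)))))))
    where
    snoc : ∀ u v {q} → q ≡ ι u → q ℚ.+ ι v ≡ ι (u + v)
    snoc u v eq = trans (cong (ℚ._+ ι v) eq) (sym (ι-+ u v))
  reassoc : ∀ e h x x′ y y′ z z′ →
    e + h + x + x′ + y + y′ + z + z′ ≡ e + (h + (x + (x′ + (y + (y′ + (z + (z′ + + 0)))))))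
  reassoc = solve-∀

-- Classes modulo ±1 and finite supports

neg-involutive : ∀ N → neg (neg N) ≡ N
neg-involutive (mat a b c d) =
  mat≡ (ℤP.neg-involutive a) (ℤP.neg-involutive b) (ℤP.neg-involutive c) (ℤP.neg-involutive d)

neg-·ˡ : ∀ M N → neg M · N ≡ neg (M · N)
neg-·ˡ (mat a b c d) (mat e f g h) = mat≡ (lem a e b g) (lem a f b h) (lem c e d g) (lem c f d h)
  where
  lem : ∀ a e b g → - a * e + - b * g ≡ - (a * e + b * g)
  lem = solve-∀

neg-·ʳ : ∀ M N → M · neg N ≡ neg (M · N)
neg-·ʳ (mat a b c d) (mat e f g h) = mat≡ (lem a e b g) (lem a f b h) (lem c e d g) (lem c f d h)
  where
  lem : ∀ a e b g → a * - e + b * - g ≡ - (a * e + b * g)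
  lem = solve-∀

det-neg : ∀ N → det (neg N) ≡ det N
det-neg (mat a b c d) = lem a b c d
  where
  lem : ∀ a b c d → - a * - d - - b * - c ≡ a * d - b * c
  lem = solve-∀

det-· : ∀ M N → det (M · N) ≡ det M * det N
det-· (mat a b c d) (mat e f g h) = lem a b c d e f g h
  where
  lem : ∀ a b c d e f g h →
        (a * e + b * g) * (c * f + d * h) - (a * f + b * h) * (c * e + d * g)
        ≡ (a * d - b * c) * (e * h - f * g)
  lem = solve-∀

det-adj : ∀ N → det (adj N) ≡ det N
det-adj (mat a b c d) = lem a b c d
  where
  lem : ∀ a b c d → d * a - - b * - c ≡ a * d - b * c
  lem = solve-∀

~-refl : ∀ {M} → M ~ M
~-refl = inj₁ refl

~-sym : ∀ {M N} → M ~ N → N ~ M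
~-sym (inj₁ refl) = inj₁ refl
~-sym {N = N} (inj₂ refl) = inj₂ (sym (neg-involutive N))

~-trans : ∀ {L M N} → L ~ M → M ~ N → L ~ N
~-trans (inj₁ refl) q = q
~-trans (inj₂ refl) (inj₁ refl) = inj₂ refl
~-trans {N = N} (inj₂ refl) (inj₂ refl) = inj₁ (neg-involutive N)

_~?_ : ∀ M N → Dec (M ~ N)
M ~? N = (M ≟ₘ N) ⊎-dec (M ≟ₘ neg N)

~-decSetoid : DecSetoid _ _
~-decSetoid = record
  { Carrier = Mat ; _≈_ = _~_
  ; isDecEquivalence = record
    { isEquivalence = record { refl = ~-refl ; sym = ~-sym ; trans = ~-trans } ; _≟_ = _~?_ } }

simᵇ-does : ∀ M N → simᵇ M N ≡ does (M ~? N)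
simᵇ-does (mat _ _ _ _) (mat _ _ _ _) = refl

~-det : ∀ {M N} → M ~ N → det M ≡ det N
~-det (inj₁ refl) = refl
~-det {N = N} (inj₂ refl) = det-neg N

~-·ˡ : ∀ L {M N} → M ~ N → (L · M) ~ (L · N)
~-·ˡ L (inj₁ refl) = inj₁ refl
~-·ˡ L {N = N} (inj₂ refl) = inj₂ (neg-·ʳ L N)

~-·ʳ : ∀ L {M N} → M ~ N → (M · L) ~ (N · L)
~-·ʳ L (inj₁ refl) = inj₁ refl
~-·ʳ L {N = N} (inj₂ refl) = inj₂ (neg-·ˡ N L)

Invariant : Coef → Set
Invariant h = ∀ {M N} → M ~ N → h M ≡ h N

-- A finite presentation of the sum of `h` over the classes of determinant `n`. Zeros of `h` may be
-- listed or left out, so many lists serve the same `h`; `cover-sum-unique` makes the sum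
-- independent of the choice.
record Cover (n : ℤ) (h : Coef) (L : List Mat) : Set where
  field
    dets : All (λ M → det M ≡ n) L
    distinct : AllPairs (λ P Q → ¬ (P ~ Q)) L
    covers : ∀ N → det N ≡ n → ¬ (h N ≡ 0ℚ) → Any (N ~_) L
open Cover public

weighted : Coef → List Mat → FinSum
weighted h = map λ M → h M , M

coeff-∷ : ∀ q M xs N → coeff ((q , M) ∷ xs) N ≡ (if does (M ~? N) then q else 0ℚ) ℚ.+ coeff xs N
coeff-∷ q M xs N rewrite simᵇ-does M N = refl

coeff-miss : ∀ h L N → All (λ M → ¬ (M ~ N)) L → coeff (weighted h L) N ≡ 0ℚ
coeff-miss h [] N [] = refl
coeff-miss h (M ∷ L) N (M≁N ∷ ms) = begin
  coeff (weighted h (M ∷ L)) N                                      ≡⟨ coeff-∷ (h M) M (weighted h L) N ⟩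
  (if does (M ~? N) then h M else 0ℚ) ℚ.+ coeff (weighted h L) N
    ≡⟨ cong₂ (λ b q → (if b then h M else 0ℚ) ℚ.+ q) (dec-false (M ~? N) M≁N) (coeff-miss h L N ms) ⟩
  0ℚ                                                                ∎
  where open ≡-Reasoning

coeff-hit : ∀ h L N → Invariant h → AllPairs (λ P Q → ¬ (P ~ Q)) L → Any (N ~_) L →
            coeff (weighted h L) N ≡ h N
coeff-hit h (M ∷ L) N inv (M≁ ∷ _) (here N~M) = begin
  coeff (weighted h (M ∷ L)) N ≡⟨ coeff-∷ (h M) M (weighted h L) N ⟩
  (if does (M ~? N) then h M else 0ℚ) ℚ.+ coeff (weighted h L) N
    ≡⟨ cong₂ (λ b q → (if b then h M else 0ℚ) ℚ.+ q) (dec-true (M ~? N) (~-sym N~M))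
         (coeff-miss h L N (All.map (λ M≁P P~N → M≁P (~-sym (~-trans P~N N~M))) M≁)) ⟩
  h M ℚ.+ 0ℚ ≡⟨ ℚP.+-identityʳ (h M) ⟩
  h M ≡⟨ inv (~-sym N~M) ⟩
  h N ∎
  where open ≡-Reasoning
coeff-hit h (M ∷ L) N inv (M≁ ∷ ds) (there N∈L) = begin
  coeff (weighted h (M ∷ L)) N ≡⟨ coeff-∷ (h M) M (weighted h L) N ⟩
  (if does (M ~? N) then h M else 0ℚ) ℚ.+ coeff (weighted h L) N
    ≡⟨ cong₂ (λ b q → (if b then h M else 0ℚ) ℚ.+ q) (dec-false (M ~? N) M≁N) (coeff-hit h L N inv ds N∈L) ⟩
  0ℚ ℚ.+ h N ≡⟨ ℚP.+-identityˡ (h N) ⟩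
  h N ∎
  where
  open ≡-Reasoning
  M≁N : ¬ (M ~ N)
  M≁N M~N = All.lookupAny M≁ N∈L .proj₁ (~-trans M~N (All.lookupAny M≁ N∈L .proj₂))

coeff-cover : ∀ {n h L} → Invariant h → Cover n h L → ∀ N → det N ≡ n → coeff (weighted h L) N ≡ h N
coeff-cover {h = h} {L} inv C N dN with Any.any? (N ~?_) L
... | yes N∈L = coeff-hit h L N inv (distinct C) N∈L
... | no N∉L with h N ℚP.≟ 0ℚ
...   | no hN≢0 = contradiction (covers C N dN hN≢0) N∉L
...   | yes hN≡0 = trans (coeff-miss h L N (All.map (λ N≁M M~N → N≁M (~-sym M~N))
    (AllP.¬Any⇒All¬ L N∉L))) (sym hN≡0)

coeff-offdet : ∀ {n h L} → Cover n h L → ∀ N → ¬ (det N ≡ n) → coeff (weighted h L) N ≡ 0ℚ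
coeff-offdet {h = h} {L} C N dN≢n =
  coeff-miss h L N (All.map (λ dM M~N → dN≢n (trans (sym (~-det M~N)) dM)) (dets C))

sum-+ : ∀ {A : Set} (f g : A → ℚ) xs →
        sumℚ (map (λ x → f x ℚ.+ g x) xs) ≡ sumℚ (map f xs) ℚ.+ sumℚ (map g xs)
sum-+ f g [] = refl
sum-+ f g (x ∷ xs) = trans (cong (f x ℚ.+ g x ℚ.+_) (sum-+ f g xs))
                           (interchange (f x) (g x) (sumℚ (map f xs)) (sumℚ (map g xs)))
  where
  open import Algebra.Properties.CommutativeSemigroup
    (CommutativeMonoid.commutativeSemigroup ℚP.+-0-commutativeMonoid)

sum-0 : ∀ {A : Set} (xs : List A) → sumℚ (map (λ _ → 0ℚ) xs) ≡ 0ℚ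
sum-0 [] = refl
sum-0 (x ∷ xs) = cong (0ℚ ℚ.+_) (sum-0 xs)

sum-cong : ∀ {A : Set} {P : A → Set} (f g : A → ℚ) {xs} → (∀ {x} → P x → f x ≡ g x) → All P xs →
           sumℚ (map f xs) ≡ sumℚ (map g xs)
sum-cong f g eq [] = refl
sum-cong f g eq (px ∷ pxs) = cong₂ ℚ._+_ (eq px) (sum-cong f g eq pxs)

sum-swap : ∀ {A B : Set} (k : A → B → ℚ) xs ys →
           sumℚ (map (λ x → sumℚ (map (k x) ys)) xs) ≡ sumℚ (map (λ y → sumℚ (map (λ x → k x y) xs)) ys)
sum-swap k [] ys = sym (sum-0 ys)
sum-swap k (x ∷ xs) ys = trans (cong (sumℚ (map (k x) ys) ℚ.+_) (sum-swap k xs ys))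
                               (sym (sum-+ (k x) (λ y → sumℚ (map (λ x → k x y) xs)) ys))

coeff-sum : ∀ h L N → coeff (weighted h L) N ≡ sumℚ (map (λ M → if does (M ~? N) then h M else 0ℚ) L)
coeff-sum h [] N = refl
coeff-sum h (M ∷ L) N = trans (coeff-∷ (h M) M (weighted h L) N)
  (cong ((if does (M ~? N) then h M else 0ℚ) ℚ.+_) (coeff-sum h L N))

-- Double counting of k(M, N), which is h(M) if M ~ N and 0 otherwise, over the two lists. Summed
-- over one list with the other argument fixed, it is a coefficient of the formal sum on that list,
-- hence a value of `h` by `coeff-cover`.
cover-sum-unique : ∀ {n h L L′} → Invariant h → Cover n h L → Cover n h L′ →
                   sumℚ (map h L) ≡ sumℚ (map h L′)
cover-sum-unique {n} {h} {L} {L′} inv C C′ = begin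
  sumℚ (map h L)
    ≡⟨ sum-cong h (λ N → sumℚ (map (λ M → k M N) L′)) (λ {N} dN → sym (row L′ C′ N dN)) (dets C) ⟩
  sumℚ (map (λ N → sumℚ (map (λ M → k M N) L′)) L)
    ≡⟨ sum-swap (λ N M → k M N) L L′ ⟩
  sumℚ (map (λ M → sumℚ (map (λ N → k M N) L)) L′)
    ≡⟨ sum-cong (λ M → sumℚ (map (λ N → k M N) L)) h
        (λ {M} dM → trans (sum-cong (k M) (λ N → k N M) (λ {N} _ → k-sym M N)
            (All.universal (λ _ → refl {x = n}) L))
         (row L C M dM)) (dets C′) ⟩
  sumℚ (map h L′) ∎
  where
  open ≡-Reasoning
  k : Mat → Mat → ℚ
  k M N = if does (M ~? N) then h M else 0ℚ
  k-sym : ∀ M N → k M N ≡ k N M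
  k-sym M N = by (M ~? N)
    where
    by : Dec (M ~ N) → k M N ≡ k N M
    by (yes M~N) = trans (cong (λ b → if b then h M else 0ℚ) (dec-true (M ~? N) M~N))
      (trans (inv M~N) (cong (λ b → if b then h N else 0ℚ) (sym (dec-true (N ~? M) (~-sym M~N)))))
    by (no M≁N) = trans (cong (λ b → if b then h M else 0ℚ) (dec-false (M ~? N) M≁N))
      (cong (λ b → if b then h N else 0ℚ) (sym (dec-false (N ~? M) (λ N~M → M≁N (~-sym N~M)))))
  row : ∀ L → Cover n h L → ∀ N → det N ≡ n → sumℚ (map (λ M → k M N) L) ≡ h N
  row L C N dN = trans (sym (coeff-sum h L N)) (coeff-cover inv C N dN)

-- Supports contained in boxes

record Box (B : ℕ) (N : Mat) : Set where
  constructor box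
  field
    ∣a∣≤ : ∣ a N ∣ ℕ.≤ B
    ∣b∣≤ : ∣ b N ∣ ℕ.≤ B
    ∣c∣≤ : ∣ c N ∣ ℕ.≤ B
    ∣d∣≤ : ∣ d N ∣ ℕ.≤ B

Bounded : ℤ → Coef → Set
Bounded n h = ∃ λ B → ∀ N → det N ≡ n → ¬ (h N ≡ 0ℚ) → Box B N

-- Zero is listed twice; repetitions disappear in `boxClasses`, which keeps one matrix of each class
-- modulo ±1.
interval : ℕ → List ℤ
interval B = map +_ (upTo (suc B)) ++ map (λ k → - + k) (upTo (suc B))

∈-interval : ∀ {B} x → ∣ x ∣ ℕ.≤ B → x ∈ interval B
∈-interval (+ k) k≤B = ∈P.∈-++⁺ˡ (∈P.∈-map⁺ +_ (∈P.∈-upTo⁺ (s≤s k≤B)))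
∈-interval {B} -[1+ k ] k≤B =
  ∈P.∈-++⁺ʳ (map +_ (upTo (suc B))) (∈P.∈-map⁺ (λ k → - + k) (∈P.∈-upTo⁺ (s≤s k≤B)))

boxList : ℕ → List Mat
boxList B = cartesianProductWith (λ { (a , b) (c , d) → mat a b c d }) rows rows
  where rows = cartesianProductWith _,_ (interval B) (interval B)

∈-boxList : ∀ {B} N → Box B N → N ∈ boxList B
∈-boxList (mat a b c d) (box p q r s) = ∈P.∈-cartesianProductWith⁺ _
  (∈P.∈-cartesianProductWith⁺ _,_ (∈-interval a p) (∈-interval b q))
  (∈P.∈-cartesianProductWith⁺ _,_ (∈-interval c r) (∈-interval d s))

boxClasses : ℤ → ℕ → List Mat
boxClasses n B = deduplicate _~?_ (filter (λ N → det N ℤ.≟ n) (boxList B))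

cover-box : ∀ {n h} B → (∀ N → det N ≡ n → ¬ (h N ≡ 0ℚ) → Box B N) → Cover n h (boxClasses n B)
cover-box {n} {h} B bound = record
  { dets = AllP.deduplicate⁺ _~?_ (AllP.all-filter (λ N → det N ℤ.≟ n) (boxList B))
  ; distinct = deduplicate-! ~-decSetoid (filter (λ N → det N ℤ.≟ n) (boxList B))
  ; covers = λ N dN hN≢0 → AnyP.deduplicate⁺ _~?_ (λ y~x N~x → ~-trans N~x (~-sym y~x))
      (Any.map (λ { refl → ~-refl }) (∈P.∈-filter⁺ (λ N → det N ℤ.≟ n) (∈-boxList N (bound N dN hN≢0)) dN))
  }

∣xy+zw∣≤ : ∀ {B C} x y z w → ∣ x ∣ ℕ.≤ B → ∣ z ∣ ℕ.≤ B → ∣ y ∣ ℕ.≤ C → ∣ w ∣ ℕ.≤ C →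
           ∣ x * y + z * w ∣ ℕ.≤ B ℕ.* C ℕ.+ B ℕ.* C
∣xy+zw∣≤ {B} {C} x y z w p q r s = begin
  ∣ x * y + z * w ∣                      ≤⟨ ℤP.∣i+j∣≤∣i∣+∣j∣ (x * y) (z * w) ⟩
  ∣ x * y ∣ ℕ.+ ∣ z * w ∣                ≡⟨ cong₂ ℕ._+_ (ℤP.∣i*j∣≡∣i∣*∣j∣ x y) (ℤP.∣i*j∣≡∣i∣*∣j∣ z w) ⟩
  ∣ x ∣ ℕ.* ∣ y ∣ ℕ.+ ∣ z ∣ ℕ.* ∣ w ∣    ≤⟨ ℕP.+-mono-≤ (ℕP.*-mono-≤ p r) (ℕP.*-mono-≤ q s) ⟩
  B ℕ.* C ℕ.+ B ℕ.* C                    ∎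
  where open ℕP.≤-Reasoning

Box-· : ∀ {B C} M N → Box B M → Box C N → Box (B ℕ.* C ℕ.+ B ℕ.* C) (M · N)
Box-· (mat a b c d) (mat e f g h) (box p q r s) (box t u v w) =
  box (∣xy+zw∣≤ a e b g p q t v) (∣xy+zw∣≤ a f b h p q u w)
      (∣xy+zw∣≤ c e d g r s t v) (∣xy+zw∣≤ c f d h r s u w)

Box-mono : ∀ {B C N} → B ℕ.≤ C → Box B N → Box C N
Box-mono B≤C (box p q r s) =
  box (ℕP.≤-trans p B≤C) (ℕP.≤-trans q B≤C) (ℕP.≤-trans r B≤C) (ℕP.≤-trans s B≤C)

size : Mat → ℕ
size (mat a b c d) = ∣ a ∣ ℕ.+ ∣ b ∣ ℕ.+ (∣ c ∣ ℕ.+ ∣ d ∣)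

Box-size : ∀ N → Box (size N) N
Box-size (mat a b c d) = box
  (ℕP.≤-trans (ℕP.m≤m+n _ ∣ b ∣) (ℕP.m≤m+n _ _)) (ℕP.≤-trans (ℕP.m≤n+m _ ∣ a ∣) (ℕP.m≤m+n _ _))
  (ℕP.≤-trans (ℕP.m≤m+n _ ∣ d ∣) (ℕP.m≤n+m _ (∣ a ∣ ℕ.+ ∣ b ∣)))
      (ℕP.≤-trans (ℕP.m≤n+m _ ∣ c ∣) (ℕP.m≤n+m _ (∣ a ∣ ℕ.+ ∣ b ∣)))

Bounded-⊕ : ∀ {n f g} → Bounded n f → Bounded n g → Bounded n (f ⊕ g)
Bounded-⊕ {f = f} {g} (B , boundf) (C , boundg) = B ℕ.+ C , bound
  where
  bound : ∀ N → det N ≡ _ → ¬ (f N ℚ.+ g N ≡ 0ℚ) → Box (B ℕ.+ C) N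
  bound N dN h≢0 with f N ℚP.≟ 0ℚ
  ... | no f≢0 = Box-mono (ℕP.m≤m+n B C) (boundf N dN f≢0)
  ... | yes f≡0 = Box-mono (ℕP.m≤n+m C B)
    (boundg N dN λ g≡0 → h≢0 (cong₂ ℚ._+_ f≡0 g≡0))

N·adjγ·γ : ∀ N γ → det γ ≡ + 1 → N · adj γ · γ ≡ N
N·adjγ·γ (mat a b c d) (mat e f g h) dγ =
  mat≡ (first a b e f g h dγ) (second a b e f g h dγ) (first c d e f g h dγ) (second c d e f g h dγ)
  where
  first : ∀ a b e f g h → e * h - f * g ≡ + 1 →
          (a * h + b * - g) * e + (a * - f + b * e) * g ≡ a
  first a b e f g h dγ = trans (lem a b e f g h) (trans (cong (a *_) dγ) (ℤP.*-identityʳ a))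
    where
    lem : ∀ a b e f g h → (a * h + b * - g) * e + (a * - f + b * e) * g ≡ a * (e * h - f * g)
    lem = solve-∀
  second : ∀ a b e f g h → e * h - f * g ≡ + 1 →
           (a * h + b * - g) * f + (a * - f + b * e) * h ≡ b
  second a b e f g h dγ = trans (lem a b e f g h) (trans (cong (b *_) dγ) (ℤP.*-identityʳ b))
    where
    lem : ∀ a b e f g h → (a * h + b * - g) * f + (a * - f + b * e) * h ≡ b * (e * h - f * g)
    lem = solve-∀

-- N = (N γ⁻¹) γ, and multiplication by the fixed γ enlarges entries by a bounded factor only.
Bounded-◃ : ∀ {n h} γ → det γ ≡ + 1 → Bounded n h → Bounded n (h ◃ γ)
Bounded-◃ {n} {h} γ dγ (B , bound) = B ℕ.* size γ ℕ.+ B ℕ.* size γ , λ N dN h≢0 →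
  subst (Box _) (N·adjγ·γ N γ dγ) (Box-· (N · adj γ) γ (bound (N · adj γ) (trans (det-· N (adj γ))
    (trans (cong₂ _*_ dN (trans (det-adj γ) dγ)) (ℤP.*-identityʳ n))) h≢0) (Box-size γ))

-- The support of T̃

cellOf : Mat → Cell
cellOf N = toCell (map (σ N) (forms baseArrangement))

data InSomeCone (s : Cell) : Set where
  in₁ : inCone₁ s ≡ true → InSomeCone s
  in₂ : inCone₂ s ≡ true → InSomeCone s
  in₃ : inCone₃ s ≡ true → InSomeCone s
  in₄ : inCone₄ s ≡ true → InSomeCone s

τ-support : ∀ s → ¬ (τ s ≡ + 0) → InSomeCone s
τ-support s τ≢0 with inCone₁ s in e₁ | inCone₂ s in e₂ | inCone₃ s in e₃ | inCone₄ s in e₄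
... | true | _ | _ | _ = in₁ e₁
... | _ | true | _ | _ = in₂ e₂
... | _ | _ | true | _ = in₃ e₃
... | _ | _ | _ | true = in₄ e₄
... | false | false | false | false = contradiction refl τ≢0

∧-split : ∀ {x y} → x ∧ y ≡ true → x ≡ true × y ≡ true
∧-split {true} h = refl , h

ℕ-of : ∀ {z} → isNN (sgn z) ≡ true → ∃ λ k → z ≡ + k
ℕ-of {+ k} _ = k , refl

suc-of : ∀ {z} → isPos (sgn z) ≡ true → ∃ λ k → z ≡ + suc k
suc-of {+ suc k} _ = k , refl

flipNN : ∀ {z} → isNN (flip (sgn z)) ≡ true → ∃ λ k → z ≡ - + k
flipNN {+ 0} _ = 0 , refl
flipNN { -[1+ k ]} _ = suc k , refl

-- Points of the cone in terms of the slacks of its inequalities: α = -a, p, u = c - p, v = m - c.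
-- These inequalities hold by construction, and det becomes an expression to which estimates in ℕ
-- apply.
cone₁-mat : (α p u v : ℕ) → Mat
cone₁-mat α p u v = mat (- + α) (- + (p ℕ.+ u ℕ.+ v)) (+ (p ℕ.+ u)) (- + (α ℕ.+ p))

cone₂-mat : (a δ u v : ℕ) → Mat
cone₂-mat a δ u v = mat (+ a) (- + (a ℕ.+ δ ℕ.+ u)) (+ (a ℕ.+ δ ℕ.+ u ℕ.+ v)) (- + δ)

cone₂′-mat : (α p u v : ℕ) → Mat
cone₂′-mat α p u v = mat (- + α) (- + (p ℕ.+ u)) (+ (p ℕ.+ u ℕ.+ v)) (- + (α ℕ.+ p))

cone₃-mat : (δ w u v : ℕ) → Mat
cone₃-mat δ w u v = mat (+ suc (w ℕ.+ u)) (- + suc (δ ℕ.+ w)) (+ suc (δ ℕ.+ w ℕ.+ u ℕ.+ v)) (- + δ)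

cone₄-mat : (c w u v : ℕ) → Mat
cone₄-mat c w u v = mat (+ suc (c ℕ.+ w)) (+ v - + c) (+ c) (+ suc (w ℕ.+ u ℕ.+ v))

cone₁-param : ∀ N → inCone₁ (cellOf N) ≡ true →
              ∃ λ α → ∃ λ p → ∃ λ u → ∃ λ v → N ≡ cone₁-mat α p u v × 0 ℕ.< p ℕ.+ u
cone₁-param N@(mat a b c d) h
  with ∧-split h
... | c>0 , h with ∧-split h
... | a≤0 , h with ∧-split h
... | p≥0 , h with ∧-split h
... | cp≥0 , cm≤0
  with suc-of c>0 | flipNN a≤0 | ℕ-of p≥0 | ℕ-of cp≥0 | flipNN cm≤0
... | k , ck | α , aα | p , pp | u , uu | v , vv = α , p , u , v , mat≡ a≡ b≡ c≡ d≡ , p+u>0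
  where
  a≡ : a ≡ - + α
  a≡ = trans (sym (ℤP.+-identityʳ a)) (trans (sym (⟪a⟫ a b c d)) aα)
  a-d≡ : a - d ≡ + p
  a-d≡ = trans (sym (ℤP.+-identityʳ (a - d))) (trans (sym (⟪p⟫ a b c d)) pp)
  c≡ : c ≡ + (p ℕ.+ u)
  c≡ = trans (lem c (a - d)) (cong₂ _+_ a-d≡ (trans (sym (⟪c-p⟫ a b c d)) uu))
    where
    lem : ∀ c p → c ≡ p + (c - p)
    lem = solve-∀
  b≡ : b ≡ - + (p ℕ.+ u ℕ.+ v)
  b≡ = trans (lem b c) (trans (cong₂ (λ x y → - (x - y)) c≡ (trans (sym (⟪c-m⟫ a b c d)) vv))
         (cong (λ t → - (+ (p ℕ.+ u) + t)) (ℤP.neg-involutive (+ v))))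
    where
    lem : ∀ b c → b ≡ - (c - (c - - b))
    lem = solve-∀
  d≡ : d ≡ - + (α ℕ.+ p)
  d≡ = trans (lem a d) (trans (cong₂ (λ x y → - (- x + y)) a≡ a-d≡)
         (cong (λ t → - (t + + p)) (ℤP.neg-involutive (+ α))))
    where
    lem : ∀ a d → d ≡ - (- a + (a - d))
    lem = solve-∀
  p+u>0 : 0 ℕ.< p ℕ.+ u
  p+u>0 = ℤP.drop‿+<+ (subst (+ 0 <_) (trans (trans (sym ck)
      (trans (⟪c⟫ a b c d) (ℤP.+-identityʳ c))) c≡) (+<+ (s≤s z≤n)))

-- Split by the sign of a. With d = -δ the determinant is α δ + m c for a = -α ≤ 0 and m c - a δ for
-- a > 0, and the two call for different estimates.
Cone₂Param : Mat → Set
Cone₂Param N = (∃ λ a → ∃ λ δ → ∃ λ u → ∃ λ v → N ≡ cone₂-mat (suc a) δ u v)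
               ⊎ (∃ λ α → ∃ λ p → ∃ λ u → ∃ λ v → N ≡ cone₂′-mat α p u v × 0 ℕ.< p ℕ.+ u)

cone₂-param : ∀ N → inCone₂ (cellOf N) ≡ true → Cone₂Param N
cone₂-param N@(mat a b c d) h
  with ∧-split h
... | m>0 , h with ∧-split h
... | d≤0 , h with ∧-split h
... | p≥0 , h with ∧-split h
... | mp≥0 , cm≥0
  with suc-of m>0 | flipNN d≤0 | ℕ-of p≥0 | ℕ-of mp≥0 | ℕ-of cm≥0
... | k , mk | δ , dδ | p , pp | u , uu | v , vv = go a refl
  where
  d≡ : d ≡ - + δ
  d≡ = trans (sym (ℤP.+-identityʳ d)) (trans (sym (⟪d⟫ a b c d)) dδ)
  a-d≡ : a - d ≡ + p
  a-d≡ = trans (sym (ℤP.+-identityʳ (a - d))) (trans (sym (⟪p⟫ a b c d)) pp)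
  b≡ : b ≡ - + (p ℕ.+ u)
  b≡ = trans (lem b (a - d)) (cong₂ (λ x y → - (x + y)) a-d≡ (trans (sym (⟪m-p⟫ a b c d)) uu))
    where
    lem : ∀ b p → b ≡ - (p + (- b - p))
    lem = solve-∀
  c≡ : c ≡ + (p ℕ.+ u ℕ.+ v)
  c≡ = trans (lem b c) (cong₂ _+_ (trans (cong -_ b≡) (ℤP.neg-involutive (+ (p ℕ.+ u))))
         (trans (sym (⟪c-m⟫ a b c d)) vv))
    where
    lem : ∀ b c → c ≡ - b + (c - - b)
    lem = solve-∀
  p+u>0 : 0 ℕ.< p ℕ.+ u
  p+u>0 = ℤP.drop‿+<+ (subst (+ 0 <_) (trans (trans (sym mk) (trans (⟪m⟫ a b c d) (ℤP.+-identityˡ (- b))))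
            (trans (cong -_ b≡) (ℤP.neg-involutive (+ (p ℕ.+ u))))) (+<+ (s≤s z≤n)))
  p≡ : ∀ k → a ≡ + k → p ≡ k ℕ.+ δ
  p≡ k eq = ℤP.+-injective (trans (sym a-d≡) (cong₂ _+_ eq (trans (cong -_ d≡) (ℤP.neg-involutive (+ δ)))))
  δ≡ : ∀ α → a ≡ - + α → + δ ≡ + (α ℕ.+ p)
  δ≡ α eq = trans (sym (trans (cong -_ d≡) (ℤP.neg-involutive (+ δ)))) (trans (lem a d)
              (cong₂ _+_ (trans (cong -_ eq) (ℤP.neg-involutive (+ α))) a-d≡))
    where
    lem : ∀ a d → - d ≡ - a + (a - d)
    lem = solve-∀
  nonpos : ∀ α → a ≡ - + α → ∃ λ α → ∃ λ p → ∃ λ u → ∃ λ v → N ≡ cone₂′-mat α p u v × 0 ℕ.< p ℕ.+ u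
  nonpos α eq = α , p , u , v , mat≡ eq b≡ c≡ (trans d≡ (cong -_ (δ≡ α eq))) , p+u>0
  go : ∀ z → a ≡ z → Cone₂Param N
  go (+ 0) eq = inj₂ (nonpos 0 eq)
  go -[1+ α ] eq = inj₂ (nonpos (suc α) eq)
  go (+ suc k) eq with p≡ (suc k) eq
  ... | refl = inj₁ (k , δ , u , v , mat≡ eq b≡ c≡ d≡)

cone₃-param : ∀ N → inCone₃ (cellOf N) ≡ true →
              ∃ λ δ → ∃ λ w → ∃ λ u → ∃ λ v → N ≡ cone₃-mat δ w u v
cone₃-param N@(mat a b c d) h
  with ∧-split {isPos (σ N mᶠ)} h
... | _ , h with ∧-split h
... | d≤0 , h with ∧-split h
... | dm>0 , h with ∧-split h
... | mp≤0 , cp≥0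
  with flipNN d≤0 | suc-of dm>0 | flipNN mp≤0 | ℕ-of cp≥0
... | δ , dδ | w , ww | u , uu | v , vv = δ , w , u , v , mat≡ a≡ b≡ c≡ d≡
  where
  d≡ : d ≡ - + δ
  d≡ = trans (sym (ℤP.+-identityʳ d)) (trans (sym (⟪d⟫ a b c d)) dδ)
  d-b≡ : d - b ≡ + suc w
  d-b≡ = trans (sym (⟪d+m⟫ a b c d)) ww
  b≡ : b ≡ - + suc (δ ℕ.+ w)
  b≡ = trans (lem b d) (trans (cong₂ (λ x y → - (- x + y)) d≡ d-b≡)
         (cong (λ t → - t) (trans (cong (_+ + suc w) (ℤP.neg-involutive (+ δ))) (cong +_ (ℕP.+-suc δ w)))))
    where
    lem : ∀ b d → b ≡ - (- d + (d - b))
    lem = solve-∀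
  p≡ : a - d ≡ + suc (δ ℕ.+ w ℕ.+ u)
  p≡ = trans (lem b (a - d)) (trans (cong₂ (λ x y → - x - y) b≡ (trans (sym (⟪m-p⟫ a b c d)) uu))
         (cong₂ _+_ (ℤP.neg-involutive (+ suc (δ ℕ.+ w))) (ℤP.neg-involutive (+ u))))
    where
    lem : ∀ b p → p ≡ - b - (- b - p)
    lem = solve-∀
  a≡ : a ≡ + suc (w ℕ.+ u)
  a≡ = trans (lem a d) (trans (cong₂ _+_ p≡ d≡) (lem′ (+ δ) (+ w) (+ u)))
    where
    lem : ∀ a d → a ≡ a - d + d
    lem = solve-∀
    lem′ : ∀ δ w u → + 1 + (δ + w + u) + - δ ≡ + 1 + (w + u)
    lem′ = solve-∀
  c≡ : c ≡ + suc (δ ℕ.+ w ℕ.+ u ℕ.+ v)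
  c≡ = trans (lem c (a - d)) (cong₂ _+_ p≡ (trans (sym (⟪c-p⟫ a b c d)) vv))
    where
    lem : ∀ c p → c ≡ p + (c - p)
    lem = solve-∀

cone₄-param : ∀ N → inCone₄ (cellOf N) ≡ true →
              ∃ λ c → ∃ λ w → ∃ λ u → ∃ λ v → N ≡ cone₄-mat c w u v
cone₄-param N@(mat a b c d) h
  with ∧-split h
... | c≥0 , h with ∧-split h
... | ac>0 , h with ∧-split h
... | mp≥0 , cm≥0
  with ℕ-of c≥0 | suc-of ac>0 | ℕ-of mp≥0 | ℕ-of cm≥0
... | k , ck | w , ww | u , uu | v , vv = k , w , u , v , mat≡ a≡ b≡ c≡ d≡
  where
  c≡ : c ≡ + k
  c≡ = trans (sym (ℤP.+-identityʳ c)) (trans (sym (⟪c⟫ a b c d)) ck)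
  a≡ : a ≡ + suc (k ℕ.+ w)
  a≡ = trans (lem a c) (trans (cong₂ _+_ c≡ (trans (sym (⟪a-c⟫ a b c d)) ww)) (cong +_ (ℕP.+-suc k w)))
    where
    lem : ∀ a c → a ≡ c + (a - c)
    lem = solve-∀
  c-m≡ : c - - b ≡ + v
  c-m≡ = trans (sym (⟪c-m⟫ a b c d)) vv
  b≡ : b ≡ + v - + k
  b≡ = trans (lem b c) (cong₂ _-_ c-m≡ c≡)
    where
    lem : ∀ b c → b ≡ c - - b - c
    lem = solve-∀
  d≡ : d ≡ + suc (w ℕ.+ u ℕ.+ v)
  d≡ = trans (lem a b d) (trans (cong₂ (λ x y → x + a + y) (trans (sym (⟪m-p⟫ a b c d)) uu) b≡)
         (trans (cong (λ t → + u + t + (+ v - + k)) a≡) (lem′ (+ k) (+ w) (+ u) (+ v))))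
    where
    lem : ∀ a b d → d ≡ - b - (a - d) + a + b
    lem = solve-∀
    lem′ : ∀ k w u v → u + (+ 1 + (k + w)) + (v - k) ≡ + 1 + (w + u + v)
    lem′ = solve-∀

≤-summand : ∀ {n x} r → n ≡ x ℕ.+ r → x ℕ.≤ n
≤-summand {x = x} r refl = ℕP.m≤m+n x r

∣-+∣ : ∀ k {n} → k ℕ.≤ n → ∣ - + k ∣ ℕ.≤ n
∣-+∣ k {n} = subst (ℕ._≤ n) (sym (ℤP.∣-i∣≡∣i∣ (+ k)))

det-elliptic : ∀ α δ m c → det (mat (- + α) (- + m) (+ c) (- + δ)) ≡ + (α ℕ.* δ ℕ.+ m ℕ.* c)
det-elliptic α δ m c = trans (lem (+ α) (+ δ) (+ m) (+ c))
    (cong₂ _+_ (sym (ℤP.pos-* α δ)) (sym (ℤP.pos-* m c)))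
  where
  lem : ∀ α δ m c → - α * - δ - - m * c ≡ α * δ + m * c
  lem = solve-∀

det-mixed : ∀ a δ m c r → m ℕ.* c ≡ a ℕ.* δ ℕ.+ r → det (mat (+ a) (- + m) (+ c) (- + δ)) ≡ + r
det-mixed a δ m c r eq = begin
  + a * - + δ - - + m * + c     ≡⟨ lem (+ a) (+ δ) (+ m) (+ c) ⟩
  + m * + c - + a * + δ         ≡⟨ cong₂ _-_ (sym (ℤP.pos-* m c)) (sym (ℤP.pos-* a δ)) ⟩
  + (m ℕ.* c) - + (a ℕ.* δ)     ≡⟨ cong (λ x → + x - + (a ℕ.* δ)) eq ⟩
  + (a ℕ.* δ) + + r - + (a ℕ.* δ) ≡⟨ lem′ (+ (a ℕ.* δ)) (+ r) ⟩
  + r                           ∎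
  where
  open ≡-Reasoning
  lem : ∀ a δ m c → a * - δ - - m * c ≡ m * c - a * δ
  lem = solve-∀
  lem′ : ∀ x r → x + r - x ≡ r
  lem′ = solve-∀

det-cone₄ : ∀ k w u v → det (cone₄-mat k w u v)
            ≡ + (k ℕ.* suc (w ℕ.+ u) ℕ.+ suc w ℕ.* suc (w ℕ.+ u ℕ.+ v) ℕ.+ k ℕ.* k)
det-cone₄ k w u v = trans (lem (+ k) (+ w) (+ u) (+ v))
  (cong₂ _+_ (cong₂ _+_ (sym (ℤP.pos-* k (suc (w ℕ.+ u)))) (sym (ℤP.pos-* (suc w) (suc (w ℕ.+ u ℕ.+ v)))))
             (sym (ℤP.pos-* k k)))
  where
  lem : ∀ k w u v → (+ 1 + (k + w)) * (+ 1 + (w + u + v)) - (v - k) * k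
        ≡ k * (+ 1 + (w + u)) + (+ 1 + w) * (+ 1 + (w + u + v)) + k * k
  lem = solve-∀

-- α δ + m c = n with m, c > 0 bounds m and c by n. It bounds δ = α + p as well if α > 0; if α = 0,
-- then δ is p, which `small` compares with m or c.
elliptic-bound : ∀ {n} α p m c → α ℕ.* (α ℕ.+ p) ℕ.+ m ℕ.* c ≡ n → 0 ℕ.< m → 0 ℕ.< c →
                 p ℕ.≤ m ⊎ p ℕ.≤ c → Box n (mat (- + α) (- + m) (+ c) (- + (α ℕ.+ p)))
elliptic-bound {n} α p m@(suc _) c@(suc _) eq _ _ small =
  box (∣-+∣ α (ℕP.≤-trans (ℕP.m≤m+n α p) (δ≤n α eq))) (∣-+∣ m m≤n) c≤n (∣-+∣ (α ℕ.+ p) (δ≤n α eq))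
  where
  mc≤n : m ℕ.* c ℕ.≤ n
  mc≤n = subst (m ℕ.* c ℕ.≤_) eq (ℕP.m≤n+m (m ℕ.* c) (α ℕ.* (α ℕ.+ p)))
  m≤n : m ℕ.≤ n
  m≤n = ℕP.≤-trans (ℕP.m≤m*n m c) mc≤n
  c≤n : c ℕ.≤ n
  c≤n = ℕP.≤-trans (ℕP.m≤n*m c m) mc≤n
  p≤n : p ℕ.≤ m ⊎ p ℕ.≤ c → p ℕ.≤ n
  p≤n (inj₁ p≤m) = ℕP.≤-trans p≤m m≤n
  p≤n (inj₂ p≤c) = ℕP.≤-trans p≤c c≤n
  δ≤n : ∀ α → α ℕ.* (α ℕ.+ p) ℕ.+ m ℕ.* c ≡ n → α ℕ.+ p ℕ.≤ n
  δ≤n zero _ = p≤n small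
  δ≤n (suc α) eq = ≤-summand _ (trans (sym eq) (ℕP.+-assoc (suc α ℕ.+ p) (α ℕ.* (suc α ℕ.+ p)) (m ℕ.* c)))

mixed-bound : ∀ {n} a δ m c → c ℕ.≤ n → a ℕ.≤ c → m ℕ.≤ c → δ ℕ.≤ c →
              Box n (mat (+ a) (- + m) (+ c) (- + δ))
mixed-bound a δ m c c≤n a≤c m≤c δ≤c =
  box (ℕP.≤-trans a≤c c≤n) (∣-+∣ m (ℕP.≤-trans m≤c c≤n)) c≤n (∣-+∣ δ (ℕP.≤-trans δ≤c c≤n))

cone₁-bound : ∀ n α p u v → 0 ℕ.< p ℕ.+ u → det (cone₁-mat α p u v) ≡ + n → Box n (cone₁-mat α p u v)
cone₁-bound n α p u v c>0 dN = elliptic-bound α p (p ℕ.+ u ℕ.+ v) (p ℕ.+ u)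
  (ℤP.+-injective (trans (sym (det-elliptic α (α ℕ.+ p) (p ℕ.+ u ℕ.+ v) (p ℕ.+ u))) dN))
  (ℕP.≤-trans c>0 (ℕP.m≤m+n (p ℕ.+ u) v)) c>0 (inj₂ (ℕP.m≤m+n p u))

cone₂′-bound : ∀ n α p u v → 0 ℕ.< p ℕ.+ u → det (cone₂′-mat α p u v) ≡ + n → Box n (cone₂′-mat α p u v)
cone₂′-bound n α p u v m>0 dN = elliptic-bound α p (p ℕ.+ u) (p ℕ.+ u ℕ.+ v)
  (ℤP.+-injective (trans (sym (det-elliptic α (α ℕ.+ p) (p ℕ.+ u) (p ℕ.+ u ℕ.+ v))) dN))
  m>0 (ℕP.≤-trans m>0 (ℕP.m≤m+n (p ℕ.+ u) v)) (inj₁ (ℕP.m≤m+n p u))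

-- In slack coordinates m c - a δ is c plus nonnegative terms, so c ≤ n, and no other entry exceeds
-- c in absolute value. The same holds in the third cone.
cone₂-bound : ∀ n a δ u v → det (cone₂-mat (suc a) δ u v) ≡ + n → Box n (cone₂-mat (suc a) δ u v)
cone₂-bound n a δ u v dN = mixed-bound (suc a) δ m c₀
    (≤-summand (a ℕ.* c₀ ℕ.+ δ ℕ.* (δ ℕ.+ u ℕ.+ v) ℕ.+ u ℕ.* c₀)
    (ℤP.+-injective (trans (sym dN) (det-mixed (suc a) δ m c₀ _ (lem a δ u v)))))
  (≤-summand (δ ℕ.+ u ℕ.+ v) (lem₁ (suc a) δ u v)) (ℕP.m≤m+n m v)
      (≤-summand (suc a ℕ.+ u ℕ.+ v) (lem₂ (suc a) δ u v))
  where
  m = suc a ℕ.+ δ ℕ.+ u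
  c₀ = suc a ℕ.+ δ ℕ.+ u ℕ.+ v
  lem : ∀ a δ u v → (suc a ℕ.+ δ ℕ.+ u) ℕ.* (suc a ℕ.+ δ ℕ.+ u ℕ.+ v)
        ≡ suc a ℕ.* δ ℕ.+ ((suc a ℕ.+ δ ℕ.+ u ℕ.+ v) ℕ.+ (a ℕ.* (suc a ℕ.+ δ ℕ.+ u ℕ.+ v)
          ℕ.+ δ ℕ.* (δ ℕ.+ u ℕ.+ v) ℕ.+ u ℕ.* (suc a ℕ.+ δ ℕ.+ u ℕ.+ v)))
  lem = ℕSolver.solve-∀
  lem₁ : ∀ a δ u v → a ℕ.+ δ ℕ.+ u ℕ.+ v ≡ a ℕ.+ (δ ℕ.+ u ℕ.+ v)
  lem₁ = ℕSolver.solve-∀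
  lem₂ : ∀ a δ u v → a ℕ.+ δ ℕ.+ u ℕ.+ v ≡ δ ℕ.+ (a ℕ.+ u ℕ.+ v)
  lem₂ = ℕSolver.solve-∀

cone₃-bound : ∀ n δ w u v → det (cone₃-mat δ w u v) ≡ + n → Box n (cone₃-mat δ w u v)
cone₃-bound n δ w u v dN = mixed-bound (suc (w ℕ.+ u)) δ (suc (δ ℕ.+ w)) c₀
  (≤-summand (δ ℕ.* (δ ℕ.+ v) ℕ.+ w ℕ.* c₀)
    (ℤP.+-injective (trans (sym dN) (det-mixed (suc (w ℕ.+ u)) δ (suc (δ ℕ.+ w)) c₀ _ (lem δ w u v)))))
  (≤-summand (δ ℕ.+ v) (lem₁ δ w u v)) (≤-summand (u ℕ.+ v) (lem₂ δ w u v))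
      (≤-summand (suc (w ℕ.+ u ℕ.+ v)) (lem₃ δ w u v))
  where
  c₀ = suc (δ ℕ.+ w ℕ.+ u ℕ.+ v)
  lem : ∀ δ w u v → suc (δ ℕ.+ w) ℕ.* suc (δ ℕ.+ w ℕ.+ u ℕ.+ v)
        ≡ suc (w ℕ.+ u) ℕ.* δ ℕ.+ (suc (δ ℕ.+ w ℕ.+ u ℕ.+ v) ℕ.+
            (δ ℕ.* (δ ℕ.+ v) ℕ.+ w ℕ.* suc (δ ℕ.+ w ℕ.+ u ℕ.+ v)))
  lem = ℕSolver.solve-∀
  lem₁ : ∀ δ w u v → suc (δ ℕ.+ w ℕ.+ u ℕ.+ v) ≡ suc (w ℕ.+ u) ℕ.+ (δ ℕ.+ v)
  lem₁ = ℕSolver.solve-∀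
  lem₂ : ∀ δ w u v → suc (δ ℕ.+ w ℕ.+ u ℕ.+ v) ≡ suc (δ ℕ.+ w) ℕ.+ (u ℕ.+ v)
  lem₂ = ℕSolver.solve-∀
  lem₃ : ∀ δ w u v → suc (δ ℕ.+ w ℕ.+ u ℕ.+ v) ≡ δ ℕ.+ suc (w ℕ.+ u ℕ.+ v)
  lem₃ = ℕSolver.solve-∀

-- Each of a, c and d splits off the expanded determinant as a summand. The entry b = v - c may have
-- either sign, but |b| ≤ max(v, c) and v < d.
cone₄-bound : ∀ n k w u v → det (cone₄-mat k w u v) ≡ + n → Box n (cone₄-mat k w u v)
cone₄-bound n k w u v dN = box
  (≤-summand (k ℕ.* (w ℕ.+ u) ℕ.+ suc w ℕ.* (w ℕ.+ u ℕ.+ v) ℕ.+ k ℕ.* k) (trans eq (lem₁ k w u v)))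
  (ℕP.≤-trans (subst (ℕ._≤ v ℕ.⊔ k) (cong ∣_∣ (sym (ℤP.m-n≡m⊖n v k))) (ℤP.∣m⊝n∣≤m⊔n v k))
    (ℕP.⊔-lub (ℕP.≤-trans (≤-summand (suc (w ℕ.+ u)) (lem₃ w u v)) d≤n)
      (≤-summand (k ℕ.* (w ℕ.+ u) ℕ.+ suc w ℕ.* suc (w ℕ.+ u ℕ.+ v) ℕ.+ k ℕ.* k)
          (trans eq (lem₄ k w u v)))))
  (≤-summand (k ℕ.* (w ℕ.+ u) ℕ.+ suc w ℕ.* suc (w ℕ.+ u ℕ.+ v) ℕ.+ k ℕ.* k) (trans eq (lem₄ k w u v)))
  d≤n
  where
  eq : n ≡ k ℕ.* suc (w ℕ.+ u) ℕ.+ suc w ℕ.* suc (w ℕ.+ u ℕ.+ v) ℕ.+ k ℕ.* k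
  eq = ℤP.+-injective (trans (sym dN) (det-cone₄ k w u v))
  lem₁ : ∀ k w u v → k ℕ.* suc (w ℕ.+ u) ℕ.+ suc w ℕ.* suc (w ℕ.+ u ℕ.+ v) ℕ.+ k ℕ.* k
         ≡ suc (k ℕ.+ w) ℕ.+ (k ℕ.* (w ℕ.+ u) ℕ.+ suc w ℕ.* (w ℕ.+ u ℕ.+ v) ℕ.+ k ℕ.* k)
  lem₁ = ℕSolver.solve-∀
  lem₂ : ∀ k w u v → k ℕ.* suc (w ℕ.+ u) ℕ.+ suc w ℕ.* suc (w ℕ.+ u ℕ.+ v) ℕ.+ k ℕ.* k
         ≡ suc (w ℕ.+ u ℕ.+ v) ℕ.+ (k ℕ.* suc (w ℕ.+ u) ℕ.+ w ℕ.* suc (w ℕ.+ u ℕ.+ v) ℕ.+ k ℕ.* k)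
  lem₂ = ℕSolver.solve-∀
  lem₃ : ∀ w u v → suc (w ℕ.+ u ℕ.+ v) ≡ v ℕ.+ suc (w ℕ.+ u)
  lem₃ = ℕSolver.solve-∀
  lem₄ : ∀ k w u v → k ℕ.* suc (w ℕ.+ u) ℕ.+ suc w ℕ.* suc (w ℕ.+ u ℕ.+ v) ℕ.+ k ℕ.* k
         ≡ k ℕ.+ (k ℕ.* (w ℕ.+ u) ℕ.+ suc w ℕ.* suc (w ℕ.+ u ℕ.+ v) ℕ.+ k ℕ.* k)
  lem₄ = ℕSolver.solve-∀
  d≤n : suc (w ℕ.+ u ℕ.+ v) ℕ.≤ n
  d≤n = ≤-summand _ (trans eq (lem₂ k w u v))

data Shape (N : Mat) : Set where
  shape₁  : ∀ α p u v → 0 ℕ.< p ℕ.+ u → N ≡ cone₁-mat α p u v → Shape N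
  shape₂  : ∀ a δ u v → N ≡ cone₂-mat (suc a) δ u v → Shape N
  shape₂′ : ∀ α p u v → 0 ℕ.< p ℕ.+ u → N ≡ cone₂′-mat α p u v → Shape N
  shape₃  : ∀ δ w u v → N ≡ cone₃-mat δ w u v → Shape N
  shape₄  : ∀ k w u v → N ≡ cone₄-mat k w u v → Shape N

cone-shape : ∀ N → InSomeCone (cellOf N) → Shape N
cone-shape N (in₁ h) = let α , p , u , v , eq , c>0 = cone₁-param N h in shape₁ α p u v c>0 eq
cone-shape N (in₂ h) with cone₂-param N h
... | inj₁ (a , δ , u , v , eq) = shape₂ a δ u v eq
... | inj₂ (α , p , u , v , eq , m>0) = shape₂′ α p u v m>0 eq
cone-shape N (in₃ h) = let δ , w , u , v , eq = cone₃-param N h in shape₃ δ w u v eq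
cone-shape N (in₄ h) = let k , w , u , v , eq = cone₄-param N h in shape₄ k w u v eq

Shape-bound : ∀ n N → det N ≡ + n → Shape N → Box n N
Shape-bound n N dN (shape₁ α p u v c>0 refl) = cone₁-bound n α p u v c>0 dN
Shape-bound n N dN (shape₂ a δ u v refl) = cone₂-bound n a δ u v dN
Shape-bound n N dN (shape₂′ α p u v m>0 refl) = cone₂′-bound n α p u v m>0 dN
Shape-bound n N dN (shape₃ δ w u v refl) = cone₃-bound n δ w u v dN
Shape-bound n N dN (shape₄ k w u v refl) = cone₄-bound n k w u v dN

Box-neg : ∀ {B} N → Box B (neg N) → Box B N
Box-neg {B} (mat a b c d) (box p q r s) = box (un a p) (un b q) (un c r) (un d s)
  where
  un : ∀ x → ∣ - x ∣ ℕ.≤ B → ∣ x ∣ ℕ.≤ B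
  un x = subst (ℕ._≤ B) (ℤP.∣-i∣≡∣i∣ x)

-- The function of signs that equals `T̃` at positive determinant. It replaces `T̃` from here on,
-- because invariance under ±1, homogeneity and support are read off the signs.
Tq : Coef
Tq N = ι (Tℤ N)

Tq-shape : ∀ N → ¬ (Tq N ≡ 0ℚ) → Shape N ⊎ Shape (neg N)
Tq-shape N T≢0 with ⟦ tPiece ⟧ N ℤ.≟ + 0
... | no t≢0 = inj₁ (cone-shape N (τ-support (cellOf N) t≢0))
... | yes t≡0 = inj₂ (cone-shape (neg N) (τ-support (cellOf (neg N))
  λ t′≡0 → T≢0 (cong ι (trans (±-overReps tPiece N) (cong₂ _+_ t≡0 t′≡0)))))

-- The bound is the determinant itself. Finiteness alone would allow any bound; this one confines
-- the γ that matter for diag(1, k) to bottom rows with entries -1, 0, 1.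
Tq-bound : ∀ n N → det N ≡ + n → ¬ (Tq N ≡ 0ℚ) → Box n N
Tq-bound n N dN T≢0 with Tq-shape N T≢0
... | inj₁ shape = Shape-bound n N dN shape
... | inj₂ shape = Box-neg N (Shape-bound n (neg N) (trans (det-neg N) dN) shape)

Tq-bounded : ∀ n → Bounded (+ n) Tq
Tq-bounded n = n , Tq-bound n

Tq-invariant : Invariant Tq
Tq-invariant (inj₁ refl) = refl
Tq-invariant {N = N} (inj₂ refl) = cong ι (begin
  Tℤ (neg N)                                         ≡⟨ ±-overReps tPiece (neg N) ⟩
  ⟦ tPiece ⟧ (neg N) + ⟦ tPiece ⟧ (neg (neg N))      ≡⟨ cong (λ M → ⟦ tPiece ⟧ (neg N) + ⟦ tPiece ⟧ M)
      (neg-involutive N) ⟩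
  ⟦ tPiece ⟧ (neg N) + ⟦ tPiece ⟧ N                  ≡⟨ ℤP.+-comm (⟦ tPiece ⟧ (neg N)) (⟦ tPiece ⟧ N) ⟩
  ⟦ tPiece ⟧ N + ⟦ tPiece ⟧ (neg N)                  ≡⟨ ±-overReps tPiece N ⟨
  Tℤ N                                               ∎)
  where open ≡-Reasoning

-- Part (a)

restrict-on : ∀ n f N → det N ≡ + n → restrict n f N ≡ f N
restrict-on n f N dN = cong (λ b → if b then f N else 0ℚ) (dec-true (det N ℤ.≟ + n) dN)

restrict-off : ∀ n f N → ¬ (det N ≡ + n) → restrict n f N ≡ 0ℚ
restrict-off n f N dN = cong (λ b → if b then f N else 0ℚ) (dec-false (det N ℤ.≟ + n) dN)

det-·₁ʳ : ∀ N γ → det γ ≡ + 1 → det (N · γ) ≡ det N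
det-·₁ʳ N γ dγ = trans (det-· N γ) (trans (cong (det N *_) dγ) (ℤP.*-identityʳ (det N)))

det-·₁ˡ : ∀ γ N → det γ ≡ + 1 → det (γ · N) ≡ det N
det-·₁ˡ γ N dγ = trans (det-· γ N) (trans (cong (_* det N) dγ) (ℤP.*-identityˡ (det N)))

Invariant-◃ : ∀ {h} γ → Invariant h → Invariant (h ◃ γ)
Invariant-◃ γ inv M~N = inv (~-·ʳ (adj γ) M~N)

Invariant-⊕ : ∀ {f g} → Invariant f → Invariant g → Invariant (f ⊕ g)
Invariant-⊕ inv inv′ M~N = cong₂ ℚ._+_ (inv M~N) (inv′ M~N)

scale : ℚ → Coef → Coef
scale q f N = q ℚ.* f N

Bounded-scale : ∀ {n f} q → Bounded n f → Bounded n (scale q f)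
Bounded-scale {f = f} q (B , bound) = B , λ N dN qf≢0 → bound N dN λ f≡0 →
  qf≢0 (trans (cong (q ℚ.*_) f≡0) (ℚP.*-zeroʳ q))

-- The finite sum lists the classes of determinant n in the bounding box, each with the value of f
-- as its coefficient.
realize : ∀ n f → Invariant f → Bounded (+ n) f →
          ∃ λ (η : FinSum) → All (λ e → det (proj₂ e) ≡ + n) η × (∀ N → coeff η N ≡ restrict n f N)
realize n f inv bound = weighted f L , AllP.map⁺ (dets C) , agrees
  where
  L = boxClasses (+ n) (proj₁ bound)
  C = cover-box (proj₁ bound) (proj₂ bound)
  agrees : ∀ N → coeff (weighted f L) N ≡ restrict n f N
  agrees N with det N ℤ.≟ + n
  ... | yes dN = coeff-cover inv C N dN
  ... | no dN≢n = coeff-offdet C N dN≢n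

T[1+S] T[1+U+U²] : Coef
T[1+S] = Tq ⊕ Tq ◃ S
T[1+U+U²] = Tq ⊕ Tq ◃ U ⊕ Tq ◃ (U · U)

T[1+S]-inv : ∀ N → + 0 < det N → T[1+S] (U · N) ≡ T[1+S] N
T[1+S]-inv N det>0 = begin
  ι (Tℤ (U · N)) ℚ.+ ι (Tℤ (U · N · adj S))    ≡⟨ ι-+ (Tℤ (U · N)) (Tℤ (U · N · adj S)) ⟨
  ι (Tℤ (U · N) ℤ.+ Tℤ (U · N · adj S))        ≡⟨ cong ι (Tℤ-S N det>0) ⟨
  ι (Tℤ N ℤ.+ Tℤ (N · adj S))                  ≡⟨ ι-+ (Tℤ N) (Tℤ (N · adj S)) ⟩
  ι (Tℤ N) ℚ.+ ι (Tℤ (N · adj S))              ∎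
  where open ≡-Reasoning

ι-+₃ : ∀ x y z → ι (x ℤ.+ y ℤ.+ z) ≡ ι x ℚ.+ ι y ℚ.+ ι z
ι-+₃ x y z = trans (ι-+ (x ℤ.+ y) z) (cong (ℚ._+ ι z) (ι-+ x y))

T[1+U+U²]-inv : ∀ N → + 0 < det N → T[1+U+U²] (S · N) ≡ T[1+U+U²] N
T[1+U+U²]-inv N det>0 = begin
  T[1+U+U²] (S · N)
    ≡⟨ ι-+₃ (Tℤ (S · N)) (Tℤ (S · N · adj U)) (Tℤ (S · N · adj (U · U))) ⟨
  ι (Tℤ (S · N) ℤ.+ Tℤ (S · N · adj U) ℤ.+ Tℤ (S · N · adj (U · U)))
    ≡⟨ cong ι (Tℤ-U N det>0) ⟨
  ι (Tℤ N ℤ.+ Tℤ (N · adj U) ℤ.+ Tℤ (N · adj (U · U)))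
    ≡⟨ ι-+₃ (Tℤ N) (Tℤ (N · adj U)) (Tℤ (N · adj (U · U))) ⟩
  T[1+U+U²] N ∎
  where open ≡-Reasoning

T[1+S]-invariant : Invariant T[1+S]
T[1+S]-invariant = Invariant-⊕ Tq-invariant (Invariant-◃ S Tq-invariant)

T[1+U+U²]-invariant : Invariant T[1+U+U²]
T[1+U+U²]-invariant = Invariant-⊕ (Invariant-⊕ Tq-invariant (Invariant-◃ U Tq-invariant))
    (Invariant-◃ (U · U) Tq-invariant)

T[1+S]-bounded : ∀ n → Bounded (+ n) T[1+S]
T[1+S]-bounded n = Bounded-⊕ (Tq-bounded n) (Bounded-◃ S refl (Tq-bounded n))

T[1+U+U²]-bounded : ∀ n → Bounded (+ n) T[1+U+U²]
T[1+U+U²]-bounded n = Bounded-⊕ (Bounded-⊕ (Tq-bounded n) (Bounded-◃ U refl (Tq-bounded n)))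
                         (Bounded-◃ (U · U) refl (Tq-bounded n))

-- `γ ▹ f` evaluates `f` at γ⁻¹ N, whereas the sign identities give invariance under N ↦ γ N.
adj-inv : ∀ {f : Coef} γ → det γ ≡ + 1 → (∀ N → + 0 < det N → f (γ · N) ≡ f N) →
          ∀ N → + 0 < det N → f (adj γ · N) ≡ f N
adj-inv {f} γ dγ inv N det>0 = begin
  f (adj γ · N)          ≡⟨ inv (adj γ · N) (subst (+ 0 <_)
      (sym (det-·₁ˡ (adj γ) N (trans (det-adj γ) dγ))) det>0) ⟨
  f (γ · (adj γ · N))    ≡⟨ cong f (·-assoc γ (adj γ) N) ⟨
  f (γ · adj γ · N)      ≡⟨ cong (λ δ → f (δ · N)) (γ·adjγ γ dγ) ⟩
  f (1ₘ · N)             ≡⟨ cong f (·-identityˡ N) ⟩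
  f N                    ∎
  where
  open ≡-Reasoning
  γ·adjγ : ∀ γ → det γ ≡ + 1 → γ · adj γ ≡ 1ₘ
  γ·adjγ (mat a b c d) dγ = mat≡ (trans (lem₁ a b c d) dγ) (lem₂ a b) (lem₃ c d) (trans (lem₄ a b c d) dγ)
    where
    lem₁ : ∀ a b c d → a * d ℤ.+ b * - c ≡ a * d - b * c
    lem₁ = solve-∀
    lem₂ : ∀ a b → a * - b ℤ.+ b * a ≡ + 0
    lem₂ = solve-∀
    lem₃ : ∀ c d → c * d ℤ.+ d * - c ≡ + 0
    lem₃ = solve-∀
    lem₄ : ∀ a b c d → c * - b ℤ.+ d * a ≡ a * d - b * c
    lem₄ = solve-∀

⅓ : ℚ
⅓ = + 1 ℚ./ 3

thirds : ∀ q → ⅓ ℚ.* q ℚ.+ ⅓ ℚ.* q ℚ.+ ⅓ ℚ.* q ≡ q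
thirds q = begin
  ⅓ ℚ.* q ℚ.+ ⅓ ℚ.* q ℚ.+ ⅓ ℚ.* q  ≡⟨ cong (ℚ._+ ⅓ ℚ.* q) (ℚP.*-distribʳ-+ q ⅓ ⅓) ⟨
  (⅓ ℚ.+ ⅓) ℚ.* q ℚ.+ ⅓ ℚ.* q      ≡⟨ ℚP.*-distribʳ-+ q (⅓ ℚ.+ ⅓) ⅓ ⟨
  (⅓ ℚ.+ ⅓ ℚ.+ ⅓) ℚ.* q            ≡⟨ ℚP.*-identityˡ q ⟩
  q                                ∎
  where open ≡-Reasoning

halves : ∀ q → ½ ℚ.* q ℚ.+ ½ ℚ.* q ≡ q
halves q = trans (sym (ℚP.*-distribʳ-+ q ½ ½)) (ℚP.*-identityˡ q)

det>0 : ∀ {n} N → 1 ℕ.≤ n → det N ≡ + n → + 0 < det N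
det>0 N 1≤n dN = subst (+ 0 <_) (sym dN) (+<+ 1≤n)

restrict-T̃ : ∀ {n} N → 1 ℕ.≤ n → restrict n T̃ N ≡ restrict n Tq N
restrict-T̃ {n} N 1≤n with det N ℤ.≟ + n
... | yes dN = T̃-ι N (det>0 N 1≤n dN)
... | no _ = refl

restrict-◃ : ∀ {n} f N γ → det γ ≡ + 1 → (restrict n f ◃ γ) N ≡ restrict n (f ◃ γ) N
restrict-◃ {n} f N γ dγ =
  cong (λ z → if does (z ℤ.≟ + n) then f (N · adj γ) else 0ℚ) (det-·₁ʳ N (adj γ) (trans (det-adj γ) dγ))

restrict-⊕ : ∀ n f g N → restrict n f N ℚ.+ restrict n g N ≡ restrict n (f ⊕ g) N
restrict-⊕ n f g N with det N ℤ.≟ + n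
... | yes _ = refl
... | no _ = refl

restrict-▹ : ∀ n q f γ N → 1 ℕ.≤ n → det γ ≡ + 1 → (∀ N → + 0 < det N → f (adj γ · N) ≡ f N) →
             restrict n (scale q f) (adj γ · N) ≡ restrict n (scale q f) N
restrict-▹ n q f γ N 1≤n dγ inv = by (det N ℤ.≟ + n)
  where
  d≡ : det (adj γ · N) ≡ det N
  d≡ = det-·₁ˡ (adj γ) N (trans (det-adj γ) dγ)
  by : Dec (det N ≡ + n) → restrict n (scale q f) (adj γ · N) ≡ restrict n (scale q f) N
  by (yes dN) = trans (restrict-on n (scale q f) (adj γ · N) (trans d≡ dN))
    (trans (cong (q ℚ.*_) (inv N (det>0 N 1≤n dN))) (sym (restrict-on n (scale q f) N dN)))
  by (no dN) = trans (restrict-off n (scale q f) (adj γ · N) λ e → dN (trans (sym d≡) e))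
    (sym (restrict-off n (scale q f) N dN))

restrict-scale : ∀ n q f N → restrict n (scale q f) N ≡ q ℚ.* restrict n f N
restrict-scale n q f N with det N ℤ.≟ + n
... | yes _ = refl
... | no _ = sym (ℚP.*-zeroʳ q)

restrict-T̃-◃ : ∀ {n} N γ → 1 ℕ.≤ n → det γ ≡ + 1 → (restrict n T̃ ◃ γ) N ≡ restrict n (Tq ◃ γ) N
restrict-T̃-◃ N γ 1≤n dγ = trans (restrict-T̃ (N · adj γ) 1≤n) (restrict-◃ Tq N γ dγ)

-- η is the part of f/3 of determinant n: translation by γ and δ does not change f, so the three
-- summands agree. With γ = U and δ = U² this is averaging over a group of order 3.
realize-3 : ∀ n f γ δ → 1 ℕ.≤ n → Invariant f → Bounded (+ n) f → det γ ≡ + 1 → det δ ≡ + 1 →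
  (∀ N → + 0 < det N → f (adj γ · N) ≡ f N) → (∀ N → + 0 < det N → f (adj δ · N) ≡ f N) →
  ∃ λ (η : FinSum) → All (λ e → det (proj₂ e) ≡ + n) η ×
    ((N : Mat) → restrict n f N ≡ coeff η N ℚ.+ (γ ▹ coeff η) N ℚ.+ (δ ▹ coeff η) N)
realize-3 n f γ δ 1≤n finv bound dγ dδ γ-inv δ-inv
  with realize n (scale ⅓ f) (λ M~N → cong (⅓ ℚ.*_) (finv M~N)) (Bounded-scale ⅓ bound)
... | η , dη , agrees = η , dη , λ N → begin
  restrict n f N
    ≡⟨ thirds (restrict n f N) ⟨
  ⅓ ℚ.* restrict n f N ℚ.+ ⅓ ℚ.* restrict n f N ℚ.+ ⅓ ℚ.* restrict n f N
    ≡⟨ cong (λ q → q ℚ.+ q ℚ.+ q) (restrict-scale n ⅓ f N) ⟨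
  restrict n (scale ⅓ f) N ℚ.+ restrict n (scale ⅓ f) N ℚ.+ restrict n (scale ⅓ f) N
    ≡⟨ cong₂ (λ q r → restrict n (scale ⅓ f) N ℚ.+ q ℚ.+ r)
         (restrict-▹ n ⅓ f γ N 1≤n dγ γ-inv) (restrict-▹ n ⅓ f δ N 1≤n dδ δ-inv) ⟨
  restrict n (scale ⅓ f) N ℚ.+ restrict n (scale ⅓ f) (adj γ · N) ℚ.+ restrict n (scale ⅓ f) (adj δ · N)
    ≡⟨ cong₂ ℚ._+_ (cong₂ ℚ._+_ (agrees N) (agrees (adj γ · N))) (agrees (adj δ · N)) ⟨
  coeff η N ℚ.+ (γ ▹ coeff η) N ℚ.+ (δ ▹ coeff η) N ∎
  where open ≡-Reasoning

realize-2 : ∀ n f γ → 1 ℕ.≤ n → Invariant f → Bounded (+ n) f → det γ ≡ + 1 →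
  (∀ N → + 0 < det N → f (adj γ · N) ≡ f N) →
  ∃ λ (η : FinSum) → All (λ e → det (proj₂ e) ≡ + n) η ×
    ((N : Mat) → restrict n f N ≡ coeff η N ℚ.+ (γ ▹ coeff η) N)
realize-2 n f γ 1≤n finv bound dγ γ-inv
  with realize n (scale ½ f) (λ M~N → cong (½ ℚ.*_) (finv M~N)) (Bounded-scale ½ bound)
... | η , dη , agrees = η , dη , λ N → begin
  restrict n f N
    ≡⟨ halves (restrict n f N) ⟨
  ½ ℚ.* restrict n f N ℚ.+ ½ ℚ.* restrict n f N
    ≡⟨ cong (λ q → q ℚ.+ q) (restrict-scale n ½ f N) ⟨
  restrict n (scale ½ f) N ℚ.+ restrict n (scale ½ f) N
    ≡⟨ cong (restrict n (scale ½ f) N ℚ.+_) (restrict-▹ n ½ f γ N 1≤n dγ γ-inv) ⟨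
  restrict n (scale ½ f) N ℚ.+ restrict n (scale ½ f) (adj γ · N)
    ≡⟨ cong₂ ℚ._+_ (agrees N) (agrees (adj γ · N)) ⟨
  coeff η N ℚ.+ (γ ▹ coeff η) N ∎
  where open ≡-Reasoning

restrict-T[1+S] : ∀ {n} N → 1 ℕ.≤ n → restrict n T̃ N ℚ.+ (restrict n T̃ ◃ S) N ≡ restrict n T[1+S] N
restrict-T[1+S] {n} N 1≤n = trans (cong₂ ℚ._+_ (restrict-T̃ N 1≤n) (restrict-T̃-◃ N S 1≤n refl))
    (restrict-⊕ n Tq (Tq ◃ S) N)

restrict-T[1+U+U²] : ∀ {n} N → 1 ℕ.≤ n →
  restrict n T̃ N ℚ.+ (restrict n T̃ ◃ U) N ℚ.+ (restrict n T̃ ◃ (U · U)) N ≡ restrict n T[1+U+U²] N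
restrict-T[1+U+U²] {n} N 1≤n = trans
  (cong₂ ℚ._+_ (trans (cong₂ ℚ._+_ (restrict-T̃ N 1≤n) (restrict-T̃-◃ N U 1≤n refl))
      (restrict-⊕ n Tq (Tq ◃ U) N))
               (restrict-T̃-◃ N (U · U) 1≤n refl))
  (restrict-⊕ n (Tq ⊕ Tq ◃ U) (Tq ◃ (U · U)) N)

realize-1+S : ∀ n → 1 ℕ.≤ n →
  ∃ λ (η : FinSum) → All (λ e → det (proj₂ e) ≡ + n) η ×
    ((N : Mat) → restrict n T̃ N ℚ.+ (restrict n T̃ ◃ S) N
                 ≡ coeff η N ℚ.+ (U ▹ coeff η) N ℚ.+ ((U · U) ▹ coeff η) N)
realize-1+S n 1≤n = proj₁ r , proj₁ (proj₂ r) , λ N → trans (restrict-T[1+S] N 1≤n) (proj₂ (proj₂ r) N)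
  where
  UU-inv : ∀ N → + 0 < det N → T[1+S] (U · U · N) ≡ T[1+S] N
  UU-inv N det>0 = trans (cong T[1+S] (·-assoc U U N))
    (trans (T[1+S]-inv (U · N) (subst (+ 0 <_) (sym (det-·₁ˡ U N refl)) det>0)) (T[1+S]-inv N det>0))
  r = realize-3 n T[1+S] U (U · U) 1≤n T[1+S]-invariant (T[1+S]-bounded n) refl refl
        (adj-inv {T[1+S]} U refl T[1+S]-inv) (adj-inv {T[1+S]} (U · U) refl UU-inv)

realize-1+U+U² : ∀ n → 1 ℕ.≤ n →
  ∃ λ (η : FinSum) → All (λ e → det (proj₂ e) ≡ + n) η ×
    ((N : Mat) → restrict n T̃ N ℚ.+ (restrict n T̃ ◃ U) N ℚ.+ (restrict n T̃ ◃ (U · U)) N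
                 ≡ coeff η N ℚ.+ (S ▹ coeff η) N)
realize-1+U+U² n 1≤n = proj₁ r , proj₁ (proj₂ r) , λ N → trans (restrict-T[1+U+U²] N 1≤n)
    (proj₂ (proj₂ r) N)
  where
  r = realize-2 n T[1+U+U²] S 1≤n T[1+U+U²]-invariant (T[1+U+U²]-bounded n) refl
      (adj-inv {T[1+U+U²]} S refl T[1+U+U²]-inv)

-- Sums over Γ

-- The sum of h over PSL₂(ℤ) is s.
Sums : Coef → ℚ → Set
Sums h s = ∃ λ L → Cover (+ 1) h L × sumℚ (map h L) ≡ s

Sums-unique : ∀ {h s t} → Invariant h → Sums h s → Sums h t → s ≡ t
Sums-unique inv (L , C , eq) (L′ , C′ , eq′) = trans (sym eq) (trans (cover-sum-unique inv C C′) eq′)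

Sums-exists : ∀ {h} → Bounded (+ 1) h → ∃ λ s → Sums h s
Sums-exists (B , bound) = _ , _ , cover-box B bound , refl

Sums-cong : ∀ {f g s} → (∀ N → det N ≡ + 1 → f N ≡ g N) → Sums f s → Sums g s
Sums-cong {f} {g} eq (L , C , sum) = L , record
  { dets = dets C ; distinct = distinct C
  ; covers = λ N dN gN≢0 → covers C N dN λ fN≡0 → gN≢0 (trans (sym (eq N dN)) fN≡0) }
  , trans (sym (sum-cong f g (λ {N} → eq N) (dets C))) sum

-- The lists behind the two sums may differ, so both are replaced by the classes of one box that
-- contains both supports; by `Sums-unique` the values remain s and t.
Sums-⊕ : ∀ {f g s t} → Invariant f → Invariant g → Bounded (+ 1) f → Bounded (+ 1) g →
         Sums f s → Sums g t → Sums (f ⊕ g) (s ℚ.+ t)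
Sums-⊕ {f} {g} finv ginv bf bg Σf Σg = L , cover-box B (proj₂ (Bounded-⊕ bf bg)) ,
  trans (sum-+ f g L) (cong₂ ℚ._+_
    (Sums-unique finv (L , cover-box B (λ N dN f≢0 → Box-mono (ℕP.m≤m+n _ _)
        (proj₂ bf N dN f≢0)) , refl) Σf)
    (Sums-unique ginv (L , cover-box B (λ N dN g≢0 → Box-mono (ℕP.m≤n+m _ _)
        (proj₂ bg N dN g≢0)) , refl) Σg))
  where
  B = proj₁ bf ℕ.+ proj₁ bg
  L = boxClasses (+ 1) B

-- Change of variables along a bijection φ: the list for `h ∘ φ` is the image of the given list
-- under the inverse ψ.
Sums-reindex : ∀ {h s} (φ ψ : Mat → Mat) →
               (∀ {M N} → M ~ N → φ M ~ φ N) → (∀ {M N} → M ~ N → ψ M ~ ψ N) →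
               (∀ N → det N ≡ + 1 → φ (ψ N) ≡ N) → (∀ N → det N ≡ + 1 → ψ (φ N) ≡ N) →
               (∀ N → det N ≡ + 1 → det (φ N) ≡ + 1) → (∀ N → det N ≡ + 1 → det (ψ N) ≡ + 1) →
               Sums h s → Sums (h ∘ φ) s
Sums-reindex {h} φ ψ φ~ ψ~ φψ ψφ detφ detψ (L , C , sum) = map ψ L , record
  { dets = AllP.map⁺ (All.map (λ {N} → detψ N) (dets C))
  ; distinct = AllPairsP.map⁺ (inject (dets C) (distinct C))
  ; covers = λ N dN hφN≢0 → AnyP.map⁺ (Any.map (λ {P} φN~P → subst (_~ ψ P) (ψφ N dN) (ψ~ φN~P))
      (covers C (φ N) (detφ N dN) hφN≢0))
  } , trans (trans (cong sumℚ (sym (map-∘ L)))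
        (sum-cong (h ∘ φ ∘ ψ) h (λ {N} dN → cong h (φψ N dN)) (dets C))) sum
  where
  inject : ∀ {L} → All (λ M → det M ≡ + 1) L → AllPairs (λ P Q → ¬ (P ~ Q)) L →
           AllPairs (λ P Q → ¬ (ψ P ~ ψ Q)) L
  inject [] [] = []
  inject (dP ∷ ds) (P≁ ∷ ps) = All.zipWith (λ { {Q} (dQ , P≁Q) ψP~ψQ →
    P≁Q (subst₂ _~_ (φψ _ dP) (φψ Q dQ) (φ~ ψP~ψQ)) }) (ds , P≁) ∷ inject ds ps

-- adj M · M = det M recovers γ from M γ. This bounds γ in `orbit-bounded` and cancels M in
-- `·-cancelˡ`.
adjM·M : ∀ M γ → adj M · (M · γ) ≡ mat (det M * a γ) (det M * b γ) (det M * c γ) (det M * d γ)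
adjM·M (mat a b c d) (mat e f g h) =
  mat≡ (lem₁ a b c d e g) (lem₁ a b c d f h) (lem₂ a b c d e g) (lem₂ a b c d f h)
  where
  lem₁ : ∀ a b c d e g → d * (a * e + b * g) + - b * (c * e + d * g) ≡ (a * d - b * c) * e
  lem₁ = solve-∀
  lem₂ : ∀ a b c d e g → - c * (a * e + b * g) + a * (c * e + d * g) ≡ (a * d - b * c) * g
  lem₂ = solve-∀

Box-scale : ∀ {B} n γ → Box B (mat (+ suc n * a γ) (+ suc n * b γ) (+ suc n * c γ) (+ suc n * d γ)) →
    Box B γ
Box-scale {B} n (mat a b c d) (box p q r s) = box (un a p) (un b q) (un c r) (un d s)
  where
  un : ∀ x → ∣ + suc n * x ∣ ℕ.≤ B → ∣ x ∣ ℕ.≤ B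
  un x h = ℕP.≤-trans (ℕP.m≤n*m ∣ x ∣ (suc n)) (subst (ℕ._≤ B) (ℤP.∣i*j∣≡∣i∣*∣j∣ (+ suc n) x) h)

0<⇒suc : ∀ {z} → + 0 < z → ∃ λ n → z ≡ + suc n
0<⇒suc {+ suc n} _ = n , refl
0<⇒suc {+ 0} (+<+ ())

adjγ·γ·N : ∀ γ N → det γ ≡ + 1 → adj γ · (γ · N) ≡ N
adjγ·γ·N γ N dγ = trans (adjM·M γ N) (trans (cong (λ z → mat (z * a N) (z * b N) (z * c N) (z * d N)) dγ)
  (mat≡ (ℤP.*-identityˡ (a N)) (ℤP.*-identityˡ (b N)) (ℤP.*-identityˡ (c N)) (ℤP.*-identityˡ (d N))))

adj-involutive : ∀ γ → adj (adj γ) ≡ γ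
adj-involutive (mat a b c d) = mat≡ refl (ℤP.neg-involutive b) (ℤP.neg-involutive c) refl

γ·adjγ·N : ∀ γ N → det γ ≡ + 1 → γ · (adj γ · N) ≡ N
γ·adjγ·N γ N dγ = subst (λ δ → δ · (adj γ · N) ≡ N) (adj-involutive γ)
  (adjγ·γ·N (adj γ) N (trans (det-adj γ) dγ))

N·γ·adjγ : ∀ N γ → det γ ≡ + 1 → N · γ · adj γ ≡ N
N·γ·adjγ N γ dγ = subst (λ δ → N · δ · adj γ ≡ N) (adj-involutive γ)
  (N·adjγ·γ N (adj γ) (trans (det-adj γ) dγ))

Sums-◃ : ∀ {h s} γ → det γ ≡ + 1 → Sums h s → Sums (h ◃ γ) s
Sums-◃ γ dγ = Sums-reindex (_· adj γ) (_· γ) (~-·ʳ (adj γ)) (~-·ʳ γ)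
  (λ N _ → N·γ·adjγ N γ dγ) (λ N _ → N·adjγ·γ N γ dγ)
  (λ N dN → trans (det-·₁ʳ N (adj γ) (trans (det-adj γ) dγ)) dN) (λ N dN → trans (det-·₁ʳ N γ dγ) dN)

halve : ∀ {s t} → s ℚ.+ s ≡ t ℚ.+ t → s ≡ t
halve {s} {t} eq = trans (sym (by-½ s)) (trans (cong (½ ℚ.*_) eq) (by-½ t))
  where
  by-½ : ∀ q → ½ ℚ.* (q ℚ.+ q) ≡ q
  by-½ q = trans (ℚP.*-distribˡ-+ ½ q q) (halves q)

third : ∀ {s t} → s ℚ.+ s ℚ.+ s ≡ t ℚ.+ t ℚ.+ t → s ≡ t
third {s} {t} eq = trans (sym (by-⅓ s)) (trans (cong (⅓ ℚ.*_) eq) (by-⅓ t))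
  where
  by-⅓ : ∀ q → ⅓ ℚ.* (q ℚ.+ q ℚ.+ q) ≡ q
  by-⅓ q = trans (trans (ℚP.*-distribˡ-+ ⅓ (q ℚ.+ q) q) (cong (ℚ._+ ⅓ ℚ.* q) (ℚP.*-distribˡ-+ ⅓ q q)))
      (thirds q)

det>0-· : ∀ M γ → + 0 < det M → det γ ≡ + 1 → + 0 < det (M · γ)
det>0-· M γ det>0 dγ = subst (+ 0 <_) (sym (det-·₁ʳ M γ dγ)) det>0

det>0-·ˡ : ∀ γ M → det γ ≡ + 1 → + 0 < det M → + 0 < det (γ · M)
det>0-·ˡ γ M dγ det>0 = subst (+ 0 <_) (sym (det-·₁ˡ γ M dγ)) det>0

-- Coset sums under multiplication by Γ on either side

module Orbits (T : Coef) (T-invariant : Invariant T) (T-bounded : ∀ n → Bounded (+ suc n) T)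
  (T-S-inv : ∀ N → + 0 < det N → (T ⊕ T ◃ S) (U · N) ≡ (T ⊕ T ◃ S) N)
  (T-U-inv : ∀ N → + 0 < det N → (T ⊕ T ◃ U ⊕ T ◃ (U · U)) (S · N) ≡ (T ⊕ T ◃ U ⊕ T ◃ (U · U)) N) where

  orbit : Mat → Coef
  orbit M γ = T (M · γ)

  orbit-invariant : ∀ M → Invariant (orbit M)
  orbit-invariant M γ~δ = T-invariant (~-·ˡ M γ~δ)

  orbit-bounded : ∀ M → + 0 < det M → Bounded (+ 1) (orbit M)
  orbit-bounded M det>0 with 0<⇒suc det>0
  ... | n , dM with T-bounded n
  ... | C , T-bound = B , bound
    where
    B = size (adj M) ℕ.* C ℕ.+ size (adj M) ℕ.* C
    bound : ∀ γ → det γ ≡ + 1 → ¬ (orbit M γ ≡ 0ℚ) → Box B γ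
    bound γ dγ T≢0 = Box-scale n γ (subst (λ z → Box B (mat (z * a γ) (z * b γ) (z * c γ) (z * d γ))) dM
      (subst (Box B) (adjM·M M γ) (Box-· (adj M) (M · γ) (Box-size (adj M))
        (T-bound (M · γ) (trans (det-·₁ʳ M γ dγ) dM) T≢0))))

  -- M δ Γ = M Γ, by the substitution γ ↦ δ⁻¹ γ.
  orbit-right : ∀ {s} M δ → det δ ≡ + 1 → Sums (orbit (M · δ)) s → Sums (orbit M) s
  orbit-right M δ dδ Σ = Sums-cong (λ N _ → cong T (trans (·-assoc M δ (adj δ · N))
      (cong (M ·_) (γ·adjγ·N δ N dδ))))
    (Sums-reindex (adj δ ·_) (δ ·_) (~-·ˡ (adj δ)) (~-·ˡ δ)
      (λ N _ → adjγ·γ·N δ N dδ) (λ N _ → γ·adjγ·N δ N dδ)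
      (λ N dN → trans (det-·₁ˡ (adj δ) N (trans (det-adj δ) dδ)) dN) (λ N dN → trans (det-·₁ˡ δ N dδ) dN) Σ)

  Sums-⊕◃ : ∀ {s} M W → det W ≡ + 1 → + 0 < det M → Sums (orbit M) s →
            Sums (orbit M ⊕ orbit M ◃ W) (s ℚ.+ s)
  Sums-⊕◃ M W dW det>0 Σ = Sums-⊕ (orbit-invariant M) (Invariant-◃ W (orbit-invariant M))
    (orbit-bounded M det>0) (Bounded-◃ W dW (orbit-bounded M det>0)) Σ (Sums-◃ W dW Σ)

  Sums-⊕◃² : ∀ {s} M W W′ → det W ≡ + 1 → det W′ ≡ + 1 → + 0 < det M → Sums (orbit M) s →
             Sums (orbit M ⊕ orbit M ◃ W ⊕ orbit M ◃ W′) (s ℚ.+ s ℚ.+ s)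
  Sums-⊕◃² M W W′ dW dW′ det>0 Σ = Sums-⊕
    (Invariant-⊕ (orbit-invariant M) (Invariant-◃ W (orbit-invariant M)))
        (Invariant-◃ W′ (orbit-invariant M))
    (Bounded-⊕ (orbit-bounded M det>0) (Bounded-◃ W dW (orbit-bounded M det>0)))
    (Bounded-◃ W′ dW′ (orbit-bounded M det>0))
    (Sums-⊕◃ M W dW det>0 Σ) (Sums-◃ W′ dW′ Σ)

  orbit-⊕◃ : ∀ M W γ → (orbit M ⊕ orbit M ◃ W) γ ≡ (T ⊕ T ◃ W) (M · γ)
  orbit-⊕◃ M W γ = cong (λ P → T (M · γ) ℚ.+ T P) (sym (·-assoc M γ (adj W)))

  orbit-⊕◃² : ∀ M W W′ γ → (orbit M ⊕ orbit M ◃ W ⊕ orbit M ◃ W′) γ ≡ (T ⊕ T ◃ W ⊕ T ◃ W′) (M · γ)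
  orbit-⊕◃² M W W′ γ = cong₂ (λ P Q → T (M · γ) ℚ.+ T P ℚ.+ T Q)
    (sym (·-assoc M γ (adj W))) (sym (·-assoc M γ (adj W′)))

  -- Summing T (1 + W) over the orbit doubles the sum, and left multiplication by V preserves T (1 + W).
  orbit-left : ∀ {s} V W M → det V ≡ + 1 → det W ≡ + 1 → + 0 < det M →
               (∀ N → + 0 < det N → (T ⊕ T ◃ W) (V · N) ≡ (T ⊕ T ◃ W) N) →
               Sums (orbit M) s → Sums (orbit (V · M)) s
  orbit-left {s} V W M dV dW det>0 inv Σ = subst (Sums (orbit (V · M))) (sym (halve (Sums-unique
      {orbit (V · M) ⊕ orbit (V · M) ◃ W}
      (Invariant-⊕ (orbit-invariant (V · M)) (Invariant-◃ W (orbit-invariant (V · M))))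
      (Sums-cong agrees (Sums-⊕◃ M W dW det>0 Σ)) (Sums-⊕◃ (V · M) W dW VM>0 (proj₂ Σ′))))) (proj₂ Σ′)
    where
    VM>0 = det>0-·ˡ V M dV det>0
    Σ′ = Sums-exists (orbit-bounded (V · M) VM>0)
    agrees : ∀ γ → det γ ≡ + 1 → (orbit M ⊕ orbit M ◃ W) γ ≡ (orbit (V · M) ⊕ orbit (V · M) ◃ W) γ
    agrees γ dγ = trans (orbit-⊕◃ M W γ) (trans (sym (inv (M · γ) (det>0-· M γ det>0 dγ)))
      (trans (cong (T ⊕ T ◃ W) (sym (·-assoc V M γ))) (sym (orbit-⊕◃ (V · M) W γ))))

  -- As in `orbit-left`, with T(1 + W + W′) and a factor 3 to cancel instead of 2.
  orbit-left² : ∀ {s} V W W′ M → det V ≡ + 1 → det W ≡ + 1 → det W′ ≡ + 1 → + 0 < det M →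
                (∀ N → + 0 < det N → (T ⊕ T ◃ W ⊕ T ◃ W′) (V · N) ≡ (T ⊕ T ◃ W ⊕ T ◃ W′) N) →
                Sums (orbit M) s → Sums (orbit (V · M)) s
  orbit-left² {s} V W W′ M dV dW dW′ det>0 inv Σ = subst (Sums (orbit (V · M))) (sym (third (Sums-unique
      {orbit (V · M) ⊕ orbit (V · M) ◃ W ⊕ orbit (V · M) ◃ W′}
      (Invariant-⊕ (Invariant-⊕ (orbit-invariant (V · M)) (Invariant-◃ W (orbit-invariant (V · M))))
        (Invariant-◃ W′ (orbit-invariant (V · M))))
      (Sums-cong agrees (Sums-⊕◃² M W W′ dW dW′ det>0 Σ))
          (Sums-⊕◃² (V · M) W W′ dW dW′ VM>0 (proj₂ Σ′))))) (proj₂ Σ′)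
    where
    VM>0 = det>0-·ˡ V M dV det>0
    Σ′ = Sums-exists (orbit-bounded (V · M) VM>0)
    agrees : ∀ γ → det γ ≡ + 1 →
             (orbit M ⊕ orbit M ◃ W ⊕ orbit M ◃ W′) γ ≡
                 (orbit (V · M) ⊕ orbit (V · M) ◃ W ⊕ orbit (V · M) ◃ W′) γ
    agrees γ dγ = trans (orbit-⊕◃² M W W′ γ) (trans (sym (inv (M · γ) (det>0-· M γ det>0 dγ)))
      (trans (cong (T ⊕ T ◃ W ⊕ T ◃ W′) (sym (·-assoc V M γ))) (sym (orbit-⊕◃² (V · M) W W′ γ))))

  orbit-U : ∀ {s} M → + 0 < det M → Sums (orbit M) s → Sums (orbit (U · M)) s
  orbit-U M det>0 = orbit-left U S M refl refl det>0 T-S-inv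

  orbit-S : ∀ {s} M → + 0 < det M → Sums (orbit M) s → Sums (orbit (S · M)) s
  orbit-S M det>0 = orbit-left² S U (U · U) M refl refl refl det>0 T-U-inv

  orbit-neg : ∀ {s} M → Sums (orbit M) s → Sums (orbit (neg M)) s
  orbit-neg M = Sums-cong λ γ _ → T-invariant (inj₂
      (sym (trans (cong neg (neg-·ˡ M γ)) (neg-involutive (M · γ)))))

-- Reduction to Smith normal form

module Reduction (P : Mat → Set)
  (P-right : ∀ M δ → det δ ≡ + 1 → P (M · δ) → P M)
  (P-U : ∀ M → + 0 < det M → P M → P (U · M))
  (P-S : ∀ M → + 0 < det M → P M → P (S · M))
  (P-neg : ∀ M → P M → P (neg M)) where

  -- Closure under products is immediate, but an inverse has to be exhibited, so the elementary
  -- matrices and their inverses are built as words in S and U.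
  record Preserves (γ : Mat) : Set where
    constructor preserves
    field
      unimodular : det γ ≡ + 1
      apply : ∀ M → + 0 < det M → P M → P (γ · M)
  open Preserves

  preserves-· : ∀ {γ δ} → Preserves γ → Preserves δ → Preserves (γ · δ)
  preserves-· {γ} {δ} (preserves dγ pγ) (preserves dδ pδ) = preserves
      (trans (det-·₁ʳ γ δ dδ) dγ) λ M det>0 p →
    subst P (sym (·-assoc γ δ M)) (pγ (δ · M) (det>0-·ˡ δ M dδ det>0) (pδ M det>0 p))

  preserves-neg : ∀ {γ} → Preserves γ → Preserves (neg γ)
  preserves-neg {γ} (preserves dγ pγ) = preserves (trans (det-neg γ) dγ) λ M det>0 p →
    subst P (sym (neg-·ˡ γ M)) (P-neg (γ · M) (pγ M det>0 p))

  preserves-S : Preserves S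
  preserves-S = preserves refl P-S

  preserves-U : Preserves U
  preserves-U = preserves refl P-U

  upper lower : ℤ → Mat
  upper q = mat (+ 1) q (+ 0) (+ 1)
  lower q = mat (+ 1) (+ 0) q (+ 1)

  -- U S is (1, 1; 0, 1) up to sign, and its inverse is S U² up to sign because S² and U³ are ±1.
  preserves-upper1 : Preserves (upper (+ 1))
  preserves-upper1 = preserves-neg {U · S} (preserves-· preserves-U preserves-S)

  preserves-upper-1 : Preserves (upper -[1+ 0 ])
  preserves-upper-1 = preserves-neg {S · (U · U)} (preserves-· preserves-S
      (preserves-· preserves-U preserves-U))

  upper-+ : ∀ p q → upper p · upper q ≡ upper (p + q)
  upper-+ p q = mat≡ (lem₁ p) (lem₂ p q) refl (lem₃ q)
    where
    lem₁ : ∀ p → + 1 * + 1 + p * + 0 ≡ + 1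
    lem₁ = solve-∀
    lem₂ : ∀ p q → + 1 * q + p * + 1 ≡ p + q
    lem₂ = solve-∀
    lem₃ : ∀ q → + 0 * q + + 1 * + 1 ≡ + 1
    lem₃ = solve-∀

  preserves-upper : ∀ q → Preserves (upper q)
  preserves-upper (+ 0) = subst Preserves (upper-+ (+ 1) -[1+ 0 ])
      (preserves-· preserves-upper1 preserves-upper-1)
  preserves-upper (+ suc k) = subst Preserves (upper-+ (+ 1) (+ k))
      (preserves-· preserves-upper1 (preserves-upper (+ k)))
  preserves-upper -[1+ 0 ] = preserves-upper-1
  preserves-upper -[1+ suc k ] =
    subst Preserves (upper-+ -[1+ 0 ] -[1+ k ]) (preserves-· preserves-upper-1 (preserves-upper -[1+ k ]))

  -- S (1, -q; 0, 1) S⁻¹ = (1, 0; q, 1), with S⁻¹ = -S.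
  preserves-lower : ∀ q → Preserves (lower q)
  preserves-lower q = subst Preserves (mat≡ (lem₁ q) refl (lem₂ q) (lem₃ q))
    (preserves-· (preserves-· preserves-S (preserves-upper (- q))) (preserves-neg preserves-S))
    where
    lem₁ : ∀ q → (+ 0 * + 1 + -[1+ 0 ] * + 0) * + 0 + (+ 0 * - q + -[1+ 0 ] * + 1) * -[1+ 0 ] ≡ + 1
    lem₁ = solve-∀
    lem₂ : ∀ q → (+ 1 * + 1 + + 0 * + 0) * + 0 + (+ 1 * - q + + 0 * + 1) * -[1+ 0 ] ≡ q
    lem₂ = solve-∀
    lem₃ : ∀ q → (+ 1 * + 1 + + 0 * + 0) * + 1 + (+ 1 * - q + + 0 * + 1) * + 0 ≡ + 1
    lem₃ = solve-∀

  -- Row operations act on the goal: `P` for the simpler γ M yields `P` for M because γ⁻¹ preserves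
  -- `P`.
  undo-left : ∀ γ M → Preserves (adj γ) → + 0 < det M → P (γ · M) → P M
  undo-left γ M pγ det>0 p = subst P (adjγ·γ·N γ M dγ) (apply pγ (γ · M) (det>0-·ˡ γ M dγ det>0) p)
    where
    dγ : det γ ≡ + 1
    dγ = trans (sym (det-adj γ)) (unimodular pγ)

  column-op : ∀ q a b c d → P (mat a (b + a * q) c (d + c * q)) → P (mat a b c d)
  column-op q a b c d p = P-right (mat a b c d) (upper q) (lem q)
    (subst P (mat≡ (lem₁ a b) (lem₂ a b q) (lem₁ c d) (lem₂ c d q)) p)
    where
    lem : ∀ q → + 1 * + 1 - q * + 0 ≡ + 1
    lem = solve-∀
    lem₁ : ∀ a b → a ≡ a * + 1 + b * + 0
    lem₁ = solve-∀
    lem₂ : ∀ a b q → b + a * q ≡ a * q + b * + 1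
    lem₂ = solve-∀

  column-swap : ∀ a b c d → P (mat b (- a) d (- c)) → P (mat a b c d)
  column-swap a b c d p = P-right (mat a b c d) S refl
    (subst P (mat≡ (lem₁ a b) (lem₂ a b) (lem₁ c d) (lem₂ c d)) p)
    where
    lem₁ : ∀ a b → b ≡ a * + 0 + b * + 1
    lem₁ = solve-∀
    lem₂ : ∀ a b → - a ≡ a * -[1+ 0 ] + b * + 0
    lem₂ = solve-∀

  row-op : ∀ q a b c d → + 0 < det (mat a b c d) → P (mat a b (c + q * a) (d + q * b)) → P (mat a b c d)
  row-op q a b c d det>0 p = undo-left (lower q) (mat a b c d) (preserves-lower (- q)) det>0
    (subst P (mat≡ (lem₁ a c) (lem₁ b d) (lem₂ q a c) (lem₂ q b d)) p)
    where
    lem₁ : ∀ a c → a ≡ + 1 * a + + 0 * c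
    lem₁ = solve-∀
    lem₂ : ∀ q a c → c + q * a ≡ q * a + + 1 * c
    lem₂ = solve-∀

  row-op′ : ∀ a b c d → + 0 < det (mat a b c d) → P (mat (a + c) (b + d) c d) → P (mat a b c d)
  row-op′ a b c d det>0 p = undo-left (upper (+ 1)) (mat a b c d) preserves-upper-1 det>0
    (subst P (mat≡ (lem₁ a c) (lem₁ b d) (lem₂ a c) (lem₂ b d)) p)
    where
    lem₁ : ∀ a c → a + c ≡ + 1 * a + + 1 * c
    lem₁ = solve-∀
    lem₂ : ∀ a c → c ≡ + 0 * a + + 1 * c
    lem₂ = solve-∀

  row-swap : ∀ a b c d → + 0 < det (mat a b c d) → P (mat (- c) (- d) a b) → P (mat a b c d)
  row-swap a b c d det>0 p = undo-left S (mat a b c d) (preserves-neg preserves-S) det>0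
    (subst P (mat≡ (lem₁ a c) (lem₁ b d) (lem₂ a c) (lem₂ b d)) p)
    where
    lem₁ : ∀ a c → - c ≡ + 0 * a + -[1+ 0 ] * c
    lem₁ = solve-∀
    lem₂ : ∀ a c → a ≡ + 1 * a + + 0 * c
    lem₂ = solve-∀

  -- Every recursive call of the reduction to Smith normal form decreases ∣ a ∣.
  module _ (base : ∀ g k → P (mat (+ suc g) (+ 0) (+ 0) (+ suc k * + suc g))) where

    remainder : ∀ b a .{{_ : ℤ.NonZero a}} → b + a * - (b DivMod./ a) ≡ + (b DivMod.% a)
    remainder b a = trans (cong (λ t → t + a * - (b DivMod./ a)) (DivMod.a≡a%n+[a/n]*n b a))
                          (lem (+ (b DivMod.% a)) (b DivMod./ a) a)
      where
      lem : ∀ r q a → r + q * a + a * - q ≡ r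
      lem = solve-∀

    -- The end of the reduction, where a divides d. Positive determinant forces q > 0, and `P-neg`
    -- handles negative a.
    scalar : ∀ a q → ℤ.NonZero a → + 0 < a * (q * a) → P (mat a (+ 0) (+ 0) (q * a))
    scalar (+ suc g) (+ suc k) _ _ = base g k
    scalar -[1+ g ] (+ suc k) _ _ =
      subst P (mat≡ refl refl refl refl) (P-neg (mat (+ suc g) (+ 0) (+ 0) (+ suc k * + suc g)) (base g k))
    scalar (+ suc g) (+ 0) _ h = contradiction (subst (+ 0 <_) (ℤP.*-zeroʳ (+ suc g)) h) λ { (+<+ ()) }
    scalar -[1+ g ] (+ 0) _ h = contradiction (subst (+ 0 <_) (ℤP.*-zeroʳ -[1+ g ]) h) λ { (+<+ ()) }
    scalar (+ suc g) -[1+ k ] _ ()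
    scalar -[1+ g ] -[1+ k ] _ ()

    det-column : ∀ q a b c d → + 0 < det (mat a b c d) → + 0 < det (mat a (b + a * q) c (d + c * q))
    det-column q a b c d = subst (+ 0 <_) (lem q a b c d)
      where
      lem : ∀ q a b c d → a * d - b * c ≡ a * (d + c * q) - (b + a * q) * c
      lem = solve-∀

    det-row : ∀ q a b c d → + 0 < det (mat a b c d) → + 0 < det (mat a b (c + q * a) (d + q * b))
    det-row q a b c d = subst (+ 0 <_) (lem q a b c d)
      where
      lem : ∀ q a b c d → a * d - b * c ≡ a * (d + q * b) - b * (c + q * a)
      lem = solve-∀

    det-swap : ∀ a b c d → + 0 < det (mat a b c d) → + 0 < det (mat b (- a) d (- c))
    det-swap a b c d = subst (+ 0 <_) (lem a b c d)
      where
      lem : ∀ a b c d → a * d - b * c ≡ b * - c - - a * d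
      lem = solve-∀

    det-rswap : ∀ a b c d → + 0 < det (mat a b c d) → + 0 < det (mat (- c) (- d) a b)
    det-rswap a b c d = subst (+ 0 <_) (lem a b c d)
      where
      lem : ∀ a b c d → a * d - b * c ≡ - c * b - - d * a
      lem = solve-∀

    Below : ℤ → Set
    Below x = ∀ a b c d → ℤ.NonZero a → ∣ a ∣ ℕ.< ∣ x ∣ → + 0 < det (mat a b c d) → P (mat a b c d)

    -- If a does not divide d, adding the second row to the first puts d beside a; its remainder
    -- modulo a, swapped into the corner, is a smaller pivot. This secures the divisibility in Smith
    -- normal form.
    diagonal : ∀ a d → ℤ.NonZero a → Below a → + 0 < det (mat a (+ 0) (+ 0) d) → P (mat a (+ 0) (+ 0) d)
    diagonal a d nz below det>0 = by (d DivMod.% a) refl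
      where
      instance _ = nz
      q = d DivMod./ a
      by : ∀ r → d DivMod.% a ≡ r → P (mat a (+ 0) (+ 0) d)
      by 0 r≡ = subst (λ t → P (mat a (+ 0) (+ 0) t)) (sym d≡)
        (scalar a q nz (subst (+ 0 <_) (trans (lem a d) (cong (a *_) d≡)) det>0))
        where
        d≡ : d ≡ q * a
        d≡ = trans (DivMod.a≡a%n+[a/n]*n d a) (trans (cong (λ t → + t + q * a) r≡) (ℤP.+-identityˡ (q * a)))
        lem : ∀ a d → a * d - + 0 * + 0 ≡ a * d
        lem = solve-∀
      by (suc r) r≡ = row-op′ a (+ 0) (+ 0) d det>0
        (subst P (mat≡ (sym (ℤP.+-identityʳ a)) (sym (ℤP.+-identityˡ d)) refl refl)
          (column-op (- q) a d (+ 0) d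
            (column-swap a (d + a * - q) (+ 0) (d + + 0 * - q)
              (below (d + a * - q) (- a) (d + + 0 * - q) (- + 0) (subst ℤ.NonZero (sym b≡) _)
                  (subst (λ z → ∣ z ∣ ℕ.< ∣ a ∣) (sym b≡)
                  (subst (ℕ._< ∣ a ∣) r≡ (DivMod.n%d<d d a)))
                (det-swap a (d + a * - q) (+ 0) (d + + 0 * - q)
                  (det-column (- q) a d (+ 0) d (subst (+ 0 <_) (lem a d) det>0)))))))
        where
        b≡ : d + a * - q ≡ + suc r
        b≡ = trans (remainder d a) (cong +_ r≡)
        lem : ∀ a d → a * d - + 0 * + 0 ≡ a * d - d * + 0
        lem = solve-∀

    triangular : ∀ a c d → ℤ.NonZero a → Below a → + 0 < det (mat a (+ 0) c d) → P (mat a (+ 0) c d)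
    triangular a c d nz below det>0 = row-op (- q) a (+ 0) c d det>0 (by (c DivMod.% a) refl)
      where
      instance _ = nz
      q = c DivMod./ a
      by : ∀ r → c DivMod.% a ≡ r → P (mat a (+ 0) (c + - q * a) (d + - q * + 0))
      c≡ : c + - q * a ≡ + (c DivMod.% a)
      c≡ = trans (cong (λ t → c + t) (ℤP.*-comm (- q) a)) (remainder c a)
      det>0′ = det-row (- q) a (+ 0) c d det>0
      by 0 r≡ = subst (λ t → P (mat a (+ 0) t (d + - q * + 0))) (sym c≡0)
        (diagonal a (d + - q * + 0) nz below (subst
            (λ t → + 0 < det (mat a (+ 0) t (d + - q * + 0))) c≡0 det>0′))
        where
        c≡0 = trans c≡ (cong +_ r≡)
      by (suc r) r≡ = row-swap a (+ 0) (c + - q * a) (d + - q * + 0) det>0′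
        (below (- (c + - q * a)) (- (d + - q * + 0)) a (+ 0) (subst (λ t → ℤ.NonZero (- t)) (sym c≡r) _)
          (subst (λ t → ∣ - t ∣ ℕ.< ∣ a ∣) (sym c≡r) (subst (ℕ._< ∣ a ∣) r≡ (DivMod.n%d<d c a)))
          (det-rswap a (+ 0) (c + - q * a) (d + - q * + 0) det>0′))
        where
        c≡r = trans c≡ (cong +_ r≡)

    -- Euclid's algorithm on the pivot: b is reduced modulo a, then c in `triangular`, then d in
    -- `diagonal`. A nonzero remainder at any stage becomes the new pivot, and `below` restarts the
    -- reduction.
    reduce : ∀ a b c d → ℤ.NonZero a → Acc ℕ._<_ ∣ a ∣ → + 0 < det (mat a b c d) → P (mat a b c d)
    reduce a b c d nz (acc rec) det>0 = column-op (- q) a b c d (by (b DivMod.% a) refl)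
      where
      instance _ = nz
      q = b DivMod./ a
      below : Below a
      below a′ b′ c′ d′ nz′ a′<a = reduce a′ b′ c′ d′ nz′ (rec a′<a)
      det>0′ = det-column (- q) a b c d det>0
      by : ∀ r → b DivMod.% a ≡ r → P (mat a (b + a * - q) c (d + c * - q))
      by 0 r≡ = subst (λ t → P (mat a t c (d + c * - q))) (sym b≡0)
        (triangular a c (d + c * - q) nz below (subst
            (λ t → + 0 < det (mat a t c (d + c * - q))) b≡0 det>0′))
        where
        b≡0 = trans (remainder b a) (cong +_ r≡)
      by (suc r) r≡ = column-swap a (b + a * - q) c (d + c * - q)
        (below (b + a * - q) (- a) (d + c * - q) (- c) (subst ℤ.NonZero (sym b≡r) _)
          (subst (λ t → ∣ t ∣ ℕ.< ∣ a ∣) (sym b≡r) (subst (ℕ._< ∣ a ∣) r≡ (DivMod.n%d<d b a)))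
          (det-swap a (b + a * - q) c (d + c * - q) det>0′))
        where
        b≡r = trans (remainder b a) (cong +_ r≡)

    all-orbits : ∀ M → + 0 < det M → P M
    all-orbits (mat a@(+ suc _) b c d) = reduce a b c d _ (<-wellFounded ∣ a ∣)
    all-orbits (mat a@(-[1+ _ ]) b c d) = reduce a b c d _ (<-wellFounded ∣ a ∣)
    -- A zero corner is exchanged for b; positive determinant excludes a = b = 0.
    all-orbits (mat (+ 0) b@(+ suc _) c d) det>0 =
      column-swap (+ 0) b c d (reduce b (+ 0) d (- c) _ (<-wellFounded ∣ b ∣) (det-swap (+ 0) b c d det>0))
    all-orbits (mat (+ 0) b@(-[1+ _ ]) c d) det>0 =
      column-swap (+ 0) b c d (reduce b (+ 0) d (- c) _ (<-wellFounded ∣ b ∣) (det-swap (+ 0) b c d det>0))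
    all-orbits (mat (+ 0) (+ 0) c d) (+<+ ())

-- The orbit of diag(1, k)

open Orbits Tq Tq-invariant (λ n → Tq-bounded (suc n)) T[1+S]-inv T[1+U+U²]-inv public

scalarMul : ℕ → Mat → Mat
scalarMul g (mat a b c d) = mat (+ g * a) (+ g * b) (+ g * c) (+ g * d)

σ-scalarMul : ∀ g N F → σ (scalarMul (suc g) N) F ≡ σ N F
σ-scalarMul g N@(mat a b c d) F@(mat x y z w) =
  trans (cong sgn (lem (+ suc g) x y z w a b c d)) (sgn-* (+ suc g) ⟪ F , N ⟫)
  where
  lem : ∀ g x y z w a b c d → x * (g * a) + y * (g * b) + z * (g * c) + w * (g * d)
        ≡ g * (x * a + y * b + z * c + w * d)
  lem = solve-∀

Tq-scalarMul : ∀ g N → Tq (scalarMul (suc g) N) ≡ Tq N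
Tq-scalarMul g N = cong (λ s → ι (value (± tPiece) s)) (go (forms baseArrangement))
  where
  go : ∀ A → map (σ (scalarMul (suc g) N)) A ≡ map (σ N) A
  go [] = refl
  go (F ∷ A) = cong₂ _∷_ (σ-scalarMul g N F) (go A)

cellOf-mat : ∀ a b c d → cellOf (mat a b c d) ≡
  cell (sgn a) (sgn (- b)) (sgn c) (sgn d) (sgn (a - d)) (sgn (c - (a - d))) (sgn (- b - (a - d)))
       (sgn (c - - b)) (sgn (d - b)) (sgn (a - c))
cellOf-mat a b c d
  rewrite trans (⟪a⟫ a b c d) (ℤP.+-identityʳ a) | trans (⟪m⟫ a b c d) (ℤP.+-identityˡ (- b))
        | trans (⟪c⟫ a b c d) (ℤP.+-identityʳ c) | trans (⟪d⟫ a b c d) (ℤP.+-identityʳ d)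
        | trans (⟪p⟫ a b c d) (ℤP.+-identityʳ (a - d)) | ⟪c-p⟫ a b c d | ⟪m-p⟫ a b c d
        | ⟪c-m⟫ a b c d | ⟪d+m⟫ a b c d | ⟪a-c⟫ a b c d = refl

diag : ℕ → Mat
diag k = mat (+ 1) (+ 0) (+ 0) (+ k)

diag-· : ∀ k x y z w → diag k · mat x y z w ≡ mat x y (+ k * z) (+ k * w)
diag-· k x y z w = mat≡ (lem₁ x z) (lem₁ y w) (lem₂ (+ k) x z) (lem₂ (+ k) y w)
  where
  lem₁ : ∀ x z → + 1 * x + + 0 * z ≡ x
  lem₁ = solve-∀
  lem₂ : ∀ k x z → + 0 * x + k * z ≡ k * z
  lem₂ = solve-∀

-+≢suc : ∀ {δ k} → ¬ (- + δ ≡ + suc k)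
-+≢suc {zero} ()
-+≢suc {suc δ} ()

-+-injective : ∀ {m n} → - + m ≡ - + n → m ≡ n
-+-injective e = ℤP.+-injective (ℤP.neg-injective e)

noShape-c<0 : ∀ {a b c d} → ¬ Shape (mat a b -[1+ c ] d)
noShape-c<0 (shape₁ α p u v _ ())
noShape-c<0 (shape₂ a δ u v ())
noShape-c<0 (shape₂′ α p u v _ ())
noShape-c<0 (shape₃ δ w u v ())
noShape-c<0 (shape₄ k w u v ())

-- A zero c together with a = 1 leaves only the fourth cone, where b = v and d = 1 + w + u + v.
shape-c≡0 : ∀ {k y} → Shape (mat (+ 1) y (+ 0) (+ suc k)) → ∃ λ v → y ≡ + v × v ℕ.< suc k
shape-c≡0 (shape₁ α p u v c>0 eq) = contradiction (ℤP.+-injective (cong c eq)) λ e → ℕP.<⇒≢ c>0 e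
shape-c≡0 (shape₂ a δ u v eq) = contradiction (cong c eq) λ ()
shape-c≡0 (shape₂′ α p u v m>0 eq) = contradiction (cong a eq) λ e → -+≢suc (sym e)
shape-c≡0 (shape₃ δ w u v eq) = contradiction (cong c eq) λ ()
shape-c≡0 {k} (shape₄ zero w u v eq) = v , trans (cong b eq) (ℤP.+-identityʳ (+ v)) ,
  subst (v ℕ.<_) (sym (ℤP.+-injective (cong d eq))) (s≤s (ℕP.m≤n+m v (w ℕ.+ u)))
shape-c≡0 (shape₄ (suc _) w u v eq) = contradiction (cong c eq) λ ()

noShape-c≡0-neg : ∀ {k y} → ¬ Shape (mat -[1+ 0 ] y (+ 0) -[1+ k ])
noShape-c≡0-neg (shape₁ α p u v c>0 eq) = ℕP.<⇒≢ c>0 (ℤP.+-injective (cong c eq))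
noShape-c≡0-neg (shape₂ a δ u v ())
noShape-c≡0-neg (shape₂′ α p u v m>0 eq) = ℕP.<⇒≢ (ℕP.≤-trans m>0 (ℕP.m≤m+n (p ℕ.+ u) v))
    (ℤP.+-injective (cong c eq))
noShape-c≡0-neg (shape₃ δ w u v ())
noShape-c≡0-neg (shape₄ k w u v ())

-- With d = 0 one has a = p, and each of the first three cones gives 0 ≤ p ≤ c; the fourth has d >
-- 0.
shape-d≡0 : ∀ {k x} → Shape (mat x -[1+ 0 ] (+ k) (+ 0)) → ∃ λ v → x ≡ + v × v ℕ.< suc k
shape-d≡0 (shape₁ zero p u v _ eq) = 0 , cong a eq , s≤s z≤n
shape-d≡0 (shape₁ (suc α) p u v _ eq) = contradiction (cong d eq) λ ()
shape-d≡0 (shape₂ α δ u v eq) = suc α , cong a eq ,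
  s≤s (≤-summand (δ ℕ.+ u ℕ.+ v) (trans (ℤP.+-injective (cong c eq))
    (trans (cong (ℕ._+ v) (ℕP.+-assoc (suc α) δ u)) (ℕP.+-assoc (suc α) (δ ℕ.+ u) v))))
shape-d≡0 (shape₂′ zero p u v _ eq) = 0 , cong a eq , s≤s z≤n
shape-d≡0 (shape₂′ (suc α) p u v _ eq) = contradiction (cong d eq) λ ()
shape-d≡0 (shape₃ zero w u v eq) = suc (w ℕ.+ u) , cong a eq ,
  s≤s (≤-summand v (ℤP.+-injective (cong c eq)))
shape-d≡0 (shape₃ (suc δ) w u v eq) = contradiction (cong d eq) λ ()
shape-d≡0 (shape₄ k w u v eq) = contradiction (cong d eq) λ ()

-- A positive d leaves only the fourth cone, whose condition a > c contradicts the bound on x.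
noShape-c≡d : ∀ {k x y} → ∣ x ∣ ℕ.≤ suc k → ¬ Shape (mat x y (+ suc k) (+ suc k))
noShape-c≡d x≤k (shape₁ α p u v _ eq) = -+≢suc (sym (cong d eq))
noShape-c≡d x≤k (shape₂ _ δ u v eq) = -+≢suc (sym (cong d eq))
noShape-c≡d x≤k (shape₂′ α p u v _ eq) = -+≢suc (sym (cong d eq))
noShape-c≡d x≤k (shape₃ δ w u v eq) = -+≢suc (sym (cong d eq))
noShape-c≡d {k} x≤k (shape₄ l w u v eq) = ℕP.<⇒≱ (s≤s
    (ℕP.≤-trans (ℕP.≤-reflexive (ℤP.+-injective (cong c eq))) (ℕP.m≤m+n l w)))
  (subst (ℕ._≤ suc k) (cong ∣_∣ (cong a eq)) x≤k)

-- In both surviving cones 1 = α + m with α = −a ≥ 0 and m > 0, which leaves only k = 1, x = 0.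
shape-c≡-d : ∀ {k x} → Shape (mat x (- x - + 1) (+ suc k) -[1+ k ]) → k ≡ 0 × x ≡ + 0
shape-c≡-d {k} {x} (shape₁ α p u v c>0 eq) = k≡0 , trans (cong a eq) (cong (λ α → - + α) α≡0)
  where
  m≡ : + (p ℕ.+ u ℕ.+ v) ≡ + 1 - + α
  m≡ = trans (sym (ℤP.neg-involutive _)) (trans (cong -_ (sym (cong b eq)))
      (trans (lem x) (cong (λ t → + 1 + t) (cong a eq))))
    where
    lem : ∀ x → - (- x - + 1) ≡ + 1 + x
    lem = solve-∀
  sum≡1 : α ℕ.+ (p ℕ.+ u ℕ.+ v) ≡ 1
  sum≡1 = ℤP.+-injective (trans (cong (λ t → + α + t) m≡) (lem (+ α)))
    where
    lem : ∀ α → α + (+ 1 - α) ≡ + 1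
    lem = solve-∀
  sk≤ : suc k ℕ.≤ p ℕ.+ u ℕ.+ v
  sk≤ = subst (ℕ._≤ p ℕ.+ u ℕ.+ v) (sym (ℤP.+-injective (cong c eq))) (ℕP.m≤m+n (p ℕ.+ u) v)
  k≡0 : k ≡ 0
  k≡0 = ℕP.n≤0⇒n≡0 (ℕP.≤-pred (ℕP.≤-trans sk≤ (ℕP.≤-trans (ℕP.m≤n+m _ α) (ℕP.≤-reflexive sum≡1))))
  α≡0 : α ≡ 0
  α≡0 = ℕP.n≤0⇒n≡0 (ℕP.≤-pred (ℕP.≤-trans (ℕP.≤-reflexive (ℕP.+-comm 1 α))
      (ℕP.≤-trans (ℕP.+-monoʳ-≤ α (ℕP.≤-trans (s≤s z≤n) sk≤)) (ℕP.≤-reflexive sum≡1))))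
shape-c≡-d {k} (shape₂ a′ δ u v eq) = contradiction
    (trans (sym (ℤP.+-injective (cong c eq))) (-+-injective {suc k} (cong d eq)))
  λ e → ℕP.m≢1+m+n δ {a′ ℕ.+ u ℕ.+ v} (trans (sym e) (lem a′ δ u v))
  where
  lem : ∀ a δ u v → suc (a ℕ.+ δ ℕ.+ u ℕ.+ v) ≡ suc (δ ℕ.+ (a ℕ.+ u ℕ.+ v))
  lem = ℕSolver.solve-∀
shape-c≡-d {k} {x} (shape₂′ α p u v m>0 eq) = k≡0 , trans (cong a eq) (cong (λ α → - + α) α≡0)
  where
  m≡ : + (p ℕ.+ u) ≡ + 1 - + α
  m≡ = trans (sym (ℤP.neg-involutive _)) (trans (cong -_ (sym (cong b eq)))
      (trans (lem x) (cong (λ t → + 1 + t) (cong a eq))))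
    where
    lem : ∀ x → - (- x - + 1) ≡ + 1 + x
    lem = solve-∀
  sum≡1 : α ℕ.+ (p ℕ.+ u) ≡ 1
  sum≡1 = ℤP.+-injective (trans (cong (λ t → + α + t) m≡) (lem (+ α)))
    where
    lem : ∀ α → α + (+ 1 - α) ≡ + 1
    lem = solve-∀
  k≡0 : k ≡ 0
  k≡0 = ℕP.n≤0⇒n≡0 (ℕP.≤-pred (ℕP.≤-trans (ℕP.≤-reflexive (-+-injective {suc k} (cong d eq)))
    (ℕP.≤-trans (ℕP.+-monoʳ-≤ α (ℕP.m≤m+n p u)) (ℕP.≤-reflexive sum≡1))))
  α≡0 : α ≡ 0
  α≡0 = ℕP.n≤0⇒n≡0 (ℕP.≤-pred (ℕP.≤-trans (ℕP.≤-reflexive (ℕP.+-comm 1 α))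
      (ℕP.≤-trans (ℕP.+-monoʳ-≤ α m>0) (ℕP.≤-reflexive sum≡1))))
shape-c≡-d {k} (shape₃ δ w u v eq) = contradiction (trans (sym (ℤP.+-injective (cong c eq)))
    (-+-injective {suc k} (cong d eq)))
  λ e → ℕP.m≢1+m+n δ {w ℕ.+ u ℕ.+ v} (trans (sym e) (lem δ w u v))
  where
  lem : ∀ δ w u v → suc (δ ℕ.+ w ℕ.+ u ℕ.+ v) ≡ suc (δ ℕ.+ (w ℕ.+ u ℕ.+ v))
  lem = ℕSolver.solve-∀
shape-c≡-d (shape₄ l w u v eq) = contradiction (cong d eq) λ ()

-- Multiplied by diag(1, K) on the left they give (1, y; 0, K) and (x, -1; K, 0). `γ₂ 0` is S and
-- `γ₂ 1` is U.
γ₁ γ₂ : ℕ → Mat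
γ₁ y = mat (+ 1) (+ y) (+ 0) (+ 1)
γ₂ x = mat (+ x) -[1+ 0 ] (+ 1) (+ 0)

-- This is U².
γ₃ : Mat
γ₃ = mat (+ 0) -[1+ 0 ] (+ 1) -[1+ 0 ]

Listed : ℕ → Mat → Set
Listed k γ = (∃ λ y → y ℕ.< suc k × γ ~ γ₁ y) ⊎ (∃ λ x → x ℕ.< suc (suc k) × γ ~ γ₂ x) ⊎ (k ≡ 0 × γ ~ γ₃)

Listed-neg : ∀ {k γ} → Listed k (neg γ) → Listed k γ
Listed-neg {γ = γ} = λ where
    (inj₁ (y , y< , e)) → inj₁ (y , y< , ~-trans γ~-γ e)
    (inj₂ (inj₁ (x , x< , e))) → inj₂ (inj₁ (x , x< , ~-trans γ~-γ e))
    (inj₂ (inj₂ (k≡0 , e))) → inj₂ (inj₂ (k≡0 , ~-trans γ~-γ e))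
  where
  γ~-γ : γ ~ neg γ
  γ~-γ = inj₂ (sym (neg-involutive γ))

module _ (k : ℕ) where
  private K = suc k

  OrbitShape : Mat → Set
  OrbitShape (mat x y z w) = Shape (mat x y (+ K * z) (+ K * w)) ⊎ Shape (neg (mat x y (+ K * z) (+ K * w)))

  *0 : + K * + 0 ≡ + 0
  *0 = ℤP.*-zeroʳ (+ K)
  *1 : + K * + 1 ≡ + K
  *1 = ℤP.*-identityʳ (+ K)
  *-1 : + K * -[1+ 0 ] ≡ -[1+ k ]
  *-1 = trans (sym (ℤP.neg-distribʳ-* (+ K) (+ 1))) (cong -_ *1)

  listed-01 : ∀ x y → det (mat x y (+ 0) (+ 1)) ≡ + 1 → OrbitShape (mat x y (+ 0) (+ 1)) → Listed k
      (mat x y (+ 0) (+ 1))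
  listed-01 x y dγ shape rewrite *0 | *1 with trans (sym (lem x y)) dγ
    where
    lem : ∀ x y → x * + 1 - y * + 0 ≡ x
    lem = solve-∀
  ... | refl with shape
  ...   | inj₂ s = contradiction s noShape-c≡0-neg
  ...   | inj₁ s with shape-c≡0 s
  ...     | v , refl , v<K = inj₁ (v , v<K , ~-refl)

  listed-10 : ∀ x y → det (mat x y (+ 1) (+ 0)) ≡ + 1 → OrbitShape (mat x y (+ 1) (+ 0)) → Listed k
      (mat x y (+ 1) (+ 0))
  listed-10 x y dγ shape rewrite *0 | *1 with trans (lem x y) (cong -_ dγ)
    where
    lem : ∀ x y → y ≡ - (x * + 0 - y * + 1)
    lem = solve-∀
  ... | refl with shape
  ...   | inj₂ s = contradiction s noShape-c<0
  ...   | inj₁ s with shape-d≡0 s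
  ...     | v , refl , v<K = inj₂ (inj₁ (v , v<K , ~-refl))

  listed-11 : ∀ x y → ∣ x ∣ ℕ.≤ K → OrbitShape (mat x y (+ 1) (+ 1)) → Listed k (mat x y (+ 1) (+ 1))
  listed-11 x y x≤K shape rewrite *1 with shape
  ... | inj₁ s = contradiction s (noShape-c≡d x≤K)
  ... | inj₂ s = contradiction s noShape-c<0

  listed-1-1 : ∀ x y → det (mat x y (+ 1) -[1+ 0 ]) ≡ + 1 → OrbitShape (mat x y (+ 1) -[1+ 0 ]) →
      Listed k (mat x y (+ 1) -[1+ 0 ])
  listed-1-1 x y dγ shape rewrite *1 | *-1 with shape
  ... | inj₂ s = contradiction s noShape-c<0
  ... | inj₁ s with trans (lem x y) (cong (λ t → - x - t) dγ)
    where
    lem : ∀ x y → y ≡ - x - (x * -[1+ 0 ] - y * + 1)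
    lem = solve-∀
  ...   | refl with shape-c≡-d s
  ...     | refl , refl = inj₂ (inj₂ (refl , ~-refl))

  OrbitShape-neg : ∀ γ → OrbitShape γ → OrbitShape (neg γ)
  OrbitShape-neg (mat x y z w) = λ where
      (inj₁ s) → inj₂ (subst Shape (sym (trans (cong neg flip-neg) (neg-involutive N))) s)
      (inj₂ s) → inj₁ (subst Shape (sym flip-neg) s)
    where
    N = mat x y (+ K * z) (+ K * w)
    flip-neg : mat (- x) (- y) (+ K * - z) (+ K * - w) ≡ neg N
    flip-neg = mat≡ refl refl (sym (ℤP.neg-distribʳ-* (+ K) z)) (sym (ℤP.neg-distribʳ-* (+ K) w))

  -- The bounds leave nine bottom rows. The zero row has determinant 0, and the other eight are four
  -- pairs up to sign, one for each of the preceding lemmas.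
  listed : ∀ γ → det γ ≡ + 1 → ∣ a γ ∣ ℕ.≤ K → ∣ c γ ∣ ℕ.≤ 1 → ∣ d γ ∣ ℕ.≤ 1 → OrbitShape γ → Listed k γ
  listed (mat x y (+ 0) (+ 0)) dγ _ _ _ _ =
    contradiction (trans (sym dγ) (lem x y)) λ ()
    where
    lem : ∀ x y → x * + 0 - y * + 0 ≡ + 0
    lem = solve-∀
  listed (mat x y (+ 0) (+ 1)) dγ _ _ _ s = listed-01 x y dγ s
  listed (mat x y (+ 1) (+ 0)) dγ _ _ _ s = listed-10 x y dγ s
  listed (mat x y (+ 1) (+ 1)) dγ x≤ _ _ s = listed-11 x y x≤ s
  listed (mat x y (+ 1) -[1+ 0 ]) dγ _ _ _ s = listed-1-1 x y dγ s
  listed γ@(mat x y (+ 0) -[1+ 0 ]) dγ _ _ _ s =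
    Listed-neg (listed-01 (- x) (- y) (trans (det-neg γ) dγ) (OrbitShape-neg γ s))
  listed γ@(mat x y -[1+ 0 ] (+ 0)) dγ _ _ _ s =
    Listed-neg (listed-10 (- x) (- y) (trans (det-neg γ) dγ) (OrbitShape-neg γ s))
  listed γ@(mat x y -[1+ 0 ] -[1+ 0 ]) dγ x≤ _ _ s =
    Listed-neg (listed-11 (- x) (- y) (subst (ℕ._≤ K) (sym (ℤP.∣-i∣≡∣i∣ x)) x≤) (OrbitShape-neg γ s))
  listed γ@(mat x y -[1+ 0 ] (+ 1)) dγ _ _ _ s =
    Listed-neg (listed-1-1 (- x) (- y) (trans (det-neg γ) dγ) (OrbitShape-neg γ s))
  listed (mat _ _ (+ suc (suc _)) _) _ _ (s≤s ())
  listed (mat _ _ -[1+ suc _ ] _) _ _ (s≤s ())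
  listed (mat _ _ _ (+ suc (suc _))) _ _ _ (s≤s ())
  listed (mat _ _ _ -[1+ suc _ ]) _ _ _ (s≤s ())

  orbit-listed : ∀ γ → det γ ≡ + 1 → ¬ (orbit (diag K) γ ≡ 0ℚ) → Listed k γ
  orbit-listed γ@(mat x y z w) dγ T≢0 = listed γ dγ (∣a∣≤ B) (small z (∣c∣≤ B)) (small w (∣d∣≤ B))
      (Tq-shape N T≢0′)
    where
    open Box
    N = mat x y (+ K * z) (+ K * w)
    T≢0′ : ¬ (Tq N ≡ 0ℚ)
    T≢0′ = subst (λ M → ¬ (Tq M ≡ 0ℚ)) (diag-· K x y z w) T≢0
    dN : det N ≡ + K
    dN = trans (lem x y z w (+ K)) (trans (cong (+ K *_) dγ) (ℤP.*-identityʳ (+ K)))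
      where
      lem : ∀ x y z w k → x * (k * w) - y * (k * z) ≡ k * (x * w - y * z)
      lem = solve-∀
    B : Box K N
    B = Tq-bound K N dN T≢0′
    small : ∀ t → ∣ + K * t ∣ ℕ.≤ K → ∣ t ∣ ℕ.≤ 1
    small t h = ℕP.*-cancelˡ-≤ K (subst₂ ℕ._≤_ (ℤP.∣i*j∣≡∣i∣*∣j∣ (+ K) t) (sym (ℕP.*-identityʳ K)) h)

τ-zero : ∀ N → ¬ Shape N → τ (cellOf N) ≡ + 0
τ-zero N noShape = decidable-stable (τ (cellOf N) ℤ.≟ + 0) λ τ≢0 → noShape
    (cone-shape N (τ-support (cellOf N) τ≢0))

Tℤ-one-sided : ∀ N {z} → ¬ Shape (neg N) → τ (cellOf N) ≡ z → Tℤ N ≡ z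
Tℤ-one-sided N {z} noShape eq = trans (±-overReps tPiece N)
  (trans (cong₂ _+_ eq (τ-zero (neg N) noShape)) (ℤP.+-identityʳ z))

-- Here K = j + 2. The case K = 1 is computed separately, since there the end points y = 0 and y = K
-- - 1 coincide.
N₁ N₂ : ℕ → ℕ → Mat
N₁ j y = mat (+ 1) (+ y) (+ 0) (+ suc (suc j))
N₂ j x = mat (+ x) -[1+ 0 ] (+ suc (suc j)) (+ 0)

-- The ends lie on walls of the fourth cone, m = c for y = 0 and m = p for y = K - 1, whence the
-- weight 1/2; in between the weight is 1.
τ-N₁-first : ∀ j → τ (cellOf (N₁ j 0)) ≡ + 12
τ-N₁-first j rewrite cellOf-mat (+ 1) (+ 0) (+ 0) (+ suc (suc j)) = refl

τ-N₁-last : ∀ j → τ (cellOf (N₁ j (suc j))) ≡ + 12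
τ-N₁-last j = trans (cong τ (cellOf-mat (+ 1) (+ suc j) (+ 0) (+ suc (suc j))))
  (go (- + suc j - (+ 1 - + suc (suc j))) (lem (+ j)))
  where
  lem : ∀ j → - (+ 1 + j) - (+ 1 - (+ 2 + j)) ≡ + 0
  lem = solve-∀
  go : ∀ z → z ≡ + 0 → τ (cell ⁺ ⁻ ⁰ ⁺ ⁻ ⁺ (sgn z) ⁺ (sgn (+ suc (suc j) - + suc j)) ⁺) ≡ + 12
  go _ refl = refl

τ-N₁-middle : ∀ i r → τ (cellOf (N₁ (suc i ℕ.+ r) (suc i))) ≡ + 24
τ-N₁-middle i r = trans (cong τ (cellOf-mat (+ 1) (+ suc i) (+ 0) (+ suc (suc (suc i ℕ.+ r)))))
  (go (- + suc i - (+ 1 - + suc (suc (suc i ℕ.+ r)))) (lem (+ i) (+ r)))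
  where
  lem : ∀ i r → - (+ 1 + i) - (+ 1 - (+ 3 + (i + r))) ≡ + 1 + r
  lem = solve-∀
  go : ∀ z → z ≡ + suc r → τ (cell ⁺ ⁻ ⁰ ⁺ ⁻ ⁺ (sgn z) ⁺
      (sgn (+ suc (suc (suc i ℕ.+ r)) - + suc i)) ⁺) ≡ + 24
  go _ refl = refl

τ-N₂-0 : ∀ j → τ (cellOf (N₂ j 0)) ≡ -[1+ 11 ]
τ-N₂-0 j rewrite cellOf-mat (+ 0) -[1+ 0 ] (+ suc (suc j)) (+ 0) = refl

-- For x = 1 the matrix lies on the wall p = m shared by the second and the third cone, and each
-- contributes -1/2.
τ-N₂-1 : ∀ j → τ (cellOf (N₂ j 1)) ≡ -[1+ 23 ]
τ-N₂-1 j rewrite cellOf-mat (+ 1) -[1+ 0 ] (+ suc (suc j)) (+ 0) = refl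

τ-N₂-middle : ∀ i r → τ (cellOf (N₂ (suc i ℕ.+ r) (suc (suc i)))) ≡ -[1+ 23 ]
τ-N₂-middle i r = trans (cong τ (cellOf-mat (+ suc (suc i)) -[1+ 0 ] (+ suc (suc (suc i ℕ.+ r))) (+ 0)))
  (go (+ suc (suc (suc i ℕ.+ r)) - (+ suc (suc i) - + 0)) (+ suc (suc i) - + suc (suc (suc i ℕ.+ r)))
      (lem (+ i) (+ r)) (lem′ (+ i) (+ r)))
  where
  lem : ∀ i r → + 3 + (i + r) - (+ 2 + i - + 0) ≡ + 1 + r
  lem = solve-∀
  lem′ : ∀ i r → + 2 + i - (+ 3 + (i + r)) ≡ - (+ 1 + r)
  lem′ = solve-∀
  go : ∀ z w → z ≡ + suc r → w ≡ -[1+ r ] → τ (cell ⁺ ⁺ ⁺ ⁰ ⁺ (sgn z) ⁻ ⁺ ⁺ (sgn w)) ≡ -[1+ 23 ]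
  go _ _ refl refl = refl

τ-N₂-last : ∀ j → τ (cellOf (N₂ j (suc (suc j)))) ≡ -[1+ 11 ]
τ-N₂-last j = trans (cong τ (cellOf-mat (+ suc (suc j)) -[1+ 0 ] (+ suc (suc j)) (+ 0)))
  (go (+ suc (suc j) - (+ suc (suc j) - + 0)) (+ suc (suc j) - + suc (suc j)) (lem (+ suc (suc j)))
      (ℤP.+-inverseʳ (+ suc (suc j))))
  where
  lem : ∀ k → k - (k - + 0) ≡ + 0
  lem = solve-∀
  go : ∀ z w → z ≡ + 0 → w ≡ + 0 → τ (cell ⁺ ⁺ ⁺ ⁰ ⁺ (sgn z) ⁻ ⁺ ⁺ (sgn w)) ≡ -[1+ 11 ]
  go _ _ refl refl = refl

orbit-γ₁ : ∀ j y {z} → τ (cellOf (N₁ j y)) ≡ z → orbit (diag (suc (suc j))) (γ₁ y) ≡ ι z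
orbit-γ₁ j y eq = cong ι (trans
  (cong Tℤ (trans (diag-· K (+ 1) (+ y) (+ 0) (+ 1))
      (mat≡ refl refl (ℤP.*-zeroʳ (+ K)) (ℤP.*-identityʳ (+ K)))))
  (Tℤ-one-sided (N₁ j y) noShape-c≡0-neg eq))
  where K = suc (suc j)

orbit-γ₂ : ∀ j x {z} → τ (cellOf (N₂ j x)) ≡ z → orbit (diag (suc (suc j))) (γ₂ x) ≡ ι z
orbit-γ₂ j x eq = cong ι (trans
  (cong Tℤ (trans (diag-· K (+ x) -[1+ 0 ] (+ 1) (+ 0))
      (mat≡ refl refl (ℤP.*-identityʳ (+ K)) (ℤP.*-zeroʳ (+ K)))))
  (Tℤ-one-sided (N₂ j x) noShape-c<0 eq))
  where K = suc (suc j)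

sum-snoc : ∀ f n → sumℚ (applyUpTo f (suc n)) ≡ sumℚ (applyUpTo f n) ℚ.+ f n
sum-snoc f zero = trans (ℚP.+-identityʳ (f 0)) (sym (ℚP.+-identityˡ (f 0)))
sum-snoc f (suc n) = trans (cong (f 0 ℚ.+_) (sum-snoc (f ∘ suc) n)) (sym (ℚP.+-assoc (f 0) _ (f (suc n))))

sum-ι-const : ∀ f z n → (∀ i → i ℕ.< n → f i ≡ ι z) → sumℚ (applyUpTo f n) ≡ ι (+ n * z)
sum-ι-const f z zero _ = refl
sum-ι-const f z (suc n) eq = trans
  (cong₂ ℚ._+_ (eq 0 (s≤s z≤n)) (sum-ι-const (f ∘ suc) z n (λ i i<n → eq (suc i) (s≤s i<n))))
  (trans (sym (ι-+ z (+ n * z))) (cong ι (lem z (+ n))))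
  where
  lem : ∀ z n → z + n * z ≡ (+ 1 + n) * z
  lem = solve-∀

sum-++ : ∀ xs ys → sumℚ (xs ++ ys) ≡ sumℚ xs ℚ.+ sumℚ ys
sum-++ [] ys = sym (ℚP.+-identityˡ (sumℚ ys))
sum-++ (x ∷ xs) ys = trans (cong (x ℚ.+_) (sum-++ xs ys)) (sym (ℚP.+-assoc x (sumℚ xs) (sumℚ ys)))

gap : ∀ {P : ℕ → Set} {i j} → i ℕ.< j → (∀ r → P (suc i ℕ.+ r)) → P j
gap {P} {i} {j} i<j h = subst P (ℕP.m+[n∸m]≡n i<j) (h (j ℕ.∸ suc i))

-- Two ends of weight 1/2 and j interior points of weight 1: the total is j + 1.
sum-γ₁ : ∀ j → sumℚ (map (orbit (diag (suc (suc j)))) (applyUpTo γ₁ (suc (suc j)))) ≡ ι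
    (+ 12 + (+ j * + 24 + + 12))
sum-γ₁ j = begin
  sumℚ (map h (applyUpTo γ₁ (suc (suc j))))
    ≡⟨ cong sumℚ (map-applyUpTo γ₁ h (suc (suc j))) ⟩
  h (γ₁ 0) ℚ.+ sumℚ (applyUpTo (h ∘ γ₁ ∘ suc) (suc j))
    ≡⟨ cong₂ ℚ._+_ (orbit-γ₁ j 0 (τ-N₁-first j)) (trans (sum-snoc (h ∘ γ₁ ∘ suc) j) (cong₂ ℚ._+_
         (sum-ι-const (h ∘ γ₁ ∘ suc) (+ 24) j λ i i<j → orbit-γ₁ j (suc i)
           (gap {λ j → τ (cellOf (N₁ j (suc i))) ≡ + 24} i<j (τ-N₁-middle i)))
         (orbit-γ₁ j (suc j) (τ-N₁-last j)))) ⟩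
  ι (+ 12) ℚ.+ (ι (+ j * + 24) ℚ.+ ι (+ 12))
    ≡⟨ cong (ι (+ 12) ℚ.+_) (ι-+ (+ j * + 24) (+ 12)) ⟨
  ι (+ 12) ℚ.+ ι (+ j * + 24 + + 12)
    ≡⟨ ι-+ (+ 12) (+ j * + 24 + + 12) ⟨
  ι (+ 12 + (+ j * + 24 + + 12)) ∎
  where
  open ≡-Reasoning
  h = orbit (diag (suc (suc j)))

-- Ends -1/2 at x = 0 (wall p = 0) and at x = K (wall p = c), and -1 at the j + 1 points between:
-- the total is -(j + 2), one more in absolute value than for `γ₁`.
sum-γ₂ : ∀ j → sumℚ (map (orbit (diag (suc (suc j)))) (applyUpTo γ₂ (suc (suc (suc j)))))
               ≡ ι (-[1+ 11 ] + (-[1+ 23 ] + (+ j * -[1+ 23 ] + -[1+ 11 ])))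
sum-γ₂ j = begin
  sumℚ (map h (applyUpTo γ₂ (suc (suc (suc j)))))
    ≡⟨ cong sumℚ (map-applyUpTo γ₂ h (suc (suc (suc j)))) ⟩
  h (γ₂ 0) ℚ.+ (h (γ₂ 1) ℚ.+ sumℚ (applyUpTo (h ∘ γ₂ ∘ suc ∘ suc) (suc j)))
    ≡⟨ cong₂ ℚ._+_ (orbit-γ₂ j 0 (τ-N₂-0 j)) (cong₂ ℚ._+_ (orbit-γ₂ j 1 (τ-N₂-1 j))
         (trans (sum-snoc (h ∘ γ₂ ∘ suc ∘ suc) j) (cong₂ ℚ._+_
           (sum-ι-const (h ∘ γ₂ ∘ suc ∘ suc) -[1+ 23 ] j λ i i<j → orbit-γ₂ j (suc (suc i))
             (gap {λ j → τ (cellOf (N₂ j (suc (suc i)))) ≡ -[1+ 23 ]} i<j (τ-N₂-middle i)))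
           (orbit-γ₂ j (suc (suc j)) (τ-N₂-last j))))) ⟩
  ι -[1+ 11 ] ℚ.+ (ι -[1+ 23 ] ℚ.+ (ι (+ j * -[1+ 23 ]) ℚ.+ ι -[1+ 11 ]))
    ≡⟨ cong (λ q → ι -[1+ 11 ] ℚ.+ (ι -[1+ 23 ] ℚ.+ q)) (ι-+ (+ j * -[1+ 23 ]) -[1+ 11 ]) ⟨
  ι -[1+ 11 ] ℚ.+ (ι -[1+ 23 ] ℚ.+ ι (+ j * -[1+ 23 ] + -[1+ 11 ]))
    ≡⟨ cong (ι -[1+ 11 ] ℚ.+_) (ι-+ -[1+ 23 ] (+ j * -[1+ 23 ] + -[1+ 11 ])) ⟨
  ι -[1+ 11 ] ℚ.+ ι (-[1+ 23 ] + (+ j * -[1+ 23 ] + -[1+ 11 ]))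
    ≡⟨ ι-+ -[1+ 11 ] (-[1+ 23 ] + (+ j * -[1+ 23 ] + -[1+ 11 ])) ⟨
  ι (-[1+ 11 ] + (-[1+ 23 ] + (+ j * -[1+ 23 ] + -[1+ 11 ]))) ∎
  where
  open ≡-Reasoning
  h = orbit (diag (suc (suc j)))

extra : ℕ → List Mat
extra zero = γ₃ ∷ []
extra (suc _) = []

diagClasses : ℕ → List Mat
diagClasses k = applyUpTo γ₁ (suc k) ++ applyUpTo γ₂ (suc (suc k)) ++ extra k

sum-diagClasses : ∀ k → sumℚ (map (orbit (diag (suc k))) (diagClasses k)) ≡ ℚ.- 1ℚ
-- For K = 1 the classes 1, S, U, U² carry 1/6, -1/2, -1/3, -1/3.
sum-diagClasses zero = refl
sum-diagClasses (suc j) = begin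
  sumℚ (map h (A ++ B ++ []))
    ≡⟨ cong sumℚ (trans (map-++ h A (B ++ [])) (cong (map h A ++_) (map-++ h B []))) ⟩
  sumℚ (map h A ++ map h B ++ [])
    ≡⟨ trans (sum-++ (map h A) (map h B ++ [])) (cong (sumℚ (map h A) ℚ.+_) (sum-++ (map h B) [])) ⟩
  sumℚ (map h A) ℚ.+ (sumℚ (map h B) ℚ.+ 0ℚ)
    ≡⟨ cong₂ (λ p q → p ℚ.+ q) (sum-γ₁ j) (trans (ℚP.+-identityʳ (sumℚ (map h B))) (sum-γ₂ j)) ⟩
  ι (+ 12 + (+ j * + 24 + + 12)) ℚ.+ ι (-[1+ 11 ] + (-[1+ 23 ] + (+ j * -[1+ 23 ] + -[1+ 11 ])))
    ≡⟨ ι-+ (+ 12 + (+ j * + 24 + + 12)) (-[1+ 11 ] + (-[1+ 23 ] + (+ j * -[1+ 23 ] + -[1+ 11 ]))) ⟨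
  ι (+ 12 + (+ j * + 24 + + 12) + (-[1+ 11 ] + (-[1+ 23 ] + (+ j * -[1+ 23 ] + -[1+ 11 ]))))
    ≡⟨ cong ι (lem (+ j)) ⟩
  ℚ.- 1ℚ ∎
  where
  open ≡-Reasoning
  h = orbit (diag (suc (suc j)))
  A = applyUpTo γ₁ (suc (suc j))
  B = applyUpTo γ₂ (suc (suc (suc j)))
  lem : ∀ j → + 12 + (j * + 24 + + 12) + (-[1+ 11 ] + (-[1+ 23 ] + (j * -[1+ 23 ] + -[1+ 11 ]))) ≡ -[1+ 23 ]
  lem = solve-∀

γ₁≁γ₁ : ∀ {i j} → i ℕ.< j → ¬ (γ₁ i ~ γ₁ j)
γ₁≁γ₁ i<j (inj₁ e) = ℕP.<⇒≢ i<j (ℤP.+-injective (cong b e))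
γ₁≁γ₁ i<j (inj₂ e) = contradiction (cong a e) λ ()

γ₂≁γ₂ : ∀ {i j} → i ℕ.< j → ¬ (γ₂ i ~ γ₂ j)
γ₂≁γ₂ i<j (inj₁ e) = ℕP.<⇒≢ i<j (ℤP.+-injective (cong a e))
γ₂≁γ₂ i<j (inj₂ e) = contradiction (cong c e) λ ()

γ₁≁γ₂ : ∀ i j → ¬ (γ₁ i ~ γ₂ j)
γ₁≁γ₂ i j (inj₁ e) = contradiction (cong c e) λ ()
γ₁≁γ₂ i j (inj₂ e) = contradiction (cong c e) λ ()

extra-distinct : ∀ k → AllPairs (λ P Q → ¬ (P ~ Q)) (extra k)
extra-distinct zero = [] ∷ []
extra-distinct (suc k) = []

γ₁≁extra : ∀ k i → All (λ Q → ¬ (γ₁ i ~ Q)) (extra k)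
γ₁≁extra zero i = (λ { (inj₁ e) → contradiction (cong c e) λ () ; (inj₂ e) → contradiction (cong c e) λ
    () }) ∷ []
γ₁≁extra (suc k) i = []

γ₂≁extra : ∀ k i → All (λ Q → ¬ (γ₂ i ~ Q)) (extra k)
γ₂≁extra zero i = (λ { (inj₁ e) → contradiction (cong d e) λ () ; (inj₂ e) → contradiction (cong d e) λ
    () }) ∷ []
γ₂≁extra (suc k) i = []

diag-base : ∀ k → Sums (orbit (diag (suc k))) (ℚ.- 1ℚ)
diag-base k = diagClasses k , record
  { dets = AllP.++⁺ (AllP.applyUpTo⁺₂ γ₁ (suc k) (λ i → det-γ₁ (+ i)))
      (AllP.++⁺ (AllP.applyUpTo⁺₂ γ₂ (suc (suc k)) (λ i → det-γ₂ (+ i))) (det-extra k))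
  ; distinct = AllPairsP.++⁺ (AllPairsP.applyUpTo⁺₁ γ₁ (suc k) (λ i<j _ → γ₁≁γ₁ i<j))
      (AllPairsP.++⁺ (AllPairsP.applyUpTo⁺₁ γ₂ (suc (suc k)) (λ i<j _ → γ₂≁γ₂ i<j)) (extra-distinct k)
        (AllP.applyUpTo⁺₂ γ₂ (suc (suc k)) (γ₂≁extra k)))
      (AllP.applyUpTo⁺₂ γ₁ (suc k) λ i → AllP.++⁺ (AllP.applyUpTo⁺₂ γ₂ (suc (suc k)) (γ₁≁γ₂ i))
          (γ₁≁extra k i))
  ; covers = λ γ dγ h≢0 → locateClass γ (orbit-listed k γ dγ h≢0)
  } , sum-diagClasses k
  where
  det-γ₁ : ∀ y → + 1 * + 1 - y * + 0 ≡ + 1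
  det-γ₁ = solve-∀
  det-γ₂ : ∀ x → x * + 0 - -[1+ 0 ] * + 1 ≡ + 1
  det-γ₂ = solve-∀
  det-extra : ∀ k → All (λ M → det M ≡ + 1) (extra k)
  det-extra zero = refl ∷ []
  det-extra (suc k) = []
  locateClass : ∀ γ → Listed k γ → Any (γ ~_) (diagClasses k)
  locateClass γ (inj₁ (y , y< , e)) = AnyP.++⁺ˡ (AnyP.applyUpTo⁺ γ₁ e y<)
  locateClass γ (inj₂ (inj₁ (x , x< , e))) = AnyP.++⁺ʳ (applyUpTo γ₁ (suc k))
      (AnyP.++⁺ˡ (AnyP.applyUpTo⁺ γ₂ e x<))
  locateClass γ (inj₂ (inj₂ (refl , e))) = AnyP.++⁺ʳ (applyUpTo γ₁ 1) (AnyP.++⁺ʳ (applyUpTo γ₂ 2) (here e))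

scalar-base : ∀ g k → Sums (orbit (mat (+ suc g) (+ 0) (+ 0) (+ suc k * + suc g))) (ℚ.- 1ℚ)
scalar-base g k = Sums-cong (λ γ _ → trans (sym (Tq-scalarMul g (diag (suc k) · γ)))
    (cong Tq (scaled γ))) (diag-base k)
  where
  scaled : ∀ γ → scalarMul (suc g) (diag (suc k) · γ) ≡ mat (+ suc g) (+ 0) (+ 0) (+ suc k * + suc g) · γ
  scaled (mat x y z w) = mat≡ (lem₁ (+ suc g) x z) (lem₁ (+ suc g) y w)
    (lem₂ (+ suc g) (+ suc k) x z) (lem₂ (+ suc g) (+ suc k) y w)
    where
    lem₁ : ∀ g x z → g * (+ 1 * x + + 0 * z) ≡ g * x + + 0 * z
    lem₁ = solve-∀
    lem₂ : ∀ g k x z → g * (+ 0 * x + k * z) ≡ + 0 * x + k * g * z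
    lem₂ = solve-∀

-- From sums over Γ to sums over cosets

·-cancelˡ : ∀ M P Q → + 0 < det M → M · P ≡ M · Q → P ≡ Q
·-cancelˡ M P Q det>0 e = mat≡ (by (cong a e′)) (by (cong b e′)) (by (cong c e′)) (by (cong d e′))
  where
  e′ : mat (det M * a P) (det M * b P) (det M * c P) (det M * d P)
       ≡ mat (det M * a Q) (det M * b Q) (det M * c Q) (det M * d Q)
  e′ = trans (sym (adjM·M M P)) (trans (cong (adj M ·_) e) (adjM·M M Q))
  by : ∀ {x y} → det M * x ≡ det M * y → x ≡ y
  by {x} {y} = ℤP.*-cancelˡ-≡ (det M) x y {{ℤ.>-nonZero det>0}}

orbit-sum : ∀ M → + 0 < det M → Sums (orbit M) (ℚ.- 1ℚ)
orbit-sum = Reduction.all-orbits (λ M → Sums (orbit M)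
    (ℚ.- 1ℚ)) orbit-right orbit-U orbit-S orbit-neg scalar-base

-- γ ↦ M γ is injective modulo ±1 because det M is nonzero, so the list for Γ times M presents the
-- coset. Two functions appear because invariance under ±1 is available for `Tq`, which agrees with
-- `T̃` at positive determinant.
coset-sum : ∀ {f g s} M → + 0 < det M → (∀ N → + 0 < det N → f N ≡ g N) → Invariant g →
  Sums (λ γ → g (M · γ)) s →
  ∃ λ (L : List Mat) → All (InCoset M) L × AllPairs (λ P Q → ¬ (P ~ Q)) L ×
    ((N : Mat) → InCoset M N → ¬ (f N ≡ 0ℚ) → Any (N ~_) L) ×
    sumℚ (map f L) ≡ s
coset-sum {f} {g} M M>0 f≡g inv (L , C , sum) = map (M ·_) L
    , AllP.map⁺ (All.map (λ {γ} dγ → γ , dγ , ~-refl) (dets C))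
    , AllPairsP.map⁺ (AllPairs.map (λ P≁Q e → P≁Q (cancel e)) (distinct C))
    , covered
    , trans (cong sumℚ (sym (map-∘ L)))
        (trans (sum-cong (f ∘ (M ·_)) (g ∘ (M ·_)) (λ {γ} dγ → f≡g (M · γ) (det>0-· M γ M>0 dγ))
            (dets C)) sum)
  where
  cancel : ∀ {P Q} → (M · P) ~ (M · Q) → P ~ Q
  cancel {P} {Q} (inj₁ e) = inj₁ (·-cancelˡ M P Q M>0 e)
  cancel {P} {Q} (inj₂ e) = inj₂ (·-cancelˡ M P (neg Q) M>0 (trans e (sym (neg-·ʳ M Q))))
  covered : (N : Mat) → InCoset M N → ¬ (f N ≡ 0ℚ) → Any (N ~_) (map (M ·_) L)
  covered N (γ , dγ , N~Mγ) f≢0 = AnyP.map⁺ (Any.map (λ γ~δ → ~-trans N~Mγ (~-·ˡ M γ~δ))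
    (covers C γ dγ λ h≡0 → f≢0 (trans (f≡g N N>0) (trans (inv N~Mγ) h≡0))))
    where
    N>0 : + 0 < det N
    N>0 = subst (+ 0 <_) (sym (~-det N~Mγ)) (det>0-· M γ M>0 dγ)

coset-sum-T̃ : (M : Mat) → + 1 ℤ.≤ det M →
  ∃ λ (L : List Mat) → All (InCoset M) L × AllPairs (λ P Q → ¬ (P ~ Q)) L ×
    ((N : Mat) → InCoset M N → ¬ (T̃ N ≡ 0ℚ) → Any (N ~_) L) ×
    sumℚ (map T̃ L) ≡ ℚ.- 1ℚ
coset-sum-T̃ M 1≤det = coset-sum {T̃} {Tq} M M>0 T̃-ι Tq-invariant (orbit-sum M M>0)
  where
  M>0 : + 0 < det M
  M>0 = ℤP.<-≤-trans (+<+ (s≤s z≤n)) 1≤det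

theorem4 : ((n : ℕ) → 1 ≤ n →
    (∃ λ (η : FinSum) → All (λ e → det (Data.Product.proj₂ e) ≡ + n) η ×
    ((N : Mat) → restrict n T̃ N Data.Rational.+ (restrict n T̃ ◃ S) N
    ≡ coeff η N Data.Rational.+ (U ▹ coeff η) N
    Data.Rational.+ ((U · U) ▹ coeff η) N))
    ×
    (∃ λ (η : FinSum) → All (λ e → det (Data.Product.proj₂ e) ≡ + n) η ×
    ((N : Mat) → restrict n T̃ N Data.Rational.+ (restrict n T̃ ◃ U) N
    Data.Rational.+ (restrict n T̃ ◃ (U · U)) N
    ≡ coeff η N Data.Rational.+ (S ▹ coeff η) N)))
    ×
    ((M : Mat) → + 1 Data.Integer.≤ det M →
    ∃ λ (L : List Mat) → All (InCoset M) L × AllPairs (λ P Q → ¬ (P ~ Q)) L ×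
    ((N : Mat) → InCoset M N → ¬ (T̃ N ≡ Data.Rational.0ℚ) → Any (N ~_) L) ×
    sumℚ (map T̃ L) ≡ Data.Rational.- Data.Rational.1ℚ)
theorem4 = (λ n 1≤n → realize-1+S n 1≤n , realize-1+U+U² n 1≤n) , coset-sum-T̃
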